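{- For every rational number $\ell > 1$ there exists an integer $N(\ell)$ such that for every integer $m > N(\ell)$ for which $\ell \cdot m$ is an integer, the complete bipartite graph $K_{m,\ell\cdot m}$ is not stable, i.e., its independence polynomial has a root $z$ with $\mathrm{Re}(z) > 0$.
   Context: For a simple graph $G$, the independence polynomial is $i(G,x)=\sum_{k=0}^{\alpha(G)} i_k(G)x^k$, where $i_k(G)$ is the number of independent sets of size $k$ in $G$ (with $i_0(G)=1$) and $\alpha(G)$ is the independence number. A graph $G$ is called stable if every root $z$ of $i(G,x)$ satisfies $\mathrm{Re}(z)\leq 0$. $K_{a,b}$ denotes the complete bipartite graph with parts of sizes $a$ and $b$; its independence polynomial is $(1+x)^a+(1+x)^b-1$. -}

module Defs where

open import Algebra.Bundles.Raw using (RawSemiring)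
import Algebra.Definitions.RawSemiring as RawSemiringDefs
open import Data.Fin.Base using (Fin; toℕ; splitAt)
open import Data.Fin.Properties using (all?)
open import Data.Fin.Subset using (Subset; _∈_; ∣_∣; inside; outside)
open import Data.Fin.Subset.Properties using (_∈?_)
open import Data.List.Base using (List; []; _∷_; _++_; map; filter; length)
open import Data.List.Extrema.Nat using (max)
open import Data.Nat.Base as ℕ using (ℕ; zero; suc)
import Data.Nat.Properties as ℕ
open import Data.Product.Base using (∃; _×_; _,_; proj₁; proj₂)
open import Data.Rational.Base as ℚ using (ℚ; 0ℚ; 1ℚ; ½)
import Data.Rational.Properties as ℚ
open import Data.Rational.Solver using (module +-*-Solver)
open import Data.Sum.Base using (_⊎_; inj₁; inj₂)
open import Data.Vec.Base using ([]; _∷_)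
open import Level using (0ℓ)
open import Relation.Binary.Core using (Rel)
open import Relation.Binary.Definitions using (Decidable; Irreflexive; Symmetric)
open import Relation.Binary.PropositionalEquality
  using (_≡_; refl; sym; trans; cong; cong₂; subst)
open import Relation.Nullary using (¬_; yes; no; ¬?)
open import Relation.Nullary.Decidable using (_→-dec_)
import Relation.Unary as U

Eventually : (ℕ → Set) → Set
Eventually P = ∃ λ N → ∀ n → N ℕ.≤ n → P n

IsCauchy : (ℕ → ℚ) → Set
IsCauchy x = ∀ ε → 0ℚ ℚ.< ε →
  ∃ λ N → ∀ m n → N ℕ.≤ m → N ℕ.≤ n → ℚ.∣ x m ℚ.- x n ∣ ℚ.< ε

private

  constant-cauchy : ∀ q → IsCauchy (λ _ → q)
  constant-cauchy q ε 0<ε = 0 , λ _ _ _ _ →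
    subst (λ r → ℚ.∣ r ∣ ℚ.< ε) (sym (ℚ.+-inverseʳ q)) 0<ε

  +-cauchy : ∀ {x y} → IsCauchy x → IsCauchy y → IsCauchy (λ n → x n ℚ.+ y n)
  +-cauchy {x} {y} cx cy ε 0<ε = M ℕ.⊔ N , bound
    where
    δ = ½ ℚ.* ε

    0<δ : 0ℚ ℚ.< δ
    0<δ = subst (ℚ._< δ) (ℚ.*-zeroʳ ½) (ℚ.*-monoʳ-<-pos ½ 0<ε)

    M = proj₁ (cx δ 0<δ)
    N = proj₁ (cy δ 0<δ)

    δ+δ≡ε : δ ℚ.+ δ ≡ ε
    δ+δ≡ε = trans (sym (ℚ.*-distribʳ-+ ε ½ ½)) (ℚ.*-identityˡ ε)

    rearrange : ∀ a b c d →
      (a ℚ.+ b) ℚ.- (c ℚ.+ d) ≡ (a ℚ.- c) ℚ.+ (b ℚ.- d)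
    rearrange = solve 4
      (λ a b c d → (a :+ b) :- (c :+ d) := (a :- c) :+ (b :- d)) refl
      where open +-*-Solver

    bound : ∀ m n → M ℕ.⊔ N ℕ.≤ m → M ℕ.⊔ N ℕ.≤ n →
            ℚ.∣ (x m ℚ.+ y m) ℚ.- (x n ℚ.+ y n) ∣ ℚ.< ε
    bound m n ≤m ≤n = begin-strict
      ℚ.∣ (x m ℚ.+ y m) ℚ.- (x n ℚ.+ y n) ∣
        ≡⟨ cong ℚ.∣_∣ (rearrange (x m) (y m) (x n) (y n)) ⟩
      ℚ.∣ (x m ℚ.- x n) ℚ.+ (y m ℚ.- y n) ∣
        ≤⟨ ℚ.∣p+q∣≤∣p∣+∣q∣ (x m ℚ.- x n) (y m ℚ.- y n) ⟩
      ℚ.∣ x m ℚ.- x n ∣ ℚ.+ ℚ.∣ y m ℚ.- y n ∣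
        <⟨ ℚ.+-mono-<
             (proj₂ (cx δ 0<δ) m n
               (ℕ.m⊔n≤o⇒m≤o M N ≤m) (ℕ.m⊔n≤o⇒m≤o M N ≤n))
             (proj₂ (cy δ 0<δ) m n
               (ℕ.m⊔n≤o⇒n≤o M N ≤m) (ℕ.m⊔n≤o⇒n≤o M N ≤n)) ⟩
      δ ℚ.+ δ
        ≡⟨ δ+δ≡ε ⟩
      ε ∎
      where open ℚ.≤-Reasoning

  neg-cauchy : ∀ {x} → IsCauchy x → IsCauchy (λ n → ℚ.- x n)
  neg-cauchy {x} cx ε 0<ε with cx ε 0<ε
  ... | N , p = N , λ m n N≤m N≤n →
    subst (ℚ._< ε)
      (trans (sym (ℚ.∣-p∣≡∣p∣ (x m ℚ.- x n)))
             (cong ℚ.∣_∣ (ℚ.neg-distrib-+ (x m) (ℚ.- x n))))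
      (p m n N≤m N≤n)

  eventually-bounded : ∀ {x} → IsCauchy x →
    ∃ λ B → 0ℚ ℚ.< B × Eventually (λ n → ℚ.∣ x n ∣ ℚ.< B)
  eventually-bounded {x} cx with cx 1ℚ (ℚ.positive⁻¹ 1ℚ)
  ... | N , p = B , 0<B , N , bound
    where
    B = 1ℚ ℚ.+ ℚ.∣ x N ∣

    0<B : 0ℚ ℚ.< B
    0<B = ℚ.+-mono-<-≤ (ℚ.positive⁻¹ 1ℚ) (ℚ.0≤∣p∣ (x N))

    cancel : ∀ a b → a ≡ (a ℚ.- b) ℚ.+ b
    cancel = solve 2 (λ a b → a := (a :- b) :+ b) refl
      where open +-*-Solver

    bound : ∀ n → N ℕ.≤ n → ℚ.∣ x n ∣ ℚ.< B
    bound n N≤n = begin-strict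
      ℚ.∣ x n ∣                         ≡⟨ cong ℚ.∣_∣ (cancel (x n) (x N)) ⟩
      ℚ.∣ (x n ℚ.- x N) ℚ.+ x N ∣       ≤⟨ ℚ.∣p+q∣≤∣p∣+∣q∣ (x n ℚ.- x N) (x N) ⟩
      ℚ.∣ x n ℚ.- x N ∣ ℚ.+ ℚ.∣ x N ∣   <⟨ ℚ.+-monoˡ-< ℚ.∣ x N ∣ (p n N N≤n ℕ.≤-refl) ⟩
      B                                 ∎
      where open ℚ.≤-Reasoning

  *-mono-bound : ∀ {a b c d} → 0ℚ ℚ.< b → a ℚ.< b → 0ℚ ℚ.≤ c → c ℚ.< d →
                 a ℚ.* c ℚ.< b ℚ.* d
  *-mono-bound {a} {b} {c} {d} 0<b a<b 0≤c c<d = ℚ.≤-<-trans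
    (ℚ.*-monoʳ-≤-nonNeg c {{ℚ.nonNegative 0≤c}} (ℚ.<⇒≤ a<b))
    (ℚ.*-monoʳ-<-pos b {{ℚ.positive 0<b}} c<d)

  divide : ∀ c ε → 0ℚ ℚ.< c → 0ℚ ℚ.< ε → ∃ λ δ → 0ℚ ℚ.< δ × c ℚ.* δ ≡ ε
  divide c ε 0<c 0<ε = c⁻¹ ℚ.* ε , 0<c⁻¹*ε , c*[c⁻¹*ε]≡ε
    where
    instance
      c-positive : ℚ.Positive c
      c-positive = ℚ.positive 0<c

      c-nonZero : ℚ.NonZero c
      c-nonZero = ℚ.pos⇒nonZero c

    c⁻¹ = ℚ.1/ c

    0<c⁻¹*ε : 0ℚ ℚ.< c⁻¹ ℚ.* ε
    0<c⁻¹*ε = subst (ℚ._< c⁻¹ ℚ.* ε) (ℚ.*-zeroʳ c⁻¹)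
      (ℚ.*-monoʳ-<-pos c⁻¹ {{ℚ.1/pos⇒pos c}} 0<ε)

    c*[c⁻¹*ε]≡ε : c ℚ.* (c⁻¹ ℚ.* ε) ≡ ε
    c*[c⁻¹*ε]≡ε = trans (sym (ℚ.*-assoc c c⁻¹ ε))
      (trans (cong (ℚ._* ε) (ℚ.*-inverseʳ c)) (ℚ.*-identityˡ ε))

  *-close : ∀ {x y : ℕ → ℚ} {A B δ ε} → 0ℚ ℚ.< A → 0ℚ ℚ.< B →
    (A ℚ.+ B) ℚ.* δ ≡ ε →
    Eventually (λ n → ℚ.∣ x n ∣ ℚ.< A) →
    Eventually (λ n → ℚ.∣ y n ∣ ℚ.< B) →
    (∃ λ M → ∀ m n → M ℕ.≤ m → M ℕ.≤ n → ℚ.∣ x m ℚ.- x n ∣ ℚ.< δ) →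
    (∃ λ N → ∀ m n → N ℕ.≤ m → N ℕ.≤ n → ℚ.∣ y m ℚ.- y n ∣ ℚ.< δ) →
    ∃ λ T → ∀ m n → T ℕ.≤ m → T ℕ.≤ n →
      ℚ.∣ x m ℚ.* y m ℚ.- x n ℚ.* y n ∣ ℚ.< ε
  *-close {x} {y} {A} {B} {δ} {ε} 0<A 0<B [A+B]δ≡ε
    (K , ∣x∣<A) (L , ∣y∣<B) (M , Δx) (N , Δy) = T , bound
    where
    T = (K ℕ.⊔ L) ℕ.⊔ (M ℕ.⊔ N)

    rearrange : ∀ a b c d →
      a ℚ.* b ℚ.- c ℚ.* d ≡ a ℚ.* (b ℚ.- d) ℚ.+ d ℚ.* (a ℚ.- c)
    rearrange = solve 4
      (λ a b c d → a :* b :- c :* d := a :* (b :- d) :+ d :* (a :- c)) refl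
      where open +-*-Solver

    bound : ∀ m n → T ℕ.≤ m → T ℕ.≤ n →
            ℚ.∣ x m ℚ.* y m ℚ.- x n ℚ.* y n ∣ ℚ.< ε
    bound m n T≤m T≤n = begin-strict
      ℚ.∣ x m ℚ.* y m ℚ.- x n ℚ.* y n ∣
        ≡⟨ cong ℚ.∣_∣ (rearrange (x m) (y m) (x n) (y n)) ⟩
      ℚ.∣ x m ℚ.* dy ℚ.+ y n ℚ.* dx ∣
        ≤⟨ ℚ.∣p+q∣≤∣p∣+∣q∣ (x m ℚ.* dy) (y n ℚ.* dx) ⟩
      ℚ.∣ x m ℚ.* dy ∣ ℚ.+ ℚ.∣ y n ℚ.* dx ∣
        ≡⟨ cong₂ ℚ._+_ (ℚ.∣p*q∣≡∣p∣*∣q∣ (x m) dy) (ℚ.∣p*q∣≡∣p∣*∣q∣ (y n) dx) ⟩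
      ℚ.∣ x m ∣ ℚ.* ℚ.∣ dy ∣ ℚ.+ ℚ.∣ y n ∣ ℚ.* ℚ.∣ dx ∣
        <⟨ ℚ.+-mono-<
             (*-mono-bound 0<A (∣x∣<A m K≤m) (ℚ.0≤∣p∣ dy) ∣dy∣<δ)
             (*-mono-bound 0<B (∣y∣<B n L≤n) (ℚ.0≤∣p∣ dx) ∣dx∣<δ) ⟩
      A ℚ.* δ ℚ.+ B ℚ.* δ
        ≡⟨ ℚ.*-distribʳ-+ δ A B ⟨
      (A ℚ.+ B) ℚ.* δ
        ≡⟨ [A+B]δ≡ε ⟩
      ε ∎
      where
      open ℚ.≤-Reasoning
      dx = x m ℚ.- x n
      dy = y m ℚ.- y n
      K⊔L≤ : ∀ {i} → T ℕ.≤ i → K ℕ.⊔ L ℕ.≤ i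
      K⊔L≤ = ℕ.m⊔n≤o⇒m≤o (K ℕ.⊔ L) (M ℕ.⊔ N)
      M⊔N≤ : ∀ {i} → T ℕ.≤ i → M ℕ.⊔ N ℕ.≤ i
      M⊔N≤ = ℕ.m⊔n≤o⇒n≤o (K ℕ.⊔ L) (M ℕ.⊔ N)
      K≤m = ℕ.m⊔n≤o⇒m≤o K L (K⊔L≤ T≤m)
      L≤n = ℕ.m⊔n≤o⇒n≤o K L (K⊔L≤ T≤n)
      ∣dx∣<δ = Δx m n
        (ℕ.m⊔n≤o⇒m≤o M N (M⊔N≤ T≤m)) (ℕ.m⊔n≤o⇒m≤o M N (M⊔N≤ T≤n))
      ∣dy∣<δ = Δy m n
        (ℕ.m⊔n≤o⇒n≤o M N (M⊔N≤ T≤m)) (ℕ.m⊔n≤o⇒n≤o M N (M⊔N≤ T≤n))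

  *-cauchy : ∀ {x y} → IsCauchy x → IsCauchy y → IsCauchy (λ n → x n ℚ.* y n)
  *-cauchy {x} {y} cx cy ε 0<ε =
    let A , 0<A , ∣x∣<A = eventually-bounded {x} cx
        B , 0<B , ∣y∣<B = eventually-bounded {y} cy
        δ , 0<δ , [A+B]δ≡ε = divide (A ℚ.+ B) ε (ℚ.+-mono-< 0<A 0<B) 0<ε
    in *-close {x} {y} 0<A 0<B [A+B]δ≡ε ∣x∣<A ∣y∣<B (cx δ 0<δ) (cy δ 0<δ)

-- Reals are Cauchy sequences of rationals; there is no quotient, so equality
-- is the relation _≈ℝ_.  Positivity is witnessed by a rational bound.
record ℝ : Set where
  constructor mkℝ
  field
    seq    : ℕ → ℚ
    cauchy : IsCauchy seq

open ℝ public

infix  4 _≈ℝ_ _<ℝ_ _≤ℝ_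
infix  8 -ℝ_
infixl 7 _*ℝ_
infixl 6 _+ℝ_

_≈ℝ_ : Rel ℝ 0ℓ
x ≈ℝ y = ∀ ε → 0ℚ ℚ.< ε → Eventually λ n → ℚ.∣ seq x n ℚ.- seq y n ∣ ℚ.< ε

_<ℝ_ : Rel ℝ 0ℓ
x <ℝ y = ∃ λ ε → 0ℚ ℚ.< ε × Eventually λ n → seq x n ℚ.+ ε ℚ.< seq y n

_≤ℝ_ : Rel ℝ 0ℓ
x ≤ℝ y = ∀ ε → 0ℚ ℚ.< ε → Eventually λ n → seq x n ℚ.< seq y n ℚ.+ ε

fromℚ : ℚ → ℝ
fromℚ q = mkℝ (λ _ → q) (constant-cauchy q)

0ℝ 1ℝ : ℝ
0ℝ = fromℚ 0ℚ
1ℝ = fromℚ 1ℚ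

_+ℝ_ _*ℝ_ : ℝ → ℝ → ℝ
x +ℝ y = mkℝ (λ n → seq x n ℚ.+ seq y n) (+-cauchy {seq x} {seq y} (cauchy x) (cauchy y))
x *ℝ y = mkℝ (λ n → seq x n ℚ.* seq y n) (*-cauchy {seq x} {seq y} (cauchy x) (cauchy y))

-ℝ_ : ℝ → ℝ
-ℝ x = mkℝ (λ n → ℚ.- seq x n) (neg-cauchy {seq x} (cauchy x))

record ℂ : Set where
  constructor _+i_
  field
    Re : ℝ
    Im : ℝ

open ℂ public

infix  4 _≈ℂ_
infixl 7 _*ℂ_
infixl 6 _+ℂ_

_≈ℂ_ : Rel ℂ 0ℓ
w ≈ℂ z = Re w ≈ℝ Re z × Im w ≈ℝ Im z

0ℂ 1ℂ : ℂ
0ℂ = 0ℝ +i 0ℝ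
1ℂ = 1ℝ +i 0ℝ

_+ℂ_ _*ℂ_ : ℂ → ℂ → ℂ
(a +i b) +ℂ (c +i d) = (a +ℝ c) +i (b +ℝ d)
(a +i b) *ℂ (c +i d) = (a *ℝ c +ℝ -ℝ (b *ℝ d)) +i (a *ℝ d +ℝ b *ℝ c)

ℂ-rawSemiring : RawSemiring 0ℓ 0ℓ
ℂ-rawSemiring = record
  { Carrier = ℂ
  ; _≈_     = _≈ℂ_
  ; _+_     = _+ℂ_
  ; _*_     = _*ℂ_
  ; 0#      = 0ℂ
  ; 1#      = 1ℂ
  }

record SimpleGraph (n : ℕ) : Set₁ where
  field
    Adj    : Rel (Fin n) 0ℓ
    symm   : Symmetric Adj
    irrefl : Irreflexive _≡_ Adj
    adj?   : Decidable Adj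

data AcrossParts {A B : Set} : Rel (A ⊎ B) 0ℓ where
  left-right : ∀ {x y} → AcrossParts (inj₁ x) (inj₂ y)
  right-left : ∀ {x y} → AcrossParts (inj₂ y) (inj₁ x)

private

  across-sym : ∀ {A B : Set} → Symmetric (AcrossParts {A} {B})
  across-sym left-right = right-left
  across-sym right-left = left-right

  across-irrefl : ∀ {A B : Set} → Irreflexive _≡_ (AcrossParts {A} {B})
  across-irrefl {x = inj₁ _} refl ()
  across-irrefl {x = inj₂ _} refl ()

  across? : ∀ {A B : Set} → Decidable (AcrossParts {A} {B})
  across? (inj₁ _) (inj₁ _) = no λ ()
  across? (inj₁ _) (inj₂ _) = yes left-right
  across? (inj₂ _) (inj₁ _) = yes right-left
  across? (inj₂ _) (inj₂ _) = no λ ()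

-- The parts of K a b are the first a and the last b elements of Fin (a + b).
K : (a b : ℕ) → SimpleGraph (a ℕ.+ b)
K a b = record
  { Adj    = λ u v → AcrossParts (splitAt a u) (splitAt a v)
  ; symm   = across-sym
  ; irrefl = λ u≡v → across-irrefl (cong (splitAt a) u≡v)
  ; adj?   = λ u v → across? (splitAt a u) (splitAt a v)
  }

-- Each subset occurs exactly once in the list.
allSubsets : ∀ n → List (Subset n)
allSubsets zero    = [] ∷ []
allSubsets (suc n) =
  map (outside ∷_) (allSubsets n) ++ map (inside ∷_) (allSubsets n)

module _ {n : ℕ} (G : SimpleGraph n) where
  open SimpleGraph G

  Independent : U.Pred (Subset n) 0ℓ
  Independent S = ∀ u v → u ∈ S → v ∈ S → ¬ Adj u v

  independent? : U.Decidable Independent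
  independent? S = all? λ u → all? λ v →
    (u ∈? S) →-dec ((v ∈? S) →-dec ¬? (adj? u v))

  independentSets : List (Subset n)
  independentSets = filter independent? (allSubsets n)

  indepCount : ℕ → ℕ
  indepCount k = length (filter (λ S → ∣ S ∣ ℕ.≟ k) independentSets)

  independenceNumber : ℕ
  independenceNumber = max 0 (map ∣_∣ independentSets)

  -- The value at x; coefficients act on R by repeated addition.
  module _ {c ℓ} (R : RawSemiring c ℓ) where
    open RawSemiring R using (Carrier)
    open RawSemiringDefs R using (sum; _^_) renaming (_×_ to _·_)

    independencePolynomial : Carrier → Carrier
    independencePolynomial x =
      sum {suc independenceNumber} λ k → indepCount (toℕ k) · (x ^ toℕ k)

  IsRoot : U.Pred ℂ 0ℓ
  IsRoot z = independencePolynomial ℂ-rawSemiring z ≈ℂ 0ℂ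

  Stable : Set
  Stable = ∀ z → IsRoot z → Re z ≤ℝ 0ℝ

{-# OPTIONS --safe #-}

-- Writing w = 1 + x, a root of the independence polynomial of K m n is a solution of wᵐ + wⁿ = 1.
-- With ℓ = p/q in lowest terms we have m = qk and n = pk. Put P = wᵐ, Q = wⁿ and c = P + Q, and move w
-- so that c runs along the real axis towards 1: then d(log w) = dc / (mP + nQ). If |w| ≥ 1 and c > 0, then
-- |P| ≤ |Q| gives 2 Re Q ≥ c, so mP + nQ = mc + (n - m)Q has positive real part and |w| keeps increasing.
-- It remains to start at a w with |w| = 1, Re Q > 0 and c in [0, 1) (approximately real). If p is even or
-- p - q ≥ 3, one can take c = 0, i.e. w^(n-m) = -1; for p odd and p - q = 2 this choice, which would give
-- Re Q = 0, is slightly rotated; for p odd and p - q = 1 one takes w to be a suitable (m+n)-th root of unity.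
-- The solution found has |w|ᵏ ≥ 1 + δ and w = 1 + O(1/k), where δ and the implied constant depend on ℓ only,
-- whence Re w > 1 for large k. To stay constructive, the path is replaced by a damped Newton iteration over
-- the Gaussian rationals and roots of unity by powers of 1 + iθ with small rational θ.
module Submission where

open import Defs

-- The iteration sees `c` only approximately real and may start near `c = 0`, where `2 Re Q ≥ c`
-- says nothing. So a bound `β ≤ Re Q` is carried along. While `c` is small, `D` is nearly a
-- positive multiple of `Q` and `Re Q` grows; once `c` is not small, `|P| ≤ |Q|` forces `Re Q ≥ β`
-- anew, up to an error of the size of `Im c`. Hence the starting defect must be small relative to
-- `β`, and starting points are demanded for every ratio `t` of the two. A step multiplies `w` by
-- `1 + ζ / k`, so its first-order effect on `P` and `Q` is free of `k`, and so are the bounds on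
-- the error terms. All constants are fixed by `q` and `d`; `k` matters only at the end, where a
-- gain of order `1 / k` in `|w|²` has to beat `(Im w)²`, of order `1 / k²`. The damping `h` lets
-- the linear gain of a step dominate its quadratic error. The residual `e = 1 - c` shrinks
-- geometrically, and every error is charged to a telescoping multiple of this decay.

module CompleteBipartite where

  open import Algebra.Bundles using (CommutativeSemiring)
  open import Data.Bool.Base using (true; false; if_then_else_)
  open import Data.Empty using (⊥-elim)
  open import Data.Fin.Base using (Fin; zero; suc; toℕ; splitAt; _↑ʳ_)
  open import Data.Fin.Properties using (all?; splitAt-↑ʳ; splitAt⁻¹-↑ʳ)
  open import Data.Fin.Subset using (Subset; _∈_; _∉_; ∣_∣; inside; outside)
  open import Data.Fin.Subset.Properties using (_∈?_; drop-there)
  open import Data.List.Base using (List; []; _∷_; _++_; map; filter; length)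
  open import Data.List.Extrema.Nat using (xs≤max)
  open import Data.List.Properties using (filter-++; filter-≐)
  open import Data.List.Relation.Unary.All as All using (All; []; _∷_)
  import Data.List.Relation.Unary.All.Properties as All
  open import Data.Nat.Base as ℕ using (ℕ; zero; suc; _<_; s≤s; z≤n)
  import Data.Nat.Properties as ℕ
  open import Data.Product.Base using (_,_)
  open import Data.Sum.Base using (_⊎_; inj₁; inj₂; map₁)
  open import Data.Vec.Base using ([]; _∷_; here; there)
  open import Function.Base using (_∘_)
  open import Relation.Binary.PropositionalEquality as ≡ using (_≡_)
  open import Relation.Nullary using (¬_; ¬?; Dec; does; yes; no)
  import Relation.Unary as U

  -- The independence polynomial of a complete bipartite graph

  module _ {c ℓ} (R : CommutativeSemiring c ℓ) where
    open CommutativeSemiring R hiding (zero)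
    open import Algebra.Properties.Semiring.Exp semiring using (_^_)
    open import Algebra.Properties.Semiring.Sum semiring using (sum; sum-cong-≋; ∑-distrib-+; sum-replicate-zero)
    open import Algebra.Definitions.RawSemiring rawSemiring using () renaming (_×_ to _·_)
    open import Relation.Binary.Reasoning.Setoid setoid

    private
      powerSum : {A : Set} → Carrier → (A → ℕ) → List A → Carrier
      powerSum x f []       = 0#
      powerSum x f (a ∷ as) = x ^ f a + powerSum x f as

      powerSum-++ : ∀ {A : Set} x (f : A → ℕ) as bs →
        powerSum x f (as ++ bs) ≈ powerSum x f as + powerSum x f bs
      powerSum-++ x f []       bs = sym (+-identityˡ _)
      powerSum-++ x f (a ∷ as) bs = trans (+-congˡ (powerSum-++ x f as bs)) (sym (+-assoc _ _ _))

      sum-indicator : ∀ {M l} (g : ℕ → Carrier) → l < M →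
        sum {M} (λ k → if does (l ℕ.≟ toℕ k) then g (toℕ k) else 0#) ≈ g l
      sum-indicator {suc M} {zero}  g _         = trans (+-congˡ (sum-replicate-zero M)) (+-identityʳ _)
      sum-indicator {suc M} {suc l} g (s≤s l<M) = trans (+-identityˡ _) (sum-indicator (g ∘ suc) l<M)

      -- Double counting: prepending `a` raises only the coefficient of index `f a`, and `f a < M`
      -- guarantees that this index is among those summed.
      sum-by-value : ∀ {A : Set} x (f : A → ℕ) {M} as → All (λ a → f a < M) as →
        sum {M} (λ k → length (filter (λ a → f a ℕ.≟ toℕ k) as) · (x ^ toℕ k)) ≈ powerSum x f as
      sum-by-value x f {M} []       []             = sum-replicate-zero M
      sum-by-value x f {M} (a ∷ as) (fa<M ∷ fas<M) = begin
        sum {M} (λ k → length (filter (λ a → f a ℕ.≟ toℕ k) (a ∷ as)) · (x ^ toℕ k))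
          ≈⟨ sum-cong-≋ {M} (λ k → count-∷ (toℕ k)) ⟩
        sum {M} (λ k → (if does (f a ℕ.≟ toℕ k) then x ^ toℕ k else 0#)
                 + length (filter (λ a → f a ℕ.≟ toℕ k) as) · (x ^ toℕ k))
          ≈⟨ ∑-distrib-+ {M} _ _ ⟩
        _ ≈⟨ +-cong (sum-indicator (x ^_) fa<M) (sum-by-value x f as fas<M) ⟩
        powerSum x f (a ∷ as) ∎
        where
        count-∷ : ∀ k → length (filter (λ a → f a ℕ.≟ k) (a ∷ as)) · (x ^ k)
          ≈ (if does (f a ℕ.≟ k) then x ^ k else 0#) + length (filter (λ a → f a ℕ.≟ k) as) · (x ^ k)
        count-∷ k with does (f a ℕ.≟ k)
        ... | true  = refl
        ... | false = sym (+-identityˡ _)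

      -- The generating function by size of the subsets satisfying `P`. Being available for any
      -- decidable predicate, it lets the recursion on vertices pass through families other than
      -- independent sets.
      weight : ∀ {n p} {P : U.Pred (Subset n) p} → Carrier → U.Decidable P → Carrier
      weight {n} x P? = powerSum x ∣_∣ (filter P? (allSubsets n))

      weight-cong : ∀ {n p q} {P : U.Pred (Subset n) p} {Q : U.Pred (Subset n) q} x
        (P? : U.Decidable P) (Q? : U.Decidable Q) → P U.≐ Q → weight x P? ≈ weight x Q?
      weight-cong {n} x P? Q? P≐Q = reflexive (≡.cong (powerSum x ∣_∣) (filter-≐ P? Q? P≐Q (allSubsets n)))

      filter-map : ∀ {A B : Set} {p} {P : U.Pred B p} (P? : U.Decidable P) (f : A → B) as →
        filter P? (map f as) ≡ map f (filter (λ a → P? (f a)) as)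
      filter-map P? f [] = ≡.refl
      filter-map P? f (a ∷ as) with does (P? (f a))
      ... | true  = ≡.cong (f a ∷_) (filter-map P? f as)
      ... | false = filter-map P? f as

      powerSum-outside : ∀ {n} x (Ss : List (Subset n)) →
        powerSum x ∣_∣ (map (outside ∷_) Ss) ≈ powerSum x ∣_∣ Ss
      powerSum-outside x []       = refl
      powerSum-outside x (S ∷ Ss) = +-congˡ (powerSum-outside x Ss)

      powerSum-inside : ∀ {n} x (Ss : List (Subset n)) →
        powerSum x ∣_∣ (map (inside ∷_) Ss) ≈ x * powerSum x ∣_∣ Ss
      powerSum-inside x []       = sym (zeroʳ x)
      powerSum-inside x (S ∷ Ss) = trans (+-congˡ (powerSum-inside x Ss)) (sym (distribˡ x _ _))

      weight-suc : ∀ {n p} {P : U.Pred (Subset (suc n)) p} x (P? : U.Decidable P) →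
        weight x P? ≈ weight x (λ S → P? (outside ∷ S)) + x * weight x (λ S → P? (inside ∷ S))
      weight-suc {n} x P? = begin
        weight x P?
          ≡⟨ ≡.cong (powerSum x ∣_∣) (≡.trans (filter-++ P? (map (outside ∷_) (allSubsets n)) _)
               (≡.cong₂ _++_ (filter-map P? (outside ∷_) (allSubsets n)) (filter-map P? (inside ∷_) (allSubsets n)))) ⟩
        powerSum x ∣_∣ (map (outside ∷_) outs ++ map (inside ∷_) ins)
          ≈⟨ powerSum-++ x ∣_∣ (map (outside ∷_) outs) _ ⟩
        powerSum x ∣_∣ (map (outside ∷_) outs) + powerSum x ∣_∣ (map (inside ∷_) ins)
          ≈⟨ +-cong (powerSum-outside x outs) (powerSum-inside x ins) ⟩
        weight x (λ S → P? (outside ∷ S)) + x * weight x (λ S → P? (inside ∷ S)) ∎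
        where
        outs = filter (λ S → P? (outside ∷ S)) (allSubsets n)
        ins  = filter (λ S → P? (inside ∷ S)) (allSubsets n)

      x+1-step : ∀ x y → y + x * y ≈ (1# + x) * y
      x+1-step x y = trans (+-congʳ (sym (*-identityˡ y))) (sym (distribʳ y 1# x))

      weight-all : ∀ {n p} {P : U.Pred (Subset n) p} x (P? : U.Decidable P) → (∀ S → P S) →
        weight x P? ≈ (1# + x) ^ n
      weight-all {zero} x P? all with P? []
      ... | yes _ = +-identityʳ 1#
      ... | no ¬p = ⊥-elim (¬p (all []))
      weight-all {suc n} x P? all = trans (weight-suc x P?) (trans
        (+-cong (weight-all x (λ S → P? (outside ∷ S)) (λ S → all (outside ∷ S)))
                (*-congˡ (weight-all x (λ S → P? (inside ∷ S)) (λ S → all (inside ∷ S)))))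
        (x+1-step x _))

      weight-none : ∀ {n p} {P : U.Pred (Subset n) p} x (P? : U.Decidable P) → (∀ S → ¬ P S) →
        weight x P? ≈ 0#
      weight-none {zero} x P? none with P? []
      ... | yes p = ⊥-elim (none [] p)
      ... | no _  = refl
      weight-none {suc n} x P? none = trans (weight-suc x P?) (trans
        (+-cong (weight-none x (λ S → P? (outside ∷ S)) (λ S → none (outside ∷ S)))
                (trans (*-congˡ (weight-none x (λ S → P? (inside ∷ S)) (λ S → none (inside ∷ S)))) (zeroʳ x)))
        (+-identityˡ 0#))

      -- Once a left vertex is chosen, this is all that independence still asks of the rest: left
      -- vertices are free, right ones excluded.
      NoRight : ∀ a b → U.Pred (Subset (a ℕ.+ b)) _
      NoRight a b S = ∀ (j : Fin b) → (a ↑ʳ j) ∉ S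

      noRight? : ∀ a b → U.Decidable (NoRight a b)
      noRight? a b S = all? λ j → ¬? ((a ↑ʳ j) ∈? S)

      weight-noRight : ∀ a b x → weight x (noRight? a b) ≈ (1# + x) ^ a
      weight-noRight zero zero x = +-identityʳ 1#
      weight-noRight zero (suc b) x = trans (weight-suc x (noRight? 0 (suc b))) (trans
        (+-cong (trans (weight-cong x _ (noRight? 0 b)
                         ((λ h j j∈S → h (suc j) (there j∈S)) , (λ { h zero () ; h (suc j) (there j∈S) → h j j∈S })))
                       (weight-noRight 0 b x))
                (trans (*-congˡ (weight-none x (λ S → noRight? 0 (suc b) (inside ∷ S)) (λ S h → h zero here))) (zeroʳ x)))
        (+-identityʳ 1#))
      weight-noRight (suc a) b x = trans (weight-suc x (noRight? (suc a) b)) (trans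
        (+-cong (tail outside) (*-congˡ (tail inside))) (x+1-step x _))
        where
        tail : ∀ s → weight x (λ S → noRight? (suc a) b (s ∷ S)) ≈ (1# + x) ^ a
        tail s = trans (weight-cong x _ (noRight? a b)
          ((λ h j j∈S → h j (there j∈S)) , (λ h j j∈S → h j (drop-there j∈S)))) (weight-noRight a b x)

      across-map₁⁺ : ∀ {A A′ B : Set} {f : A → A′} {s t : A ⊎ B} → AcrossParts s t → AcrossParts (map₁ f s) (map₁ f t)
      across-map₁⁺ left-right = left-right
      across-map₁⁺ right-left = right-left

      across-map₁⁻ : ∀ {A A′ B : Set} {f : A → A′} (s t : A ⊎ B) → AcrossParts (map₁ f s) (map₁ f t) → AcrossParts s t
      across-map₁⁻ (inj₁ _) (inj₂ _) left-right = left-right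
      across-map₁⁻ (inj₂ _) (inj₁ _) right-left = right-left

      independent-outside : ∀ a b → (λ S → Independent (K (suc a) b) (outside ∷ S)) U.≐ Independent (K a b)
      independent-outside a b =
          (λ h u v u∈S v∈S adj → h (suc u) (suc v) (there u∈S) (there v∈S) (across-map₁⁺ adj))
        , (λ { h (suc u) (suc v) (there u∈S) (there v∈S) adj →
               h u v u∈S v∈S (across-map₁⁻ (splitAt a u) (splitAt a v) adj) })

      independent-inside : ∀ a b → (λ S → Independent (K (suc a) b) (inside ∷ S)) U.≐ NoRight a b
      independent-inside a b =
          (λ h j j∈S → h zero (suc (a ↑ʳ j)) here (there j∈S)
            (≡.subst (λ s → AcrossParts (inj₁ zero) (map₁ suc s)) (≡.sym (splitAt-↑ʳ a b j)) left-right))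
        , to
        where
        to : ∀ {S} → NoRight a b S → Independent (K (suc a) b) (inside ∷ S)
        to h u v u∈S v∈S adj with splitAt (suc a) u in u≡ | splitAt (suc a) v in v≡ | adj
        ... | inj₁ _ | inj₂ j | left-right = h j (drop-there (≡.subst (_∈ _) (≡.sym (splitAt⁻¹-↑ʳ {suc a} v≡)) v∈S))
        ... | inj₂ j | inj₁ _ | right-left = h j (drop-there (≡.subst (_∈ _) (≡.sym (splitAt⁻¹-↑ʳ {suc a} u≡)) u∈S))

      -- Induction on the left part: the sets containing the new left vertex contribute
      -- `x (1 + x)^a`, which turns `(1 + x)^a` into its successor power. The summand `1#` stands on
      -- the left because the empty set is counted for both parts and a semiring has no subtraction.
      weight-independent : ∀ a b x →
        weight x (independent? (K a b)) + 1# ≈ (1# + x) ^ a + (1# + x) ^ b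
      weight-independent zero b x =
        trans (+-congʳ (weight-all x (independent? (K 0 b)) (λ S u v _ _ ()))) (+-comm _ _)
      weight-independent (suc a) b x = begin
        weight x (independent? (K (suc a) b)) + 1#
          ≈⟨ +-congʳ (trans (weight-suc x (independent? (K (suc a) b)))
               (+-cong (weight-cong x _ (independent? (K a b)) (independent-outside a b))
                       (*-congˡ (trans (weight-cong x _ (noRight? a b) (independent-inside a b))
                                       (weight-noRight a b x))))) ⟩
        (weight x (independent? (K a b)) + x * y) + 1#
          ≈⟨ trans (+-assoc _ _ _) (trans (+-congˡ (+-comm _ _)) (sym (+-assoc _ _ _))) ⟩
        (weight x (independent? (K a b)) + 1#) + x * y
          ≈⟨ +-congʳ (weight-independent a b x) ⟩
        (y + (1# + x) ^ b) + x * y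
          ≈⟨ trans (+-assoc _ _ _) (trans (+-congˡ (+-comm _ _)) (sym (+-assoc _ _ _))) ⟩
        (y + x * y) + (1# + x) ^ b
          ≈⟨ +-congʳ (x+1-step x y) ⟩
        (1# + x) ^ suc a + (1# + x) ^ b ∎
        where y = (1# + x) ^ a

    independencePolynomial-K : ∀ a b x →
      independencePolynomial (K a b) rawSemiring x + 1# ≈ (1# + x) ^ a + (1# + x) ^ b
    independencePolynomial-K a b x = trans
      (+-congʳ (sum-by-value x ∣_∣ (independentSets (K a b))
        -- No independent set exceeds the independence number, so cutting the sum off there loses
        -- nothing.
        (All.map s≤s (All.map⁻ (xs≤max 0 (map ∣_∣ (independentSets (K a b))))))))
      (weight-independent a b x)

open CompleteBipartite using (independencePolynomial-K)

open import Algebra.Bundles using (CommutativeRing; CommutativeSemiring)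
import Algebra.Definitions.RawSemiring as RawSemiringDefs
import Algebra.Properties.CommutativeSemiring.Exp as CommExp
import Algebra.Properties.Semiring.Exp as Exp
open import Algebra.Structures using (IsCommutativeRing)
open import Data.Empty using (⊥-elim)
open import Data.Fin.Base using (Fin; zero; suc; toℕ)
open import Data.Integer.Base as ℤ using (+_)
import Data.Integer.Properties as ℤ
open import Data.List.Base using ([]; _∷_)
open import Data.Nat.Base as ℕ using (ℕ; zero; suc; _>_)
open import Data.Nat.Coprimality as Coprime using (Coprime; coprime-Bézout; coprime-divisor)
open import Data.Nat.Divisibility as ℕ using (_∣_; divides; ∣m+n∣m⇒∣n)
open import Data.Nat.GCD using (module Bézout)
import Data.Nat.Properties as ℕ
open import Data.Nat.Tactic.RingSolver using () renaming (solve-∀ to solve-∀ℕ)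
open import Data.Product.Base using (∃; ∃₂; _×_; _,_; proj₁; proj₂)
open import Data.Rational.Base hiding (_>_)
open import Data.Rational.Properties
import Data.Rational.Unnormalised.Base as ℚᵘ
import Data.Rational.Unnormalised.Properties as ℚᵘ
open import Data.Sum.Base using (_⊎_; inj₁; inj₂)
open import Level using (0ℓ)
open import Relation.Binary.Definitions using (DecidableEquality)
open import Relation.Binary.PropositionalEquality hiding (J)
open import Relation.Nullary using (Dec; yes; no; ¬_)
open import Relation.Nullary.Decidable using (dec⇒maybe; from-yes; map′; _×-dec_)
open import Tactic.RingSolver using (solve; solve-∀)
open import Tactic.RingSolver.Core.AlmostCommutativeRing using (AlmostCommutativeRing; fromCommutativeRing)

-- Inequalities of rational numbers

ℚ-ring : AlmostCommutativeRing _ _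
ℚ-ring = fromCommutativeRing +-*-commutativeRing (λ x → dec⇒maybe (0ℚ ≟ x))

-- The working tool for inequalities: the slack `s` is written as a sum of products of nonnegative
-- quantities, so its sign can be read off, and the identity is left to the ring solver.
≤-by : ∀ {a b s} → 0ℚ ≤ s → b ≡ a + s → a ≤ b
≤-by {a} {s = s} 0≤s refl = subst (_≤ a + s) (+-identityʳ a) (+-monoʳ-≤ a 0≤s)

<-by : ∀ {a b s} → 0ℚ < s → b ≡ a + s → a < b
<-by {a} {s = s} 0<s refl = subst (_< a + s) (+-identityʳ a) (+-monoʳ-< a 0<s)

0≤- : ∀ {a b} → a ≤ b → 0ℚ ≤ b - a
0≤- {a} {b} a≤b = subst (_≤ b - a) (+-inverseʳ a) (+-monoˡ-≤ (- a) a≤b)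

0<- : ∀ {a b} → a < b → 0ℚ < b - a
0<- {a} {b} a<b = subst (_< b - a) (+-inverseʳ a) (+-monoˡ-< (- a) a<b)

*-monoˡ₀ : ∀ {a b c} → 0ℚ ≤ a → b ≤ c → a * b ≤ a * c
*-monoˡ₀ {a} 0≤a = *-monoˡ-≤-nonNeg a {{nonNegative 0≤a}}

*-monoʳ₀ : ∀ {a b c} → 0ℚ ≤ a → b ≤ c → b * a ≤ c * a
*-monoʳ₀ {a} 0≤a = *-monoʳ-≤-nonNeg a {{nonNegative 0≤a}}

infixl 6 _+₀_
infixl 7 _*₀_ _*₊_

_+₀_ : ∀ {a b} → 0ℚ ≤ a → 0ℚ ≤ b → 0ℚ ≤ a + b
_+₀_ = +-mono-≤

_*₀_ : ∀ {a b} → 0ℚ ≤ a → 0ℚ ≤ b → 0ℚ ≤ a * b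
_*₀_ {a} {b} 0≤a 0≤b =
  subst (_≤ a * b) (*-zeroʳ a) (*-monoˡ₀ 0≤a 0≤b)

_*₊_ : ∀ {a b} → 0ℚ < a → 0ℚ < b → 0ℚ < a * b
_*₊_ {a} {b} 0<a 0<b =
  subst (_< a * b) (*-zeroʳ a) (*-monoʳ-<-pos a {{positive 0<a}} 0<b)

0≤sq : ∀ a → 0ℚ ≤ a * a
0≤sq a with ≤-total 0ℚ a
... | inj₁ 0≤a = 0≤a *₀ 0≤a
... | inj₂ a≤0 = subst (0ℚ ≤_) (lemma a) (0≤- a≤0 *₀ 0≤- a≤0)
  where
  lemma : ∀ a → (0ℚ - a) * (0ℚ - a) ≡ a * a
  lemma = solve-∀ ℚ-ring

*-mono₀ : ∀ {a b c d} → 0ℚ ≤ a → 0ℚ ≤ d → a ≤ b → c ≤ d → a * c ≤ b * d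
*-mono₀ {a} {b} {c} {d} 0≤a 0≤d a≤b c≤d =
  ≤-by (0≤a *₀ 0≤- c≤d +₀ 0≤- a≤b *₀ 0≤d) (solve (a ∷ b ∷ c ∷ d ∷ []) ℚ-ring)

*-cancel₀ : ∀ {a b c} → 0ℚ < c → a * c ≤ b * c → a ≤ b
*-cancel₀ {c = c} 0<c = *-cancelʳ-≤-pos c {{positive 0<c}}

-- Stands in for taking square roots, which would leave the rationals.
sq-cancel-≤ : ∀ {a b} → 0ℚ ≤ b → a * a ≤ b * b → a ≤ b
sq-cancel-≤ {a} {b} 0≤b a²≤b² = ≮⇒≥ λ b<a → <-irrefl refl (<-≤-trans (b²<a² b<a) a²≤b²)
  where
  b²<a² : b < a → b * b < a * a
  b²<a² b<a = <-by (0<- b<a *₊ +-mono-≤-< 0≤b (≤-<-trans 0≤b b<a))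
    (solve (a ∷ b ∷ []) ℚ-ring)

2ℚ 3ℚ 4ℚ 5ℚ 8ℚ 12ℚ 16ℚ 32ℚ : ℚ
2ℚ = + 2 / 1
3ℚ = + 3 / 1
4ℚ = + 4 / 1
5ℚ = + 5 / 1
8ℚ = + 8 / 1
12ℚ = + 12 / 1
16ℚ = + 16 / 1
32ℚ = + 32 / 1

recip : ∀ {a} → 0ℚ < a → ∃ λ b → 0ℚ < b × a * b ≡ 1ℚ
recip {a} 0<a = (1/ a) , positive⁻¹ (1/ a) {{1/pos⇒pos a}} , *-inverseʳ a
  where
  instance
    a-pos : Positive a
    a-pos = positive 0<a

    a-nonZero : NonZero a
    a-nonZero = pos⇒nonZero a

-- Recursive, so that `ι (suc n)` computes to `1ℚ + ι n` inside ring identities.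
ι : ℕ → ℚ
ι zero    = 0ℚ
ι (suc n) = 1ℚ + ι n

0≤1 : 0ℚ ≤ 1ℚ
0≤1 = from-yes (0ℚ ≤? 1ℚ)

0<1 : 0ℚ < 1ℚ
0<1 = from-yes (0ℚ <? 1ℚ)

0≤ι : ∀ n → 0ℚ ≤ ι n
0≤ι zero    = ≤-refl
0≤ι (suc n) = 0≤1 +₀ 0≤ι n

1≤ι : ∀ {n} → 1 ℕ.≤ n → 1ℚ ≤ ι n
1≤ι {suc n} _ = ≤-by (0≤ι n) refl

0<ι : ∀ {n} → 1 ℕ.≤ n → 0ℚ < ι n
0<ι 1≤n = <-≤-trans 0<1 (1≤ι 1≤n)

ι-+ : ∀ m n → ι (m ℕ.+ n) ≡ ι m + ι n
ι-+ zero    n = sym (+-identityˡ (ι n))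
ι-+ (suc m) n = trans (cong (_+_ 1ℚ) (ι-+ m n)) (sym (+-assoc 1ℚ (ι m) (ι n)))

ι-* : ∀ m n → ι (m ℕ.* n) ≡ ι m * ι n
ι-* zero    n = sym (*-zeroˡ (ι n))
ι-* (suc m) n = trans (ι-+ n (m ℕ.* n))
  (trans (cong (_+_ (ι n)) (ι-* m n)) (lemma (ι m) (ι n)))
  where
  lemma : ∀ x y → y + x * y ≡ (1ℚ + x) * y
  lemma = solve-∀ ℚ-ring

ι-mono : ∀ {m n} → m ℕ.≤ n → ι m ≤ ι n
ι-mono {n = n} ℕ.z≤n     = 0≤ι n
ι-mono (ℕ.s≤s m≤n) = +-monoʳ-≤ 1ℚ (ι-mono m≤n)

ι≡/1 : ∀ n → ι n ≡ + n / 1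
ι≡/1 zero    = refl
ι≡/1 (suc n) = trans (cong (_+_ 1ℚ) (ι≡/1 n)) (toℚᵘ-injective (begin
  toℚᵘ (1ℚ + (+ n / 1))             ≈⟨ toℚᵘ-homo-+ 1ℚ (+ n / 1) ⟩
  toℚᵘ 1ℚ ℚᵘ.+ toℚᵘ (+ n / 1)       ≈⟨ ℚᵘ.+-congʳ (toℚᵘ 1ℚ) (toℚᵘ-fromℚᵘ (ℚᵘ.mkℚᵘ (+ n) 0)) ⟩
  toℚᵘ 1ℚ ℚᵘ.+ ℚᵘ.mkℚᵘ (+ n) 0      ≈⟨ ℚᵘ.*≡* (cong (ℤ._* + 1) (cong (λ t → + 1 ℤ.+ t) (ℤ.*-identityʳ (+ n)))) ⟩
  ℚᵘ.mkℚᵘ (+ suc n) 0               ≈⟨ toℚᵘ-fromℚᵘ (ℚᵘ.mkℚᵘ (+ suc n) 0) ⟨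
  toℚᵘ (+ suc n / 1)                ∎))
  where
  open ℚᵘ.≃-Reasoning

archimedean : ∀ a → ∃ λ n → 1 ℕ.≤ n × a ≤ ι n
archimedean a@(mkℚ i d-1 _) = suc n , ℕ.s≤s ℕ.z≤n , ≤-trans a≤n (≤-by 0≤1 (+-comm 1ℚ (ι n)))
  where
  n = ℤ.∣ i ∣

  a≤n : a ≤ ι n
  a≤n = subst (a ≤_) (sym (ι≡/1 n)) (toℚᵘ-cancel-≤
    (ℚᵘ.≤-respʳ-≃ (ℚᵘ.≃-sym (toℚᵘ-fromℚᵘ (ℚᵘ.mkℚᵘ (+ n) 0)))
      (ℚᵘ.*≤* (bound i (suc d-1)))))
    where
    bound : ∀ i d .{{_ : ℕ.NonZero d}} → i ℤ.* + 1 ℤ.≤ + ℤ.∣ i ∣ ℤ.* + d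
    bound i d = ℤ.≤-trans
      (subst (ℤ._≤ + ℤ.∣ i ∣) (sym (ℤ.*-identityʳ i)) (i≤∣i∣ i))
      (subst (+ ℤ.∣ i ∣ ℤ.≤_) (ℤ.pos-* ℤ.∣ i ∣ d) (ℤ.+≤+ (ℕ.m≤m*n ℤ.∣ i ∣ d)))
      where
      i≤∣i∣ : ∀ i → i ℤ.≤ + ℤ.∣ i ∣
      i≤∣i∣ (+ n)        = ℤ.≤-refl
      i≤∣i∣ (ℤ.-[1+ n ]) = ℤ.-≤+

-- Gaussian rationals

infix 5 _⊹_

record ℚ[i] : Set where
  constructor _⊹_
  field
    re im : ℚ

open ℚ[i] public

infixl 6 _+ᵢ_ _-ᵢ_
infixl 7 _*ᵢ_

_+ᵢ_ _*ᵢ_ : ℚ[i] → ℚ[i] → ℚ[i]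
(a ⊹ b) +ᵢ (c ⊹ d) = (a + c) ⊹ (b + d)
(a ⊹ b) *ᵢ (c ⊹ d) = (a * c - b * d) ⊹ (a * d + b * c)

negᵢ : ℚ[i] → ℚ[i]
negᵢ (a ⊹ b) = (- a) ⊹ (- b)

_-ᵢ_ : ℚ[i] → ℚ[i] → ℚ[i]
z -ᵢ w = z +ᵢ negᵢ w

0ᵢ 1ᵢ 𝑖 : ℚ[i]
0ᵢ = 0ℚ ⊹ 0ℚ
1ᵢ = 1ℚ ⊹ 0ℚ
𝑖 = 0ℚ ⊹ 1ℚ

⟦_⟧ : ℚ → ℚ[i]
⟦ r ⟧ = r ⊹ 0ℚ

conj : ℚ[i] → ℚ[i]
conj (a ⊹ b) = a ⊹ (- b)

+ᵢ-*ᵢ-isCommutativeRing : IsCommutativeRing _≡_ _+ᵢ_ _*ᵢ_ negᵢ 0ᵢ 1ᵢ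
+ᵢ-*ᵢ-isCommutativeRing = record
  { isRing = record
    { +-isAbelianGroup = record
      { isGroup = record
        { isMonoid = record
          { isSemigroup = record
            { isMagma = isMagma _+ᵢ_
            ; assoc = λ x y z → cong₂ _⊹_ (+-assoc (re x) (re y) (re z)) (+-assoc (im x) (im y) (im z))
            }
          ; identity = (λ x → cong₂ _⊹_ (+-identityˡ (re x)) (+-identityˡ (im x)))
                     , (λ x → cong₂ _⊹_ (+-identityʳ (re x)) (+-identityʳ (im x)))
          }
        ; inverse = (λ x → cong₂ _⊹_ (+-inverseˡ (re x)) (+-inverseˡ (im x)))
                  , (λ x → cong₂ _⊹_ (+-inverseʳ (re x)) (+-inverseʳ (im x)))
        ; ⁻¹-cong = cong negᵢ
        }
      ; comm = λ x y → cong₂ _⊹_ (+-comm (re x) (re y)) (+-comm (im x) (im y))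
      }
    ; *-cong = cong₂ _*ᵢ_
    ; *-assoc = λ x y z → cong₂ _⊹_ (assoc-re (re x) (im x) (re y) (im y) (re z) (im z))
                                    (assoc-im (re x) (im x) (re y) (im y) (re z) (im z))
    ; *-identity = comm∧idˡ⇒id *ᵢ-comm identityˡ
    ; distrib = distribˡ , comm∧distrˡ⇒distrʳ *ᵢ-comm distribˡ
    }
  ; *-comm = *ᵢ-comm
  }
  where
  open import Relation.Binary.PropositionalEquality.Algebra using (isMagma)
  open import Algebra.Consequences.Propositional using (comm∧idˡ⇒id; comm∧distrˡ⇒distrʳ)
  assoc-re : ∀ a b c d e f → (a * c - b * d) * e - (a * d + b * c) * f ≡ a * (c * e - d * f) - b * (c * f + d * e)
  assoc-re = solve-∀ ℚ-ring
  assoc-im : ∀ a b c d e f → (a * c - b * d) * f + (a * d + b * c) * e ≡ a * (c * f + d * e) + b * (c * e - d * f)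
  assoc-im = solve-∀ ℚ-ring
  distrib-re : ∀ a b c d e f → a * (c + e) - b * (d + f) ≡ (a * c - b * d) + (a * e - b * f)
  distrib-re = solve-∀ ℚ-ring
  distrib-im : ∀ a b c d e f → a * (d + f) + b * (c + e) ≡ (a * d + b * c) + (a * f + b * e)
  distrib-im = solve-∀ ℚ-ring
  *ᵢ-comm : ∀ x y → x *ᵢ y ≡ y *ᵢ x
  *ᵢ-comm x y = cong₂ _⊹_ (comm-re (re x) (im x) (re y) (im y)) (comm-im (re x) (im x) (re y) (im y))
    where
    comm-re : ∀ a b c d → a * c - b * d ≡ c * a - d * b
    comm-re = solve-∀ ℚ-ring
    comm-im : ∀ a b c d → a * d + b * c ≡ c * b + d * a
    comm-im = solve-∀ ℚ-ring
  distribˡ : ∀ x y z → x *ᵢ (y +ᵢ z) ≡ x *ᵢ y +ᵢ x *ᵢ z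
  distribˡ x y z = cong₂ _⊹_ (distrib-re (re x) (im x) (re y) (im y) (re z) (im z))
                             (distrib-im (re x) (im x) (re y) (im y) (re z) (im z))
  identityˡ : ∀ x → 1ᵢ *ᵢ x ≡ x
  identityˡ x = cong₂ _⊹_ (identity-re (re x) (im x)) (identity-im (re x) (im x))
    where
    identity-re : ∀ a b → 1ℚ * a - 0ℚ * b ≡ a
    identity-re = solve-∀ ℚ-ring
    identity-im : ∀ a b → 1ℚ * b + 0ℚ * a ≡ b
    identity-im = solve-∀ ℚ-ring

ℚ[i]-commutativeRing : CommutativeRing 0ℓ 0ℓ
ℚ[i]-commutativeRing = record { isCommutativeRing = +ᵢ-*ᵢ-isCommutativeRing }

open CommutativeRing ℚ[i]-commutativeRing using (semiring; commutativeSemiring)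
open Exp semiring public using (_^_; ^-homo-*; ^-assocʳ)
open CommExp commutativeSemiring public using (^-distrib-*)

infix 4 _≟ᵢ_

_≟ᵢ_ : DecidableEquality ℚ[i]
(a ⊹ b) ≟ᵢ (c ⊹ d) = map′ (λ { (refl , refl) → refl }) (λ { refl → refl , refl })
  ((a ≟ c) ×-dec (b ≟ d))

ℚ[i]-ring : AlmostCommutativeRing _ _
ℚ[i]-ring = fromCommutativeRing ℚ[i]-commutativeRing (λ z → dec⇒maybe (0ᵢ ≟ᵢ z))

⟦⟧-* : ∀ r s → ⟦ r * s ⟧ ≡ ⟦ r ⟧ *ᵢ ⟦ s ⟧
⟦⟧-* r s = cong₂ _⊹_ (real r s) (imag r s)
  where
  real : ∀ r s → r * s ≡ r * s - 0ℚ * 0ℚ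
  real = solve-∀ ℚ-ring
  imag : ∀ r s → 0ℚ ≡ r * 0ℚ + 0ℚ * s
  imag = solve-∀ ℚ-ring

opaque
  -- The modulus of a Gaussian rational is in general irrational. This norm and the squared modulus
  -- `N` share its role: the norm obeys the triangle inequality and is submultiplicative, `N` is
  -- multiplicative, and `N z ≤ ∥ z ∥₁² ≤ 2 N z`.
  ∥_∥₁ : ℚ[i] → ℚ
  ∥ a ⊹ b ∥₁ = ∣ a ∣ + ∣ b ∣

N : ℚ[i] → ℚ
N (a ⊹ b) = a * a + b * b

p≤∣p∣ : ∀ p → p ≤ ∣ p ∣
p≤∣p∣ p with ≤-total 0ℚ p
... | inj₁ 0≤p = ≤-reflexive (sym (0≤p⇒∣p∣≡p 0≤p))
... | inj₂ p≤0 = ≤-trans p≤0 (0≤∣p∣ p)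

-p≤∣p∣ : ∀ p → - p ≤ ∣ p ∣
-p≤∣p∣ p = subst (- p ≤_) (∣-p∣≡∣p∣ p) (p≤∣p∣ (- p))

∣p∣²≡p² : ∀ p → ∣ p ∣ * ∣ p ∣ ≡ p * p
∣p∣²≡p² p = trans (sym (∣p*q∣≡∣p∣*∣q∣ p p)) (0≤p⇒∣p∣≡p (0≤sq p))

opaque
  unfolding ∥_∥₁

  0≤∥∥ : ∀ z → 0ℚ ≤ ∥ z ∥₁
  0≤∥∥ (a ⊹ b) = 0≤∣p∣ a +₀ 0≤∣p∣ b

0≤N : ∀ z → 0ℚ ≤ N z
0≤N (a ⊹ b) = 0≤sq a +₀ 0≤sq b

opaque
  unfolding ∥_∥₁

  ∥∥-+ : ∀ z w → ∥ z +ᵢ w ∥₁ ≤ ∥ z ∥₁ + ∥ w ∥₁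
  ∥∥-+ (a ⊹ b) (c ⊹ d) = subst (∥ (a ⊹ b) +ᵢ (c ⊹ d) ∥₁ ≤_)
    (lemma (∣ a ∣) (∣ b ∣) (∣ c ∣) (∣ d ∣))
    (+-mono-≤ (∣p+q∣≤∣p∣+∣q∣ a c) (∣p+q∣≤∣p∣+∣q∣ b d))
    where
    lemma : ∀ a b c d → (a + c) + (b + d) ≡ (a + b) + (c + d)
    lemma = solve-∀ ℚ-ring

opaque
  unfolding ∥_∥₁

  ∥∥-neg : ∀ z → ∥ negᵢ z ∥₁ ≡ ∥ z ∥₁
  ∥∥-neg (a ⊹ b) = cong₂ _+_ (∣-p∣≡∣p∣ a) (∣-p∣≡∣p∣ b)

∥∥-- : ∀ z w → ∥ z -ᵢ w ∥₁ ≤ ∥ z ∥₁ + ∥ w ∥₁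
∥∥-- z w = subst (λ t → ∥ z -ᵢ w ∥₁ ≤ ∥ z ∥₁ + t) (∥∥-neg w) (∥∥-+ z (negᵢ w))

∥∥-sym : ∀ z w → ∥ z -ᵢ w ∥₁ ≡ ∥ w -ᵢ z ∥₁
∥∥-sym z w = trans (sym (∥∥-neg (z -ᵢ w))) (cong ∥_∥₁ (lemma z w))
  where
  lemma : ∀ z w → negᵢ (z -ᵢ w) ≡ w -ᵢ z
  lemma = solve-∀ ℚ[i]-ring

∥∥-triangle : ∀ x y z → ∥ x -ᵢ z ∥₁ ≤ ∥ x -ᵢ y ∥₁ + ∥ y -ᵢ z ∥₁
∥∥-triangle x y z = subst (λ t → ∥ t ∥₁ ≤ ∥ x -ᵢ y ∥₁ + ∥ y -ᵢ z ∥₁) (lemma x y z) (∥∥-+ (x -ᵢ y) (y -ᵢ z))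
  where
  lemma : ∀ x y z → (x -ᵢ y) +ᵢ (y -ᵢ z) ≡ x -ᵢ z
  lemma = solve-∀ ℚ[i]-ring

opaque
  unfolding ∥_∥₁

  ∥∥-* : ∀ z w → ∥ z *ᵢ w ∥₁ ≤ ∥ z ∥₁ * ∥ w ∥₁
  ∥∥-* (a ⊹ b) (c ⊹ d) = ≤-trans
    (+-mono-≤ (∣p-q∣≤∣p∣+∣q∣ (a * c) (b * d)) (∣p+q∣≤∣p∣+∣q∣ (a * d) (b * c)))
    (≤-reflexive (trans
      (cong₂ _+_ (cong₂ _+_ (∣p*q∣≡∣p∣*∣q∣ a c) (∣p*q∣≡∣p∣*∣q∣ b d))
                 (cong₂ _+_ (∣p*q∣≡∣p∣*∣q∣ a d) (∣p*q∣≡∣p∣*∣q∣ b c)))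
      (lemma (∣ a ∣) (∣ b ∣) (∣ c ∣) (∣ d ∣))))
    where
    lemma : ∀ a b c d → (a * c + b * d) + (a * d + b * c) ≡ (a + b) * (c + d)
    lemma = solve-∀ ℚ-ring

opaque
  unfolding ∥_∥₁

  ∥⟦⟧∥ : ∀ {r} → 0ℚ ≤ r → ∥ ⟦ r ⟧ ∥₁ ≡ r
  ∥⟦⟧∥ {r} 0≤r = trans (+-identityʳ ∣ r ∣) (0≤p⇒∣p∣≡p 0≤r)

∥⟦⟧*∥ : ∀ {r} z → 0ℚ ≤ r → ∥ ⟦ r ⟧ *ᵢ z ∥₁ ≤ r * ∥ z ∥₁
∥⟦⟧*∥ {r} z 0≤r = subst (λ t → ∥ ⟦ r ⟧ *ᵢ z ∥₁ ≤ t * ∥ z ∥₁) (∥⟦⟧∥ 0≤r) (∥∥-* ⟦ r ⟧ z)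

opaque
  unfolding ∥_∥₁

  re≤∥∥ : ∀ z → re z ≤ ∥ z ∥₁
  re≤∥∥ (a ⊹ b) = ≤-trans (p≤∣p∣ a) (≤-by (0≤∣p∣ b) refl)

opaque
  unfolding ∥_∥₁

  -re≤∥∥ : ∀ z → - re z ≤ ∥ z ∥₁
  -re≤∥∥ (a ⊹ b) = ≤-trans (-p≤∣p∣ a) (≤-by (0≤∣p∣ b) refl)

opaque
  unfolding ∥_∥₁

  ∣im∣≤∥∥ : ∀ z → ∣ im z ∣ ≤ ∥ z ∥₁
  ∣im∣≤∥∥ (a ⊹ b) = ≤-by (0≤∣p∣ a) (+-comm ∣ a ∣ ∣ b ∣)

im≤∥∥ : ∀ z → im z ≤ ∥ z ∥₁
im≤∥∥ z = ≤-trans (p≤∣p∣ (im z)) (∣im∣≤∥∥ z)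

-im≤∥∥ : ∀ z → - im z ≤ ∥ z ∥₁
-im≤∥∥ z = ≤-trans (-p≤∣p∣ (im z)) (∣im∣≤∥∥ z)

opaque
  unfolding ∥_∥₁

  N≤∥∥² : ∀ z → N z ≤ ∥ z ∥₁ * ∥ z ∥₁
  N≤∥∥² (a ⊹ b) = subst (_≤ ∥ a ⊹ b ∥₁ * ∥ a ⊹ b ∥₁)
    (cong₂ _+_ (∣p∣²≡p² a) (∣p∣²≡p² b))
    (≤-by (0≤∣p∣ a *₀ 0≤∣p∣ b +₀ 0≤∣p∣ a *₀ 0≤∣p∣ b) (lemma (∣ a ∣) (∣ b ∣)))
    where
    lemma : ∀ a b → (a + b) * (a + b) ≡ (a * a + b * b) + (a * b + a * b)
    lemma = solve-∀ ℚ-ring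

opaque
  unfolding ∥_∥₁

  ∥∥²≤2N : ∀ z → ∥ z ∥₁ * ∥ z ∥₁ ≤ 2ℚ * N z
  ∥∥²≤2N (a ⊹ b) = subst (λ t → ∥ a ⊹ b ∥₁ * ∥ a ⊹ b ∥₁ ≤ 2ℚ * t)
    (cong₂ _+_ (∣p∣²≡p² a) (∣p∣²≡p² b))
    (≤-by (0≤sq (∣ a ∣ - ∣ b ∣)) (lemma (∣ a ∣) (∣ b ∣)))
    where
    lemma : ∀ a b → 2ℚ * (a * a + b * b) ≡ (a + b) * (a + b) + (a - b) * (a - b)
    lemma = solve-∀ ℚ-ring

N-* : ∀ z w → N (z *ᵢ w) ≡ N z * N w
N-* (a ⊹ b) (c ⊹ d) = lemma a b c d
  where
  lemma : ∀ a b c d → (a * c - b * d) * (a * c - b * d) + (a * d + b * c) * (a * d + b * c) ≡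
    (a * a + b * b) * (c * c + d * d)
  lemma = solve-∀ ℚ-ring

1≤N-^ : ∀ {z} n → 1ℚ ≤ N z → 1ℚ ≤ N (z ^ n)
1≤N-^ zero    1≤N = ≤-refl
1≤N-^ {z} (suc n) 1≤N = subst (1ℚ ≤_) (sym (N-* z (z ^ n)))
  (*-mono₀ {1ℚ} {N z} {1ℚ} 0≤1 (0≤N (z ^ n)) 1≤N (1≤N-^ n 1≤N))

N≤N-^ : ∀ {z} {n} → 1 ℕ.≤ n → 1ℚ ≤ N z → N z ≤ N (z ^ n)
N≤N-^ {z} {suc n} _ 1≤N = subst₂ _≤_ (*-identityʳ (N z)) (sym (N-* z (z ^ n)))
  (*-monoˡ₀ (0≤N z) (1≤N-^ n 1≤N))

inverse : ∀ z → 0ℚ < N z → ∃ λ r → 0ℚ < r × N z * r ≡ 1ℚ × z *ᵢ (⟦ r ⟧ *ᵢ conj z) ≡ 1ᵢ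
inverse z@(a ⊹ b) 0<N with recip 0<N
... | r , 0<r , Nr≡1 = r , 0<r , Nr≡1 , cong₂ _⊹_ (trans (real a b r) Nr≡1) (imag a b r)
  where
  real : ∀ a b r → a * (r * a - 0ℚ * (- b)) - b * (r * (- b) + 0ℚ * a) ≡ (a * a + b * b) * r
  real = solve-∀ ℚ-ring
  imag : ∀ a b r → a * (r * (- b) + 0ℚ * a) + b * (r * a - 0ℚ * (- b)) ≡ 0ℚ
  imag = solve-∀ ℚ-ring

-- The factor is crude but harmless, as `j` will depend on `ℓ` only. One more power costs
-- `2 · 3^j + 3^j`, from `∥ x ∥₁ ≤ 2` and `∥ z ∥₁ ≤ 1`.
^-close : ∀ {x z} j → ∥ x ∥₁ ≤ 2ℚ → ∥ z ∥₁ ≤ 1ℚ → ∥ x ^ j -ᵢ z ^ j ∥₁ ≤ ι (3 ℕ.^ j) * ∥ x -ᵢ z ∥₁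
^-close {x} {z} zero _ _ = subst (_≤ ι 1 * ∥ x -ᵢ z ∥₁) (sym (∥⟦⟧∥ ≤-refl)) (0≤ι 1 *₀ 0≤∥∥ (x -ᵢ z))
^-close {x} {z} (suc j) ∥x∥≤2 ∥z∥≤1 = begin
  ∥ x ^ suc j -ᵢ z ^ suc j ∥₁
    ≡⟨ cong ∥_∥₁ (split x z (x ^ j) (z ^ j)) ⟩
  ∥ x *ᵢ (x ^ j -ᵢ z ^ j) +ᵢ (x -ᵢ z) *ᵢ z ^ j ∥₁
    ≤⟨ ≤-trans (∥∥-+ _ ((x -ᵢ z) *ᵢ z ^ j)) (+-mono-≤ (∥∥-* x _) (∥∥-* (x -ᵢ z) (z ^ j))) ⟩
  ∥ x ∥₁ * ∥ x ^ j -ᵢ z ^ j ∥₁ + ∥ x -ᵢ z ∥₁ * ∥ z ^ j ∥₁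
    ≤⟨ +-mono-≤ (*-mono₀ (0≤∥∥ x) (0≤ι (3 ℕ.^ j) *₀ 0≤∥∥ (x -ᵢ z)) ∥x∥≤2 (^-close j ∥x∥≤2 ∥z∥≤1))
                (*-monoˡ₀ (0≤∥∥ (x -ᵢ z)) (≤-trans (∥z^j∥≤1 j) (1≤ι (ℕ.m^n>0 3 j)))) ⟩
  2ℚ * (ι (3 ℕ.^ j) * ∥ x -ᵢ z ∥₁) + ∥ x -ᵢ z ∥₁ * ι (3 ℕ.^ j)
    ≡⟨ trans (collect (ι (3 ℕ.^ j)) ∥ x -ᵢ z ∥₁) (cong (_* ∥ x -ᵢ z ∥₁) (sym (ι-* 3 (3 ℕ.^ j)))) ⟩
  ι (3 ℕ.^ suc j) * ∥ x -ᵢ z ∥₁ ∎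
  where
  open ≤-Reasoning
  split : ∀ x z s t → x *ᵢ s -ᵢ z *ᵢ t ≡ x *ᵢ (s -ᵢ t) +ᵢ (x -ᵢ z) *ᵢ t
  split = solve-∀ ℚ[i]-ring
  collect : ∀ s d → 2ℚ * (s * d) + d * s ≡ (1ℚ + (1ℚ + (1ℚ + 0ℚ))) * s * d
  collect = solve-∀ ℚ-ring
  ∥z^j∥≤1 : ∀ j → ∥ z ^ j ∥₁ ≤ 1ℚ
  ∥z^j∥≤1 zero    = ≤-reflexive (∥⟦⟧∥ 0≤1)
  ∥z^j∥≤1 (suc j) = ≤-trans (∥∥-* z (z ^ j))
    (*-mono₀ {∥ z ∥₁} {1ℚ} {∥ z ^ j ∥₁} {1ℚ} (0≤∥∥ z) 0≤1 ∥z∥≤1 (∥z^j∥≤1 j))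

binomial-remainder : ℚ[i] → ℕ → ℚ[i]
binomial-remainder x n = (1ᵢ +ᵢ x) ^ n -ᵢ (1ᵢ +ᵢ ⟦ ι n ⟧ *ᵢ x)

-- Passing to `n + 1` adds `x` times the remainder and `n x²`; as long as `n ∥ x ∥₁ ≤ 1`, both fit
-- into the growth of `(n ∥ x ∥₁)²`.
∥binomial-remainder∥ : ∀ x n → ι n * ∥ x ∥₁ ≤ 1ℚ →
  ∥ binomial-remainder x n ∥₁ ≤ (ι n * ∥ x ∥₁) * (ι n * ∥ x ∥₁)
∥binomial-remainder∥ x zero _ = ≤-reflexive (trans (trans (cong ∥_∥₁ (lemma x)) (∥⟦⟧∥ ≤-refl)) (sym (zero² ∥ x ∥₁)))
  where
  lemma : ∀ x → 1ᵢ -ᵢ (1ᵢ +ᵢ 0ᵢ *ᵢ x) ≡ 0ᵢ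
  lemma = solve-∀ ℚ[i]-ring
  zero² : ∀ s → (0ℚ * s) * (0ℚ * s) ≡ 0ℚ
  zero² = solve-∀ ℚ-ring
∥binomial-remainder∥ x (suc n) n∥x∥≤1 = begin
  ∥ binomial-remainder x (suc n) ∥₁
    ≡⟨ cong ∥_∥₁ (trans (cong (λ t → (1ᵢ +ᵢ x) *ᵢ (1ᵢ +ᵢ x) ^ n -ᵢ (1ᵢ +ᵢ t *ᵢ x)) (⟦1+⟧ (ι n))) (split x ((1ᵢ +ᵢ x) ^ n) ⟦ ι n ⟧)) ⟩
  ∥ r +ᵢ (x *ᵢ r +ᵢ ⟦ ι n ⟧ *ᵢ (x *ᵢ x)) ∥₁
    ≤⟨ ≤-trans (∥∥-+ r _) (+-monoʳ-≤ ∥ r ∥₁ (≤-trans (∥∥-+ (x *ᵢ r) _)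
         (+-mono-≤ (∥∥-* x r) (≤-trans (∥⟦⟧*∥ (x *ᵢ x) (0≤ι n)) (*-monoˡ₀ (0≤ι n) (∥∥-* x x)))))) ⟩
  ∥ r ∥₁ + (s * ∥ r ∥₁ + ι n * (s * s))
    ≤⟨ +-mono-≤ IH (+-monoˡ-≤ (ι n * (s * s)) (*-monoˡ₀ (0≤∥∥ x) IH)) ⟩
  (ι n * s) * (ι n * s) + (s * ((ι n * s) * (ι n * s)) + ι n * (s * s))
    ≤⟨ ≤-by (0≤- ns≤1 *₀ (0≤ι n *₀ 0≤sq s) +₀ 0≤sq s) (arith (ι n) s) ⟩
  (ι (suc n) * s) * (ι (suc n) * s) ∎
  where
  open ≤-Reasoning
  r = binomial-remainder x n
  s = ∥ x ∥₁
  ns≤1 : ι n * s ≤ 1ℚ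
  ns≤1 = ≤-trans (≤-by (0≤∥∥ x) (lemma (ι n) s)) n∥x∥≤1
    where
    lemma : ∀ n s → (1ℚ + n) * s ≡ n * s + s
    lemma = solve-∀ ℚ-ring
  IH = ∥binomial-remainder∥ x n ns≤1
  ⟦1+⟧ : ∀ t → ⟦ 1ℚ + t ⟧ ≡ 1ᵢ +ᵢ ⟦ t ⟧
  ⟦1+⟧ t = refl
  split : ∀ x w n → (1ᵢ +ᵢ x) *ᵢ w -ᵢ (1ᵢ +ᵢ (1ᵢ +ᵢ n) *ᵢ x) ≡
    (w -ᵢ (1ᵢ +ᵢ n *ᵢ x)) +ᵢ (x *ᵢ (w -ᵢ (1ᵢ +ᵢ n *ᵢ x)) +ᵢ n *ᵢ (x *ᵢ x))
  split = solve-∀ ℚ[i]-ring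
  arith : ∀ n s → ((1ℚ + n) * s) * ((1ℚ + n) * s) ≡
    ((n * s) * (n * s) + (s * ((n * s) * (n * s)) + n * (s * s))) + ((1ℚ - n * s) * (n * (s * s)) + s * s)
  arith = solve-∀ ℚ-ring

opaque
  unfolding ∥_∥₁

  ∥𝑖∥≡1 : ∥ 𝑖 ∥₁ ≡ 1ℚ
  ∥𝑖∥≡1 = refl

-- From Gaussian rational approximations to complex roots

open CommutativeSemiring commutativeSemiring using (rawSemiring)

private
  module ℂ′ = RawSemiringDefs ℂ-rawSemiring
  module ℚ′ = RawSemiringDefs rawSemiring

-- The operations of ℂ act termwise, so taking the i-th term is an exact homomorphism.
term : ℕ → ℂ → ℚ[i]
term i z = seq (Re z) i ⊹ seq (Im z) i

private
  term-^ : ∀ i z k → term i (z ℂ′.^ k) ≡ term i z ^ k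
  term-^ i z zero    = refl
  term-^ i z (suc k) = cong (term i z *ᵢ_) (term-^ i z k)

  term-× : ∀ i k z → term i (k ℂ′.× z) ≡ k ℚ′.× term i z
  term-× i zero    z = refl
  term-× i (suc k) z = cong (term i z +ᵢ_) (term-× i k z)

  term-sum : ∀ i {n} (f : Fin n → ℂ) (g : Fin n → ℚ[i]) → (∀ k → term i (f k) ≡ g k) →
    term i (ℂ′.sum f) ≡ ℚ′.sum g
  term-sum i {zero}  f g f≡g = refl
  term-sum i {suc n} f g f≡g = cong₂ _+ᵢ_ (f≡g zero) (term-sum i (λ k → f (suc k)) (λ k → g (suc k)) (λ k → f≡g (suc k)))

term-independencePolynomial : ∀ {n} (G : SimpleGraph n) i z →
  term i (independencePolynomial G ℂ-rawSemiring z) ≡ independencePolynomial G rawSemiring (term i z)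
term-independencePolynomial G i z = term-sum i {suc (independenceNumber G)}
  (λ k → indepCount G (toℕ k) ℂ′.× (z ℂ′.^ toℕ k)) (λ k → indepCount G (toℕ k) ℚ′.× (term i z ^ toℕ k)) λ k →
  trans (term-× i (indepCount G (toℕ k)) (z ℂ′.^ toℕ k))
        (cong (indepCount G (toℕ k) ℚ′.×_) (term-^ i z (toℕ k)))

-- The polynomial is evaluated termwise, so the `i`-th term of its value at the limit is exactly the
-- defect of `w i`; that these defects tend to zero is all that being a root means.
limit-root : ∀ m n (w : ℕ → ℚ[i]) →
  (∀ ε → 0ℚ < ε → ∃ λ I → ∀ i j → I ℕ.≤ i → I ℕ.≤ j → ∥ w i -ᵢ w j ∥₁ < ε) →
  (∀ ε → 0ℚ < ε → Eventually λ i → ∥ (w i ^ m +ᵢ w i ^ n) -ᵢ 1ᵢ ∥₁ < ε) →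
  (∃ λ s → 0ℚ < s × Eventually λ i → 1ℚ + s < re (w i)) →
  ∃ λ z → IsRoot (K m n) z × 0ℝ <ℝ Re z
limit-root m n w w-cauchy w-root (s , 0<s , J , 1+s<re) = z , (small {Re value} re-part , small {Im value} im-part) , (s , 0<s , J , positive-re)
  where

  ∣re∣≤∥∥ : ∀ z → ∣ re z ∣ ≤ ∥ z ∥₁
  ∣re∣≤∥∥ z with ∣p∣≡p∨∣p∣≡-p (re z)
  ... | inj₁ eq = subst (_≤ ∥ z ∥₁) (sym eq) (re≤∥∥ z)
  ... | inj₂ eq = subst (_≤ ∥ z ∥₁) (sym eq) (-re≤∥∥ z)

  re-seq : ℝ
  re-seq = mkℝ (λ i → re (w i) - 1ℚ) λ ε 0<ε → proj₁ (w-cauchy ε 0<ε) , λ i j I≤i I≤j →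
    ≤-<-trans (subst (λ t → ∣ t ∣ ≤ ∥ w i -ᵢ w j ∥₁) (shift (re (w i)) (re (w j))) (∣re∣≤∥∥ (w i -ᵢ w j)))
      (proj₂ (w-cauchy ε 0<ε) i j I≤i I≤j)
    where
    shift : ∀ a b → a - b ≡ (a - 1ℚ) - (b - 1ℚ)
    shift = solve-∀ ℚ-ring

  im-seq : ℝ
  im-seq = mkℝ (λ i → im (w i)) λ ε 0<ε → proj₁ (w-cauchy ε 0<ε) , λ i j I≤i I≤j →
    ≤-<-trans (∣im∣≤∥∥ (w i -ᵢ w j)) (proj₂ (w-cauchy ε 0<ε) i j I≤i I≤j)

  z : ℂ
  z = re-seq +i im-seq

  value : ℂ
  value = independencePolynomial (K m n) ℂ-rawSemiring z

  1+z≡w : ∀ i → 1ᵢ +ᵢ term i z ≡ w i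
  1+z≡w i = cong₂ _⊹_ (cancel (re (w i))) (+-identityˡ (im (w i)))
    where
    cancel : ∀ a → 1ℚ + (a - 1ℚ) ≡ a
    cancel = solve-∀ ℚ-ring

  term-value : ∀ i → term i value ≡ (w i ^ m +ᵢ w i ^ n) -ᵢ 1ᵢ
  term-value i = begin
    term i value ≡⟨ term-independencePolynomial (K m n) i z ⟩
    P            ≡⟨ cancel P ⟩
    (P +ᵢ 1ᵢ) -ᵢ 1ᵢ
      ≡⟨ cong (_-ᵢ 1ᵢ) (independencePolynomial-K commutativeSemiring m n (term i z)) ⟩
    ((1ᵢ +ᵢ term i z) ^ m +ᵢ (1ᵢ +ᵢ term i z) ^ n) -ᵢ 1ᵢ
      ≡⟨ cong (λ t → (t ^ m +ᵢ t ^ n) -ᵢ 1ᵢ) (1+z≡w i) ⟩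
    (w i ^ m +ᵢ w i ^ n) -ᵢ 1ᵢ ∎
    where
    open ≡-Reasoning
    P = independencePolynomial (K m n) rawSemiring (term i z)
    cancel : ∀ p → p ≡ (p +ᵢ 1ᵢ) -ᵢ 1ᵢ
    cancel = solve-∀ ℚ[i]-ring

  small : ∀ {x : ℝ} → (∀ i → ∣ seq x i ∣ ≤ ∥ term i value ∥₁) → x ≈ℝ 0ℝ
  small {x} x≤ ε 0<ε = proj₁ (w-root ε 0<ε) , λ i I≤i →
    subst (λ t → ∣ t ∣ < ε) (sym (+-identityʳ (seq x i)))
      (≤-<-trans (x≤ i) (subst (λ t → ∥ t ∥₁ < ε) (sym (term-value i)) (proj₂ (w-root ε 0<ε) i I≤i)))

  re-part : ∀ i → ∣ seq (Re value) i ∣ ≤ ∥ term i value ∥₁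
  re-part i = ∣re∣≤∥∥ (term i value)

  im-part : ∀ i → ∣ seq (Im value) i ∣ ≤ ∥ term i value ∥₁
  im-part i = ∣im∣≤∥∥ (term i value)

  positive-re : ∀ i → J ℕ.≤ i → 0ℚ + s < re (w i) - 1ℚ
  positive-re i J≤i = <-by (0<- (1+s<re i J≤i)) (rearrange s (re (w i)))
    where
    rearrange : ∀ s a → a - 1ℚ ≡ (0ℚ + s) + (a - (1ℚ + s))
    rearrange = solve-∀ ℚ-ring

unstable : ∀ {n} {G : SimpleGraph n} → (∃ λ z → IsRoot G z × 0ℝ <ℝ Re z) → ¬ Stable G
unstable (z , root , ε , 0<ε , I , ε<re) stable with stable z root ε 0<ε
... | J , re<ε = <-irrefl refl (<-trans (ε<re k (ℕ.m≤m⊔n I J)) (re<ε k (ℕ.m≤n⊔m I J)))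
  where k = I ℕ.⊔ J

-- The damped Newton iteration

opaque
  unfolding ∥_∥₁

  ∥conj∥ : ∀ z → ∥ conj z ∥₁ ≡ ∥ z ∥₁
  ∥conj∥ (a ⊹ b) = cong (λ t → ∣ a ∣ + t) (∣-p∣≡∣p∣ b)

-- The `r = 1 / k` in the step cancels the `k` in the exponent, `n k r = n`. The remainder bound is
-- therefore the same for all `k`, which is what makes the later constants independent of `k`.
power-step : ∀ {k r} → ι k * r ≡ 1ℚ → 0ℚ ≤ r → ∀ w ζ n → ι n * ∥ ζ ∥₁ ≤ 1ℚ → ∃ λ ρ →
  (w *ᵢ (1ᵢ +ᵢ ⟦ r ⟧ *ᵢ ζ)) ^ (n ℕ.* k) ≡ w ^ (n ℕ.* k) *ᵢ ((1ᵢ +ᵢ ⟦ ι n ⟧ *ᵢ ζ) +ᵢ ρ) ×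
  ∥ ρ ∥₁ ≤ (ι n * ∥ ζ ∥₁) * (ι n * ∥ ζ ∥₁)
power-step {k} {r} kr≡1 0≤r w ζ n n∥ζ∥≤1 = binomial-remainder x (n ℕ.* k) , expand , ≤-trans
  (∥binomial-remainder∥ x (n ℕ.* k) (≤-trans nk∥x∥≤n∥ζ∥ n∥ζ∥≤1))
  (*-mono₀ 0≤nk∥x∥ (0≤ι n *₀ 0≤∥∥ ζ) nk∥x∥≤n∥ζ∥ nk∥x∥≤n∥ζ∥)
  where
  x = ⟦ r ⟧ *ᵢ ζ
  0≤nk∥x∥ = 0≤ι (n ℕ.* k) *₀ 0≤∥∥ x
  nkr≡n : ι (n ℕ.* k) * r ≡ ι n
  nkr≡n = trans (cong (_* r) (ι-* n k)) (trans (*-assoc (ι n) (ι k) r)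
    (trans (cong (ι n *_) kr≡1) (*-identityʳ (ι n))))
  nk∥x∥≤n∥ζ∥ : ι (n ℕ.* k) * ∥ x ∥₁ ≤ ι n * ∥ ζ ∥₁
  nk∥x∥≤n∥ζ∥ = ≤-trans (*-mono₀ (0≤ι (n ℕ.* k)) (0≤r *₀ 0≤∥∥ ζ) (≤-refl {ι (n ℕ.* k)}) (∥⟦⟧*∥ ζ 0≤r))
    (≤-reflexive (trans (sym (*-assoc (ι (n ℕ.* k)) r ∥ ζ ∥₁)) (cong (_* ∥ ζ ∥₁) nkr≡n)))
  linear : ⟦ ι (n ℕ.* k) ⟧ *ᵢ x ≡ ⟦ ι n ⟧ *ᵢ ζ
  linear = trans (assoc ⟦ ι (n ℕ.* k) ⟧ ⟦ r ⟧ ζ)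
    (cong (_*ᵢ ζ) (trans (sym (⟦⟧-* (ι (n ℕ.* k)) r)) (cong ⟦_⟧ nkr≡n)))
    where
    assoc : ∀ x y z → x *ᵢ (y *ᵢ z) ≡ (x *ᵢ y) *ᵢ z
    assoc = solve-∀ ℚ[i]-ring
  expand : (w *ᵢ (1ᵢ +ᵢ x)) ^ (n ℕ.* k) ≡ w ^ (n ℕ.* k) *ᵢ ((1ᵢ +ᵢ ⟦ ι n ⟧ *ᵢ ζ) +ᵢ binomial-remainder x (n ℕ.* k))
  expand = trans (^-distrib-* w (1ᵢ +ᵢ x) (n ℕ.* k)) (cong (w ^ (n ℕ.* k) *ᵢ_) (trans
    (add-sub ((1ᵢ +ᵢ x) ^ (n ℕ.* k)) (1ᵢ +ᵢ ⟦ ι (n ℕ.* k) ⟧ *ᵢ x))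
    (cong (λ t → (1ᵢ +ᵢ t) +ᵢ binomial-remainder x (n ℕ.* k)) linear)))
    where
    add-sub : ∀ s t → s ≡ t +ᵢ (s -ᵢ t)
    add-sub = solve-∀ ℚ[i]-ring

∥Q∥≤2NQ-identity : ∀ s → s * s ≡ s + s * (s - 1ℚ)
∥Q∥≤2NQ-identity = solve-∀ ℚ-ring

∥∥≤2∥Q∥-identity2 : ∀ s → 2ℚ * s ≡ s + s
∥∥≤2∥Q∥-identity2 = solve-∀ ℚ-ring

∥∥≤2∥Q∥-identity : ∀ s → 2ℚ * s * (2ℚ * s) ≡ 2ℚ * (s * s) + (s * s + s * s)
∥∥≤2∥Q∥-identity = solve-∀ ℚ-ring

NQ≤ND-identity : ∀ q d a b x y →
  (q * (a + x) - 0ℚ * (b + y) + (d * x - 0ℚ * y)) * (q * (a + x) - 0ℚ * (b + y) + (d * x - 0ℚ * y))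
  + (q * (b + y) + 0ℚ * (a + x) + (d * y + 0ℚ * x)) * (q * (b + y) + 0ℚ * (a + x) + (d * y + 0ℚ * x))
  ≡ (x * x + y * y)
  + ((q + d) * q * ((a + x) * (a + x) + (b + y) * (b + y)) + q * d * ((x * x + y * y) - (a * a + b * b))
     + (d * (d - 1ℚ) + (d - 1ℚ)) * (x * x + y * y))
NQ≤ND-identity = solve-∀ ℚ-ring

Nc≤2Re[c̄Q]-identity : ∀ a b x y → 2ℚ * ((a + x) * x + (b + y) * y) ≡
  ((a + x) * (a + x) + (b + y) * (b + y)) + ((x * x + y * y) - (a * a + b * b))
Nc≤2Re[c̄Q]-identity = solve-∀ ℚ-ring

∥D∥≤3p∥Q∥-identity : ∀ q d s → 3ℚ * (q + d) * s ≡ (q * (2ℚ * s + s) + d * s) + (d * s + d * s)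
∥D∥≤3p∥Q∥-identity = solve-∀ ℚ-ring

ND≤18p²NQ-identity : ∀ p s n → (+ 18 / 1) * (p * p) * n ≡
  (3ℚ * p * s * (3ℚ * p * s)) + p * p * (2ℚ * n - s * s) * (+ 9 / 1)
ND≤18p²NQ-identity = solve-∀ ℚ-ring

∥D⁻¹∥∥Q∥≤2-identity2 : ∀ s x y → (s * x * y) * (s * x * y) ≡ (s * s) * ((x * x) * (y * y))
∥D⁻¹∥∥Q∥≤2-identity2 = solve-∀ ℚ-ring

∥D⁻¹∥∥Q∥≤2-identity : ∀ s n → (s * s) * (2ℚ * n * (2ℚ * n)) ≡ 2ℚ * 2ℚ * ((n * s) * (n * s))
∥D⁻¹∥∥Q∥≤2-identity = solve-∀ ℚ-ring

re-shift-identity : ∀ h s a b x y →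
  h * (a * (s * x - 0ℚ * (- y)) - b * (s * (- y) + 0ℚ * x))
  - 0ℚ * (a * (s * (- y) + 0ℚ * x) + b * (s * x - 0ℚ * (- y)))
  ≡ h * s * (a * x + b * y)
re-shift-identity = solve-∀ ℚ-ring

Re[Qe̅D]-identity : ∀ q d a b x y u v →
  (x * a - y * b) * (q * u - 0ℚ * v + (d * x - 0ℚ * y)) + (x * b + y * a) * (q * v + 0ℚ * u + (d * y + 0ℚ * x))
  ≡ d * a * (x * x + y * y) + q * ((x * a - y * b) * u - (x * b + y * a) * (- v))
Re[Qe̅D]-identity = solve-∀ ℚ-ring

-- Here P = w^(qk), Q = w^(pk) with p = q + d, and c = P + Q.
module Geometry {q d : ℚ} (0≤q : 0ℚ ≤ q) (1≤d : 1ℚ ≤ d) (P Q : ℚ[i])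
                (NP≤NQ : N P ≤ N Q) (1≤NQ : 1ℚ ≤ N Q) where

  p = q + d
  c = P +ᵢ Q
  D = ⟦ q ⟧ *ᵢ c +ᵢ ⟦ d ⟧ *ᵢ Q

  0≤d : 0ℚ ≤ d
  0≤d = ≤-trans 0≤1 1≤d

  0≤p : 0ℚ ≤ p
  0≤p = 0≤q +₀ 0≤d

  1≤∥Q∥ : 1ℚ ≤ ∥ Q ∥₁
  1≤∥Q∥ = sq-cancel-≤ (0≤∥∥ Q) (≤-trans 1≤NQ (N≤∥∥² Q))

  ∥Q∥≤2NQ : ∥ Q ∥₁ ≤ 2ℚ * N Q
  ∥Q∥≤2NQ = ≤-trans (≤-by (0≤∥∥ Q *₀ 0≤- 1≤∥Q∥) (∥Q∥≤2NQ-identity ∥ Q ∥₁)) (∥∥²≤2N Q)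

  ∥∥≤2∥Q∥ : ∀ {z} → N z ≤ N Q → ∥ z ∥₁ ≤ 2ℚ * ∥ Q ∥₁
  ∥∥≤2∥Q∥ {z} Nz≤NQ = sq-cancel-≤ (≤-trans (0≤∥∥ Q) (≤-by (0≤∥∥ Q) (∥∥≤2∥Q∥-identity2 ∥ Q ∥₁))) (begin
    ∥ z ∥₁ * ∥ z ∥₁         ≤⟨ ∥∥²≤2N z ⟩
    2ℚ * N z              ≤⟨ *-monoˡ-≤-nonNeg 2ℚ Nz≤NQ ⟩
    2ℚ * N Q              ≤⟨ *-monoˡ-≤-nonNeg 2ℚ (N≤∥∥² Q) ⟩
    2ℚ * (∥ Q ∥₁ * ∥ Q ∥₁)  ≤⟨ ≤-by (0≤sq ∥ Q ∥₁ +₀ 0≤sq ∥ Q ∥₁) (∥∥≤2∥Q∥-identity ∥ Q ∥₁) ⟩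
    2ℚ * ∥ Q ∥₁ * (2ℚ * ∥ Q ∥₁) ∎)
    where
    open ≤-Reasoning

  ∥P∥≤2∥Q∥ : ∥ P ∥₁ ≤ 2ℚ * ∥ Q ∥₁
  ∥P∥≤2∥Q∥ = ∥∥≤2∥Q∥ {P} NP≤NQ

  -- Expanding `|q c + d Q|²` with `2 Re(c̄ Q) = |c|² + |Q|² - |P|²` leaves nonnegative terms, among
  -- them `d² |Q|²`. So the denominator of the Newton step stays away from zero wherever `P` and `Q`
  -- point.
  NQ≤ND : N Q ≤ N D
  NQ≤ND = ≤-by
    (0≤p *₀ 0≤q *₀ 0≤N c +₀ 0≤q *₀ 0≤d *₀ 0≤- NP≤NQ +₀ (0≤d *₀ 0≤- 1≤d +₀ 0≤- 1≤d) *₀ 0≤N Q)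
    (NQ≤ND-identity q d (re P) (im P) (re Q) (im Q))

  -- With `P = c - Q`, the inequality `|P|² ≤ |Q|²` expands to exactly this. It makes `Re Q`
  -- positive when `c` is close to a positive real that is not too small.
  Nc≤2Re[c̄Q] : N c ≤ 2ℚ * (re c * re Q + im c * im Q)
  Nc≤2Re[c̄Q] = ≤-by (0≤- NP≤NQ) (Nc≤2Re[c̄Q]-identity (re P) (im P) (re Q) (im Q))

  ∥D∥≤3p∥Q∥ : ∥ D ∥₁ ≤ 3ℚ * p * ∥ Q ∥₁
  ∥D∥≤3p∥Q∥ = begin
    ∥ D ∥₁ ≤⟨ ∥∥-+ (⟦ q ⟧ *ᵢ c) (⟦ d ⟧ *ᵢ Q) ⟩
    ∥ ⟦ q ⟧ *ᵢ c ∥₁ + ∥ ⟦ d ⟧ *ᵢ Q ∥₁ ≤⟨ +-mono-≤ (∥⟦⟧*∥ c 0≤q) (∥⟦⟧*∥ Q 0≤d) ⟩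
    q * ∥ c ∥₁ + d * ∥ Q ∥₁
      ≤⟨ +-monoˡ-≤ (d * ∥ Q ∥₁) (*-monoˡ₀ 0≤q (≤-trans (∥∥-+ P Q) (+-monoˡ-≤ ∥ Q ∥₁ ∥P∥≤2∥Q∥))) ⟩
    q * (2ℚ * ∥ Q ∥₁ + ∥ Q ∥₁) + d * ∥ Q ∥₁
      ≤⟨ ≤-by (0≤d *₀ 0≤∥∥ Q +₀ 0≤d *₀ 0≤∥∥ Q) (∥D∥≤3p∥Q∥-identity q d ∥ Q ∥₁) ⟩
    3ℚ * p * ∥ Q ∥₁ ∎
    where
    open ≤-Reasoning

  ND≤18p²NQ : N D ≤ (+ 18 / 1) * (p * p) * N Q
  ND≤18p²NQ = begin
    N D           ≤⟨ N≤∥∥² D ⟩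
    ∥ D ∥₁ * ∥ D ∥₁ ≤⟨ *-mono₀ (0≤∥∥ D) (≤-trans (0≤∥∥ D) ∥D∥≤3p∥Q∥) ∥D∥≤3p∥Q∥ ∥D∥≤3p∥Q∥ ⟩
    3ℚ * p * ∥ Q ∥₁ * (3ℚ * p * ∥ Q ∥₁)
      ≤⟨ ≤-by (0≤sq p *₀ 0≤- (∥∥²≤2N Q) *₀ nonNegative⁻¹ (+ 9 / 1)) (ND≤18p²NQ-identity p ∥ Q ∥₁ (N Q)) ⟩
    (+ 18 / 1) * (p * p) * N Q ∎
    where
    open ≤-Reasoning

  0<ND : 0ℚ < N D
  0<ND = <-≤-trans 0<1 (≤-trans 1≤NQ NQ≤ND)

  s : ℚ
  s = proj₁ (inverse D 0<ND)

  0<s : 0ℚ < s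
  0<s = proj₁ (proj₂ (inverse D 0<ND))

  NDs≡1 : N D * s ≡ 1ℚ
  NDs≡1 = proj₁ (proj₂ (proj₂ (inverse D 0<ND)))

  D⁻¹ : ℚ[i]
  D⁻¹ = ⟦ s ⟧ *ᵢ conj D

  DD⁻¹≡1 : D *ᵢ D⁻¹ ≡ 1ᵢ
  DD⁻¹≡1 = proj₂ (proj₂ (proj₂ (inverse D 0<ND)))

  -- A lower bound for `s = 1 / N D`, used wherever a gain is bounded from below; `18 = 2 · 3²`
  -- stems from `∥ D ∥₁ ≤ 3 p ∥ Q ∥₁` and `∥ Q ∥₁² ≤ 2 N Q`.
  1≤18p²NQs : 1ℚ ≤ (+ 18 / 1) * (p * p) * (N Q * s)
  1≤18p²NQs = begin
    1ℚ      ≡⟨ NDs≡1 ⟨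
    N D * s ≤⟨ *-monoʳ₀ (<⇒≤ 0<s) ND≤18p²NQ ⟩
    (+ 18 / 1) * (p * p) * N Q * s ≡⟨ *-assoc ((+ 18 / 1) * (p * p)) (N Q) s ⟩
    (+ 18 / 1) * (p * p) * (N Q * s) ∎
    where open ≤-Reasoning

  -- In the squares, each of the norms of `D` and `Q` costs a factor `2` over `N`, and `N Q ≤ N D`.
  -- The product is what a step needs, since it changes `Q` by about `p ζ Q`.
  ∥D⁻¹∥∥Q∥≤2 : ∥ D⁻¹ ∥₁ * ∥ Q ∥₁ ≤ 2ℚ
  ∥D⁻¹∥∥Q∥≤2 = ≤-trans
    (*-monoʳ₀ (0≤∥∥ Q)
      (subst (λ t → ∥ D⁻¹ ∥₁ ≤ s * t) (∥conj∥ D) (∥⟦⟧*∥ (conj D) (<⇒≤ 0<s))))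
    (sq-cancel-≤ (nonNegative⁻¹ 2ℚ) (begin
      (s * ∥ D ∥₁ * ∥ Q ∥₁) * (s * ∥ D ∥₁ * ∥ Q ∥₁) ≡⟨ ∥D⁻¹∥∥Q∥≤2-identity2 s ∥ D ∥₁ ∥ Q ∥₁ ⟩
      (s * s) * ((∥ D ∥₁ * ∥ D ∥₁) * (∥ Q ∥₁ * ∥ Q ∥₁))
        ≤⟨ *-monoˡ₀ (0≤sq s)
             (*-mono₀ (0≤sq ∥ D ∥₁) (nonNegative⁻¹ 2ℚ *₀ 0≤N D) (∥∥²≤2N D)
               (≤-trans (∥∥²≤2N Q) (*-monoˡ-≤-nonNeg 2ℚ NQ≤ND))) ⟩
      (s * s) * (2ℚ * N D * (2ℚ * N D))   ≡⟨ ∥D⁻¹∥∥Q∥≤2-identity s (N D) ⟩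
      2ℚ * 2ℚ * ((N D * s) * (N D * s))   ≡⟨ cong (λ t → 2ℚ * 2ℚ * (t * t)) NDs≡1 ⟩
      2ℚ * 2ℚ ∎))
    where
    open ≤-Reasoning

  re-shift : ∀ h z → re (⟦ h ⟧ *ᵢ (z *ᵢ D⁻¹)) ≡ h * s * (re z * re D + im z * im D)
  re-shift h z = re-shift-identity h s (re z) (im z) (re D) (im D)

  -- Splits the first-order change of `Re Q` along `D = q c + d Q`: the part from `Q` has the sign
  -- of `Re e`, the part from `c` is harmless while `c` is small.
  Re[Qe̅D] : ∀ e → re (Q *ᵢ e) * re D + im (Q *ᵢ e) * im D ≡ d * re e * N Q + q * re (Q *ᵢ e *ᵢ conj c)
  Re[Qe̅D] e = Re[Qe̅D]-identity q d (re e) (im e) (re Q) (im Q) (re c) (im c)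

module Exponents {k : ℕ} (1≤k : 1 ℕ.≤ k) (q d : ℕ) (1≤q : 1 ℕ.≤ q) (1≤d : 1 ℕ.≤ d)
                 {w : ℚ[i]} (1≤Nw : 1ℚ ≤ N w) where
  P Q : ℚ[i]
  P = w ^ (q ℕ.* k)
  Q = w ^ ((q ℕ.+ d) ℕ.* k)

  1≤NQ : 1ℚ ≤ N Q
  1≤NQ = 1≤N-^ {w} ((q ℕ.+ d) ℕ.* k) 1≤Nw

  NP≤NQ : N P ≤ N Q
  NP≤NQ = subst₂ _≤_ (*-identityʳ (N P)) NQ≡
    (*-monoˡ₀ (0≤N P) (1≤N-^ {w} (d ℕ.* k) 1≤Nw))
    where
    NQ≡ : N P * N (w ^ (d ℕ.* k)) ≡ N Q
    NQ≡ = trans (sym (N-* P (w ^ (d ℕ.* k)))) (cong N (trans (sym (^-homo-* w (q ℕ.* k) (d ℕ.* k)))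
      (cong (w ^_) (sym (ℕ.*-distribʳ-+ k q d)))))

  Nw≤NQ : N w ≤ N Q
  Nw≤NQ = N≤N-^ {w} (ℕ.*-mono-≤ (ℕ.≤-trans 1≤q (ℕ.m≤m+n q d)) 1≤k) 1≤Nw

  open Geometry (0≤ι q) (1≤ι 1≤d) P Q NP≤NQ 1≤NQ public

  e : ℚ[i]
  e = 1ᵢ -ᵢ c

  1≤p : 1ℚ ≤ p
  1≤p = ≤-trans (1≤ι 1≤d) (≤-by (0≤ι q) (+-comm (ι q) (ι d)))

∥ζ∥∥Q∥≤σ-identity2 : ∀ h a b c → h * (a * b) * c ≡ h * (a * (b * c))
∥ζ∥∥Q∥≤σ-identity2 = solve-∀ ℚ-ring

∥ζ∥∥Q∥≤σ-identity : ∀ h m → h * (4ℚ * m * 2ℚ) ≡ 8ℚ * (h * m)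
∥ζ∥∥Q∥≤σ-identity = solve-∀ ℚ-ring

∥ζ∥≤σ-identity : ∀ a b → a * b ≡ a + a * (b - 1ℚ)
∥ζ∥≤σ-identity = solve-∀ ℚ-ring

hp≤-identity : ∀ h p → h * (p * p * p) ≡ h * p + h * p * (p * p - 1ℚ)
hp≤-identity = solve-∀ ℚ-ring

pσ≤1-identity : ∀ h p m → 1ℚ ≡ p * (8ℚ * (h * m)) +
  (8ℚ * (h * p * (1ℚ - m) + ((+ 1 / 36864) - h * p)) + (1ℚ - 8ℚ * (+ 1 / 36864)))
pσ≤1-identity = solve-∀ ℚ-ring

∥Q∥*square-identity : ∀ x z s → x * ((s * z) * (s * z)) ≡ s * s * ((z * x) * z)
∥Q∥*square-identity = solve-∀ ℚ-ring

∥remainder∥≤-identity : ∀ p h m → 2ℚ * (p * p * (8ℚ * (h * m) * (8ℚ * (h * m)))) + p * p * (8ℚ * (h * m) * (8ℚ * (h * m)))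
  ≡ (+ 192 / 1) * (p * p) * (h * h * (m * m))
∥remainder∥≤-identity = solve-∀ ℚ-ring

Dζ≡he-identity2 : ∀ D h e i → D *ᵢ (h *ᵢ (e *ᵢ i)) ≡ h *ᵢ e *ᵢ (D *ᵢ i)
Dζ≡he-identity2 = solve-∀ ℚ[i]-ring

Dζ≡he-identity : ∀ x → x *ᵢ 1ᵢ ≡ x
Dζ≡he-identity = solve-∀ ℚ[i]-ring

c′≡-identity : ∀ P Q q d z s t → P *ᵢ ((1ᵢ +ᵢ q *ᵢ z) +ᵢ s) +ᵢ Q *ᵢ ((1ᵢ +ᵢ (q +ᵢ d) *ᵢ z) +ᵢ t) ≡
  ((P +ᵢ Q) +ᵢ (q *ᵢ (P +ᵢ Q) +ᵢ d *ᵢ Q) *ᵢ z) +ᵢ (P *ᵢ s +ᵢ Q *ᵢ t)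
c′≡-identity = solve-∀ ℚ[i]-ring

e′≡-identity : ∀ c h s → 1ᵢ -ᵢ ((c +ᵢ h *ᵢ (1ᵢ -ᵢ c)) +ᵢ s) ≡ (1ᵢ -ᵢ h) *ᵢ (1ᵢ -ᵢ c) -ᵢ s
e′≡-identity = solve-∀ ℚ[i]-ring

∥Q′-Q∥≤-identity4 : ∀ Q z s → Q *ᵢ ((1ᵢ +ᵢ z) +ᵢ s) -ᵢ Q ≡ Q *ᵢ z +ᵢ Q *ᵢ s
∥Q′-Q∥≤-identity4 = solve-∀ ℚ[i]-ring

∥Q′-Q∥≤-identity3 : ∀ x p z → x * (p * z) ≡ p * (z * x)
∥Q′-Q∥≤-identity3 = solve-∀ ℚ-ring

∥Q′-Q∥≤-identity2 : ∀ p s → p * s + p * s ≡ p * s + p * p * (s * s) + p * s * (1ℚ - p * s)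
∥Q′-Q∥≤-identity2 = solve-∀ ℚ-ring

∥Q′-Q∥≤-identity : ∀ p h m → p * (8ℚ * (h * m)) + p * (8ℚ * (h * m)) ≡ 16ℚ * p * (h * m)
∥Q′-Q∥≤-identity = solve-∀ ℚ-ring

∥w′-w∥≤-identity3 : ∀ w x → w *ᵢ (1ᵢ +ᵢ x) -ᵢ w ≡ w *ᵢ x
∥w′-w∥≤-identity3 = solve-∀ ℚ[i]-ring

∥w′-w∥≤-identity2 : ∀ x r z → 2ℚ * x * (r * z) ≡ 2ℚ * r * (z * x)
∥w′-w∥≤-identity2 = solve-∀ ℚ-ring

∥w′-w∥≤-identity : ∀ r h m → 2ℚ * r * (8ℚ * (h * m)) ≡ 16ℚ * (h * m) * r
∥w′-w∥≤-identity = solve-∀ ℚ-ring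

Nw′≥-identity : ∀ n r a b → n * ((1ℚ + (r * a - 0ℚ * b)) * (1ℚ + (r * a - 0ℚ * b)) + (0ℚ + (r * b + 0ℚ * a)) * (0ℚ + (r * b + 0ℚ * a)))
  ≡ (n + 2ℚ * r * a) + ((n - 1ℚ) * (2ℚ * r * a) + n * (r * a * (r * a) + r * b * (r * b)))
Nw′≥-identity = solve-∀ ℚ-ring

ReQ≤ReQ′-identity2 : ∀ Q z p s → Q *ᵢ ((1ᵢ +ᵢ p *ᵢ z) +ᵢ s) ≡ Q +ᵢ (Q *ᵢ (p *ᵢ z) +ᵢ Q *ᵢ s)
ReQ≤ReQ′-identity2 = solve-∀ ℚ[i]-ring

ReQ≤ReQ′-identity : ∀ Q p h e i → Q *ᵢ (p *ᵢ (h *ᵢ (e *ᵢ i))) ≡ p *ᵢ (h *ᵢ (Q *ᵢ e *ᵢ i))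
ReQ≤ReQ′-identity = solve-∀ ℚ[i]-ring

lemma₂-identity : ∀ p a b → p * a - 0ℚ * b ≡ p * a
lemma₂-identity = solve-∀ ℚ-ring

-T≤-identity : ∀ n m c → 2ℚ * n * (4ℚ * m) * c ≡ 8ℚ * m * n * c
-T≤-identity = solve-∀ ℚ-ring

G≥-identity : ∀ d a n q t m c → d * a * n + q * t ≡ (+ 1 / 32) * (m * n)
  + ((+ 1 / 16) * (16ℚ * a) * (d - 1ℚ) * n
     + (+ 1 / 16) * (16ℚ * a - m) * n
     + q * (8ℚ * m * n * c - (- t))
     + 8ℚ * (m * n) * ((+ 1 / 256) - q * c))
G≥-identity = solve-∀ ℚ-ring

μ²≤μ-identity : ∀ m → m ≡ m * m + m * (1ℚ - m)
μ²≤μ-identity = solve-∀ ℚ-ring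

gain≥0-identity : ∀ p h s G t m n → p * (h * s * G) + t ≡ 0ℚ +
  (p * (h * s) * (G - (+ 1 / 32) * (m * n))
   + (p * p * (8ℚ * (h * m) * (8ℚ * (h * m))) - (- t))
   + (+ 64 / 1) * (p * p) * (h * h) * (m - m * m)
   + (+ 64 / 1) * (p * p) * (h * h) * m * ((+ 18 / 1) * (p * p) * (n * s) - 1ℚ)
   + (+ 1152 / 1) * (p * (h * s) * (m * n)) * ((+ 1 / 36864) - h * (p * p * p)))
gain≥0-identity = solve-∀ ℚ-ring

module Step {k : ℕ} (1≤k : 1 ℕ.≤ k) {r : ℚ} (kr≡1 : ι k * r ≡ 1ℚ) (0≤r : 0ℚ ≤ r)
            (q d : ℕ) (1≤q : 1 ℕ.≤ q) (1≤d : 1 ℕ.≤ d)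
            {w : ℚ[i]} (1≤Nw : 1ℚ ≤ N w)
            {h μ : ℚ} (0≤h : 0ℚ ≤ h) (0≤μ : 0ℚ ≤ μ) (μ≤1 : μ ≤ 1ℚ)
            (h-small : h * ((ι q + ι d) * (ι q + ι d) * (ι q + ι d)) ≤ + 1 / 36864)
            (∥e∥≤4μ : ∥ Exponents.e 1≤k q d 1≤q 1≤d {w} 1≤Nw ∥₁ ≤ 4ℚ * μ) where
  open Exponents 1≤k q d 1≤q 1≤d {w} 1≤Nw

  -- `D` is the derivative of `c` with respect to `k log w`, so `ζ` is the Newton correction of
  -- `k log w` towards `c = 1`, damped by `h`.
  ζ w′ : ℚ[i]
  ζ = ⟦ h ⟧ *ᵢ (e *ᵢ D⁻¹)
  w′ = w *ᵢ (1ᵢ +ᵢ ⟦ r ⟧ *ᵢ ζ)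

  σ : ℚ
  σ = 8ℚ * (h * μ)

  0≤σ : 0ℚ ≤ σ
  0≤σ = nonNegative⁻¹ 8ℚ *₀ (0≤h *₀ 0≤μ)

  ∥ζ∥∥Q∥≤σ : ∥ ζ ∥₁ * ∥ Q ∥₁ ≤ σ
  ∥ζ∥∥Q∥≤σ = begin
    ∥ ζ ∥₁ * ∥ Q ∥₁
      ≤⟨ *-monoʳ₀ (0≤∥∥ Q) (≤-trans (∥⟦⟧*∥ (e *ᵢ D⁻¹) 0≤h)
           (*-monoˡ₀ 0≤h (∥∥-* e D⁻¹))) ⟩
    h * (∥ e ∥₁ * ∥ D⁻¹ ∥₁) * ∥ Q ∥₁ ≡⟨ ∥ζ∥∥Q∥≤σ-identity2 h ∥ e ∥₁ ∥ D⁻¹ ∥₁ ∥ Q ∥₁ ⟩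
    h * (∥ e ∥₁ * (∥ D⁻¹ ∥₁ * ∥ Q ∥₁))
      ≤⟨ *-monoˡ₀ 0≤h (*-mono₀ (0≤∥∥ e) (nonNegative⁻¹ 2ℚ) ∥e∥≤4μ ∥D⁻¹∥∥Q∥≤2) ⟩
    h * (4ℚ * μ * 2ℚ) ≡⟨ ∥ζ∥∥Q∥≤σ-identity h μ ⟩
    σ ∎
    where
    open ≤-Reasoning

  ∥ζ∥≤σ : ∥ ζ ∥₁ ≤ σ
  ∥ζ∥≤σ = ≤-trans (≤-by (0≤∥∥ ζ *₀ 0≤- 1≤∥Q∥) (∥ζ∥≤σ-identity ∥ ζ ∥₁ ∥ Q ∥₁)) ∥ζ∥∥Q∥≤σ

  1≤p² : 1ℚ ≤ p * p
  1≤p² = *-mono₀ {1ℚ} {p} {1ℚ} {p} 0≤1 0≤p 1≤p 1≤p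

  hp≤ : h * p ≤ + 1 / 36864
  hp≤ = ≤-trans (≤-by (0≤h *₀ 0≤p *₀ 0≤- 1≤p²) (hp≤-identity h p)) h-small

  pσ≤1 : p * σ ≤ 1ℚ
  pσ≤1 = ≤-by
    (nonNegative⁻¹ 8ℚ *₀ (0≤h *₀ 0≤p *₀ 0≤- μ≤1 +₀ 0≤- hp≤) +₀ nonNegative⁻¹ (1ℚ - 8ℚ * (+ 1 / 36864)))
    (pσ≤1-identity h p μ)

  q≤p : ι q ≤ p
  q≤p = ≤-by 0≤d refl

  q∥ζ∥≤pσ : ι q * ∥ ζ ∥₁ ≤ p * σ
  q∥ζ∥≤pσ = *-mono₀ (0≤ι q) 0≤σ q≤p ∥ζ∥≤σ

  ιp≡p : ι (q ℕ.+ d) ≡ p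
  ιp≡p = ι-+ q d

  p∥ζ∥≤pσ : p * ∥ ζ ∥₁ ≤ p * σ
  p∥ζ∥≤pσ = *-monoˡ₀ 0≤p ∥ζ∥≤σ

  private
    stepP = power-step {k} kr≡1 0≤r w ζ q (≤-trans q∥ζ∥≤pσ pσ≤1)
    stepQ = power-step {k} kr≡1 0≤r w ζ (q ℕ.+ d) (≤-trans (≤-trans (≤-reflexive (cong (_* ∥ ζ ∥₁) ιp≡p)) p∥ζ∥≤pσ) pσ≤1)

  ρP ρQ P′ Q′ c′ e′ : ℚ[i]
  ρP = proj₁ stepP
  ρQ = proj₁ stepQ
  P′ = w′ ^ (q ℕ.* k)
  Q′ = w′ ^ ((q ℕ.+ d) ℕ.* k)
  c′ = P′ +ᵢ Q′
  e′ = 1ᵢ -ᵢ c′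

  P′≡ : P′ ≡ P *ᵢ ((1ᵢ +ᵢ ⟦ ι q ⟧ *ᵢ ζ) +ᵢ ρP)
  P′≡ = proj₁ (proj₂ stepP)

  Q′≡ : Q′ ≡ Q *ᵢ ((1ᵢ +ᵢ ⟦ p ⟧ *ᵢ ζ) +ᵢ ρQ)
  Q′≡ = trans (proj₁ (proj₂ stepQ)) (cong (λ t → Q *ᵢ ((1ᵢ +ᵢ ⟦ t ⟧ *ᵢ ζ) +ᵢ ρQ)) ιp≡p)

  ∥Q∥*square : ∀ {t s} → 0ℚ ≤ t → t ≤ (s * ∥ ζ ∥₁) * (s * ∥ ζ ∥₁) → 0ℚ ≤ s → s ≤ p → ∥ Q ∥₁ * t ≤ p * p * (σ * σ)
  ∥Q∥*square {t} {s} 0≤t t≤ 0≤s s≤p = begin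
    ∥ Q ∥₁ * t ≤⟨ *-monoˡ₀ (0≤∥∥ Q) t≤ ⟩
    ∥ Q ∥₁ * ((s * ∥ ζ ∥₁) * (s * ∥ ζ ∥₁)) ≡⟨ ∥Q∥*square-identity ∥ Q ∥₁ ∥ ζ ∥₁ s ⟩
    s * s * ((∥ ζ ∥₁ * ∥ Q ∥₁) * ∥ ζ ∥₁)
      ≤⟨ *-mono₀ (0≤s *₀ 0≤s) (0≤σ *₀ 0≤σ) (*-mono₀ 0≤s 0≤p s≤p s≤p)
           (*-mono₀ (0≤∥∥ ζ *₀ 0≤∥∥ Q) 0≤σ ∥ζ∥∥Q∥≤σ ∥ζ∥≤σ) ⟩
    p * p * (σ * σ) ∎
    where
    open ≤-Reasoning

  ∥QρQ∥≤ : ∥ Q *ᵢ ρQ ∥₁ ≤ p * p * (σ * σ)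
  ∥QρQ∥≤ = ≤-trans (∥∥-* Q ρQ) (∥Q∥*square (0≤∥∥ ρQ) (subst (λ t → ∥ ρQ ∥₁ ≤ t * ∥ ζ ∥₁ * (t * ∥ ζ ∥₁)) ιp≡p (proj₂ (proj₂ stepQ))) 0≤p ≤-refl)

  ∥PρP∥≤ : ∥ P *ᵢ ρP ∥₁ ≤ 2ℚ * (p * p * (σ * σ))
  ∥PρP∥≤ = begin
    ∥ P *ᵢ ρP ∥₁           ≤⟨ ∥∥-* P ρP ⟩
    ∥ P ∥₁ * ∥ ρP ∥₁        ≤⟨ *-monoʳ₀ (0≤∥∥ ρP) ∥P∥≤2∥Q∥ ⟩
    2ℚ * ∥ Q ∥₁ * ∥ ρP ∥₁   ≡⟨ *-assoc 2ℚ ∥ Q ∥₁ ∥ ρP ∥₁ ⟩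
    2ℚ * (∥ Q ∥₁ * ∥ ρP ∥₁) ≤⟨ *-monoˡ-≤-nonNeg 2ℚ (∥Q∥*square (0≤∥∥ ρP) (proj₂ (proj₂ stepP)) (0≤ι q) q≤p) ⟩
    2ℚ * (p * p * (σ * σ)) ∎
    where open ≤-Reasoning

  remainder : ℚ[i]
  remainder = P *ᵢ ρP +ᵢ Q *ᵢ ρQ

  ∥remainder∥≤ : ∥ remainder ∥₁ ≤ (+ 192 / 1) * (p * p) * (h * h * (μ * μ))
  ∥remainder∥≤ = ≤-trans (∥∥-+ (P *ᵢ ρP) (Q *ᵢ ρQ)) (≤-trans (+-mono-≤ ∥PρP∥≤ ∥QρQ∥≤) (≤-reflexive (∥remainder∥≤-identity p h μ)))

  Dζ≡he : D *ᵢ ζ ≡ ⟦ h ⟧ *ᵢ e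
  Dζ≡he = trans (Dζ≡he-identity2 D ⟦ h ⟧ e D⁻¹) (trans (cong (⟦ h ⟧ *ᵢ e *ᵢ_) DD⁻¹≡1) (Dζ≡he-identity (⟦ h ⟧ *ᵢ e)))

  c′≡ : c′ ≡ (c +ᵢ ⟦ h ⟧ *ᵢ e) +ᵢ remainder
  c′≡ = trans (cong₂ _+ᵢ_ P′≡ Q′≡) (trans (c′≡-identity P Q ⟦ ι q ⟧ ⟦ ι d ⟧ ζ ρP ρQ)
    (cong (λ t → (c +ᵢ t) +ᵢ remainder) Dζ≡he))

  e′≡ : e′ ≡ ⟦ 1ℚ - h ⟧ *ᵢ e -ᵢ remainder
  e′≡ = trans (cong (1ᵢ -ᵢ_) c′≡) (trans (e′≡-identity c ⟦ h ⟧ remainder) (cong (λ t → t *ᵢ e -ᵢ remainder) (⟦⟧-sub)))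
    where
    ⟦⟧-sub : 1ᵢ -ᵢ ⟦ h ⟧ ≡ ⟦ 1ℚ - h ⟧
    ⟦⟧-sub = refl

  ∥Q′-Q∥≤ : ∥ Q′ -ᵢ Q ∥₁ ≤ 16ℚ * p * (h * μ)
  ∥Q′-Q∥≤ = begin
    ∥ Q′ -ᵢ Q ∥₁ ≡⟨ cong ∥_∥₁ (trans (cong (_-ᵢ Q) Q′≡) (∥Q′-Q∥≤-identity4 Q (⟦ p ⟧ *ᵢ ζ) ρQ)) ⟩
    ∥ Q *ᵢ (⟦ p ⟧ *ᵢ ζ) +ᵢ Q *ᵢ ρQ ∥₁ ≤⟨ ∥∥-+ (Q *ᵢ (⟦ p ⟧ *ᵢ ζ)) (Q *ᵢ ρQ) ⟩
    ∥ Q *ᵢ (⟦ p ⟧ *ᵢ ζ) ∥₁ + ∥ Q *ᵢ ρQ ∥₁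
      ≤⟨ +-mono-≤ (≤-trans (∥∥-* Q _) (≤-trans (*-monoˡ₀ (0≤∥∥ Q) (∥⟦⟧*∥ ζ 0≤p))
           (≤-trans (≤-reflexive (∥Q′-Q∥≤-identity3 ∥ Q ∥₁ p ∥ ζ ∥₁)) (*-monoˡ₀ 0≤p ∥ζ∥∥Q∥≤σ)))) ∥QρQ∥≤ ⟩
    p * σ + p * p * (σ * σ) ≤⟨ ≤-by (0≤p *₀ 0≤σ *₀ 0≤- pσ≤1) (∥Q′-Q∥≤-identity2 p σ) ⟩
    p * σ + p * σ ≡⟨ ∥Q′-Q∥≤-identity p h μ ⟩
    16ℚ * p * (h * μ) ∎
    where
    open ≤-Reasoning

  ∥w′-w∥≤ : ∥ w′ -ᵢ w ∥₁ ≤ 16ℚ * (h * μ) * r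
  ∥w′-w∥≤ = begin
    ∥ w′ -ᵢ w ∥₁ ≡⟨ cong ∥_∥₁ (∥w′-w∥≤-identity3 w (⟦ r ⟧ *ᵢ ζ)) ⟩
    ∥ w *ᵢ (⟦ r ⟧ *ᵢ ζ) ∥₁ ≤⟨ ∥∥-* w _ ⟩
    ∥ w ∥₁ * ∥ ⟦ r ⟧ *ᵢ ζ ∥₁ ≤⟨ *-mono₀ (0≤∥∥ w) (0≤r *₀ 0≤∥∥ ζ) (∥∥≤2∥Q∥ {w} Nw≤NQ) (∥⟦⟧*∥ ζ 0≤r) ⟩
    2ℚ * ∥ Q ∥₁ * (r * ∥ ζ ∥₁) ≡⟨ ∥w′-w∥≤-identity2 ∥ Q ∥₁ r ∥ ζ ∥₁ ⟩
    2ℚ * r * (∥ ζ ∥₁ * ∥ Q ∥₁) ≤⟨ *-monoˡ₀ (nonNegative⁻¹ 2ℚ *₀ 0≤r) ∥ζ∥∥Q∥≤σ ⟩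
    2ℚ * r * σ ≡⟨ ∥w′-w∥≤-identity r h μ ⟩
    16ℚ * (h * μ) * r ∎
    where
    open ≤-Reasoning

  Re[eD̄] : ℚ
  Re[eD̄] = re e * re D + im e * im D

  Nw′≥ : 0ℚ ≤ Re[eD̄] → N w + 2ℚ * r * (h * s * Re[eD̄]) ≤ N w′
  Nw′≥ 0≤Re = begin
    N w + 2ℚ * r * (h * s * Re[eD̄])
      ≡⟨ cong (λ t → N w + 2ℚ * r * t) (re-shift h e) ⟨
    N w + 2ℚ * r * re ζ
      ≤⟨ ≤-by (0≤- 1≤Nw *₀ (nonNegative⁻¹ 2ℚ *₀ 0≤r *₀ subst (0ℚ ≤_) (sym (re-shift h e)) (0≤h *₀ <⇒≤ 0<s *₀ 0≤Re))
               +₀ 0≤N w *₀ (0≤sq (r * re ζ) +₀ 0≤sq (r * im ζ)))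
              (Nw′≥-identity (N w) r (re ζ) (im ζ)) ⟩
    N w * N (1ᵢ +ᵢ ⟦ r ⟧ *ᵢ ζ) ≡⟨ N-* w _ ⟨
    N w′ ∎
    where
    open ≤-Reasoning

  -- In `Re(Q e D̄)` the part of `D` along `Q` contributes at least `μ N Q / 16`. The part along `c`
  -- takes away at most `8 q μ N Q ∥ c ∥₁`, and the bound `1 / 256` limits this to half of the gain.
  ReQ≤ReQ′ : ι q * ∥ c ∥₁ ≤ + 1 / 256 → μ ≤ 16ℚ * re e → re Q ≤ re Q′
  ReQ≤ReQ′ q∥c∥≤ μ≤16Re-e = ≤-by gain≥0 (trans (cong re Q′≡) (trans (cong re (ReQ≤ReQ′-identity2 Q ζ ⟦ p ⟧ ρQ))
      (cong (λ t → re Q + (t + re (Q *ᵢ ρQ))) (trans (cong re (ReQ≤ReQ′-identity Q ⟦ p ⟧ ⟦ h ⟧ e D⁻¹))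
        (trans (lemma₂ p (⟦ h ⟧ *ᵢ (Q *ᵢ e *ᵢ D⁻¹))) (cong (p *_) (re-shift h (Q *ᵢ e))))))))
    where
    open ≤-Reasoning
    G = re (Q *ᵢ e) * re D + im (Q *ᵢ e) * im D
    T = re (Q *ᵢ e *ᵢ conj c)
    lemma₂ : ∀ p z → re (⟦ p ⟧ *ᵢ z) ≡ p * re z
    lemma₂ p z = lemma₂-identity p (re z) (im z)
    -T≤ : - T ≤ 8ℚ * μ * N Q * ∥ c ∥₁
    -T≤ = begin
      - T ≤⟨ -re≤∥∥ (Q *ᵢ e *ᵢ conj c) ⟩
      ∥ Q *ᵢ e *ᵢ conj c ∥₁ ≤⟨ ∥∥-* (Q *ᵢ e) (conj c) ⟩
      ∥ Q *ᵢ e ∥₁ * ∥ conj c ∥₁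
        ≤⟨ *-mono₀ (0≤∥∥ (Q *ᵢ e)) (0≤∥∥ c) (≤-trans (∥∥-* Q e)
             (*-mono₀ (0≤∥∥ Q) (nonNegative⁻¹ 4ℚ *₀ 0≤μ) ∥Q∥≤2NQ ∥e∥≤4μ)) (≤-reflexive (∥conj∥ c)) ⟩
      2ℚ * N Q * (4ℚ * μ) * ∥ c ∥₁ ≡⟨ -T≤-identity (N Q) μ ∥ c ∥₁ ⟩
      8ℚ * μ * N Q * ∥ c ∥₁ ∎
    0≤16Re-e : 0ℚ ≤ 16ℚ * re e
    0≤16Re-e = ≤-trans 0≤μ μ≤16Re-e
    G≥ : (+ 1 / 32) * (μ * N Q) ≤ G
    G≥ = subst ((+ 1 / 32) * (μ * N Q) ≤_) (sym (Re[Qe̅D] e)) (≤-by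
      (nonNegative⁻¹ (+ 1 / 16) *₀ 0≤16Re-e *₀ 0≤- (1≤ι 1≤d) *₀ 0≤N Q
        +₀ nonNegative⁻¹ (+ 1 / 16) *₀ 0≤- μ≤16Re-e *₀ 0≤N Q
        +₀ 0≤ι q *₀ 0≤- -T≤
        +₀ nonNegative⁻¹ 8ℚ *₀ (0≤μ *₀ 0≤N Q) *₀ 0≤- q∥c∥≤)
      (G≥-identity (ι d) (re e) (N Q) (ι q) T μ ∥ c ∥₁))
    μ²≤μ : μ * μ ≤ μ
    μ²≤μ = ≤-by (0≤μ *₀ 0≤- μ≤1) (μ²≤μ-identity μ)
    -- The gain `p h s μ N Q / 32` must beat the remainder, at most `64 p² h² μ²`. By
    -- `1 ≤ 18 p² N Q s` and `μ² ≤ μ` it does if `32 · 64 · 18 h p³ ≤ 1`, whence `36864`.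
    gain≥0 : 0ℚ ≤ p * (h * s * G) + re (Q *ᵢ ρQ)
    gain≥0 = ≤-by
      (0≤p *₀ (0≤h *₀ <⇒≤ 0<s) *₀ 0≤- G≥
        +₀ 0≤- (≤-trans (-re≤∥∥ (Q *ᵢ ρQ)) ∥QρQ∥≤)
        +₀ nonNegative⁻¹ (+ 64 / 1) *₀ (0≤p *₀ 0≤p) *₀ (0≤h *₀ 0≤h) *₀ 0≤- μ²≤μ
        +₀ nonNegative⁻¹ (+ 64 / 1) *₀ (0≤p *₀ 0≤p) *₀ (0≤h *₀ 0≤h) *₀ 0≤μ *₀ 0≤- 1≤18p²NQs
        +₀ nonNegative⁻¹ (+ 1152 / 1) *₀ (0≤p *₀ (0≤h *₀ <⇒≤ 0<s) *₀ (0≤μ *₀ 0≤N Q)) *₀ 0≤- h-small)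
      (gain≥0-identity p h s G (re (Q *ᵢ ρQ)) μ (N Q))

∣∣≤ : ∀ {x a} → x ≤ a → - x ≤ a → ∣ x ∣ ≤ a
∣∣≤ {x} x≤a -x≤a with ∣p∣≡p∨∣p∣≡-p x
... | inj₁ eq = subst (_≤ _) (sym eq) x≤a
... | inj₂ eq = subst (_≤ _) (sym eq) -x≤a

opaque
  unfolding ∥_∥₁

  ∥∥≤ : ∀ {z a b} → re z ≤ a → - re z ≤ a → im z ≤ b → - im z ≤ b → ∥ z ∥₁ ≤ a + b
  ∥∥≤ p p′ q q′ = +-mono-≤ (∣∣≤ p p′) (∣∣≤ q q′)

≤-+-∥-∥ : ∀ {f : ℚ[i] → ℚ} → (∀ z w → f (z -ᵢ w) ≡ f z - f w) → (∀ z → f z ≤ ∥ z ∥₁) →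
  ∀ z w {b} → ∥ z -ᵢ w ∥₁ ≤ b → f z ≤ f w + b
≤-+-∥-∥ {f} f-- f≤ z w {b} zw≤b = ≤-by (0≤- (≤-trans (subst (_≤ ∥ z -ᵢ w ∥₁) (f-- z w) (f≤ (z -ᵢ w))) zw≤b))
  (lemma (f z) (f w) b)
  where
  lemma : ∀ x y b → y + b ≡ x + (b - (x - y))
  lemma = solve-∀ ℚ-ring

re-close : ∀ z w {b} → ∥ z -ᵢ w ∥₁ ≤ b → re z ≤ re w + b
re-close = ≤-+-∥-∥ {re} (λ z w → refl) re≤∥∥

im-close : ∀ z w {b} → ∥ z -ᵢ w ∥₁ ≤ b → im z ≤ im w + b
im-close = ≤-+-∥-∥ {im} (λ z w → refl) im≤∥∥

swap-close : ∀ z w {b} → ∥ z -ᵢ w ∥₁ ≤ b → ∥ w -ᵢ z ∥₁ ≤ b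
swap-close z w {b} = subst (_≤ b) (∥∥-sym z w)

-∣ab∣≤ : ∀ {a b s t} → a ≤ s → - a ≤ s → b ≤ t → - b ≤ t → - (s * t) ≤ a * b
-∣ab∣≤ {a} {b} {s} {t} a≤ -a≤ b≤ -b≤ = ≤-by
  (nonNegative⁻¹ ½ *₀ (0≤- a≤ *₀ 0≤- b≤ +₀ 0≤- -a≤ *₀ 0≤- -b≤))
  (lemma a b s t)
  where
  lemma : ∀ a b s t → a * b ≡ - (s * t) + ½ * ((s - a) * (t - b) + (s - - a) * (t - - b))
  lemma = solve-∀ ℚ-ring

bernoulli-identity2 : ∀ h → 1ℚ * (1ℚ + 0ℚ * h) ≡ 1ℚ
bernoulli-identity2 = solve-∀ ℚ-ring

bernoulli-identity : ∀ m i h → m * (1ℚ + i * h) ≡ (1ℚ - h) * m * (1ℚ + (1ℚ + i) * h) + m * ((1ℚ + i) * (h * h))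
bernoulli-identity = solve-∀ ℚ-ring

A≤-identity : ∀ A t s → A * t * s ≡ A * (s * t)
A≤-identity = solve-∀ ℚ-ring

small-identity : ∀ A ε m I i h → ε ≡ (A * m + ε * m)
  + ((I * (h * ε) - A) * m + (i - I) * (h * ε) * m + ε * (1ℚ - m * (1ℚ + i * h)))
small-identity = solve-∀ ℚ-ring

module GeometricDecay {h : ℚ} (0<h : 0ℚ < h) (0<1-h : 0ℚ < 1ℚ - h)
                      (μ : ℕ → ℚ) (μ-zero : μ 0 ≡ 1ℚ) (μ-suc : ∀ i → μ (suc i) ≡ (1ℚ - h) * μ i) where
  0<μ : ∀ i → 0ℚ < μ i
  0<μ zero    = subst (0ℚ <_) (sym μ-zero) 0<1
  0<μ (suc i) = subst (0ℚ <_) (sym (μ-suc i)) (0<1-h *₊ 0<μ i)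

  -- Bernoulli's inequality with the division cleared; decay like `1 / (1 + i h)` is enough for
  -- convergence.
  bernoulli : ∀ i → μ i * (1ℚ + ι i * h) ≤ 1ℚ
  bernoulli zero    = ≤-reflexive (trans (cong (_* (1ℚ + 0ℚ * h)) μ-zero) (bernoulli-identity2 h))
  bernoulli (suc i) = ≤-trans
    (≤-by (<⇒≤ (0<μ i) *₀ (0≤ι (suc i) *₀ (<⇒≤ 0<h *₀ <⇒≤ 0<h))) (trans (bernoulli-identity (μ i) (ι i) h)
      (cong (λ t → t * (1ℚ + ι (suc i) * h) + μ i * (ι (suc i) * (h * h))) (sym (μ-suc i)))))
    (bernoulli i)

  vanishes : ∀ A ε → 0ℚ ≤ A → 0ℚ < ε → Eventually λ i → A * μ i < ε
  vanishes A ε 0≤A 0<ε with recip (0<h *₊ 0<ε)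
  ... | t , 0<t , hεt≡1 with archimedean (A * t)
  ... | I , _ , At≤I = I , small
    where
    A≤ : A ≤ ι I * (h * ε)
    A≤ = subst (_≤ ι I * (h * ε)) (trans (A≤-identity A t (h * ε)) (trans (cong (A *_) hεt≡1) (*-identityʳ A)))
      (*-monoʳ₀ (<⇒≤ (0<h *₊ 0<ε)) At≤I)
    small : ∀ i → I ℕ.≤ i → A * μ i < ε
    small i I≤i = <-≤-trans (<-by (0<ε *₊ 0<μ i) refl) (≤-by
      (0≤- A≤ *₀ <⇒≤ (0<μ i) +₀ 0≤- (ι-mono I≤i) *₀ <⇒≤ (0<h *₊ 0<ε) *₀ <⇒≤ (0<μ i) +₀ <⇒≤ 0<ε *₀ 0≤- (bernoulli i))
      (small-identity A ε (μ i) (ι I) (ι i) h))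

-- The invariant of the iteration and its limit

p²h≤-identity : ∀ p h → h * (p * p * p) ≡ p * p * h + p * p * h * (p - 1ℚ)
p²h≤-identity = solve-∀ ℚ-ring

h≤½-identity : ∀ p h → p * p * h ≡ h + h * (p * (p - 1ℚ) + (p - 1ℚ))
h≤½-identity = solve-∀ ℚ-ring

κ≤1/1536-identity : ∀ q κ h → + 1 / 1536 ≡ κ + ((+ 1 / 3) * ((+ 1 / 512) - q * (3ℚ * κ + 5ℚ * h))
  + (q - 1ℚ) * κ + (+ 5 / 3) * q * h)
κ≤1/1536-identity = solve-∀ ℚ-ring

start-identity3 : ∀ p → 2ℚ ≡ 2ℚ + 16ℚ * p * (1ℚ - 1ℚ)
start-identity3 = solve-∀ ℚ-ring

start-identity2 : ∀ e → e -ᵢ 1ᵢ *ᵢ e ≡ 0ᵢ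
start-identity2 = solve-∀ ℚ[i]-ring

start-identity : ∀ p h → 0ℚ ≡ (+ 384 / 1) * (p * p) * h * (1ℚ * (1ℚ - 1ℚ))
start-identity = solve-∀ ℚ-ring

∥Δw∥≤-identity3 : ∀ z → z -ᵢ z ≡ 0ᵢ
∥Δw∥≤-identity3 = solve-∀ ℚ[i]-ring

∥Δw∥≤-identity2 : ∀ r m → 0ℚ ≡ 16ℚ * r * (m - m)
∥Δw∥≤-identity2 = solve-∀ ℚ-ring

∥Δw∥≤-identity : ∀ r h m n → 16ℚ * (h * n) * r + 16ℚ * r * (m - n) ≡ 16ℚ * r * (m - (1ℚ - h) * n)
∥Δw∥≤-identity = solve-∀ ℚ-ring

e-close′-identity : ∀ κ₀ κ m p h → m * (κ - κ₀) ≡ (+ 384 / 1) * (p * p) * h * (m * (1ℚ - m))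
  + (m * (κ - (κ₀ + (+ 384 / 1) * (p * p) * h)) + (+ 384 / 1) * (p * p) * h * (m * m))
e-close′-identity = solve-∀ ℚ-ring

re-μe₀-identity : ∀ m a b → m * a - 0ℚ * b ≡ m * a
re-μe₀-identity = solve-∀ ℚ-ring

im-μe₀-identity : ∀ m a b → m * b + 0ℚ * a ≡ m * b
im-μe₀-identity = solve-∀ ℚ-ring

μ≤16Re-e-identity : ∀ a a₀ m κ κ₀ → 16ℚ * a ≡ m + (16ℚ * (a + m * (κ - κ₀) - m * a₀)
  + 16ℚ * (m * (a₀ - (+ 1 / 8) + ((+ 1 / 1536) - κ) + κ₀ + (+ 1 / 16 - + 1 / 1536))))
μ≤16Re-e-identity = solve-∀ ℚ-ring

Re-e≤-identity : ∀ a m κ κ₀ → m * (1ℚ + κ) ≡ (m * a + m * (κ - κ₀)) + m * (1ℚ + κ₀ - a)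
Re-e≤-identity = solve-∀ ℚ-ring

Im-e≤-identity : ∀ a m κ κ₀ → m * κ ≡ (m * a + m * (κ - κ₀)) + m * (κ₀ - a)
Im-e≤-identity = solve-∀ ℚ-ring

-Im-e≤-identity : ∀ b b₀ m κ κ₀ → m * κ ≡ - b + (b + m * (κ - κ₀) - m * b₀ + m * (κ₀ - - b₀))
-Im-e≤-identity = solve-∀ ℚ-ring

∥e∥≤4μ-identity : ∀ m κ → 4ℚ * m ≡ (m * (1ℚ + κ) + m * κ) + m * (2ℚ * ((+ 1 / 1536) - κ) + (+ 3 / 1 - 2ℚ * (+ 1 / 1536)))
∥e∥≤4μ-identity = solve-∀ ℚ-ring

μκ≤κ-identity : ∀ m κ → κ ≡ m * κ + κ * (1ℚ - m)
μκ≤κ-identity = solve-∀ ℚ-ring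

Im-c≤-identity : ∀ b → b ≡ - (0ℚ - b)
Im-c≤-identity = solve-∀ ℚ-ring

-κ≤Re-c-identity : ∀ u m κ → u ≡ - κ + (m * (1ℚ + κ) - (1ℚ - u) + (1ℚ - m) * (1ℚ + κ))
-κ≤Re-c-identity = solve-∀ ℚ-ring

∥Q∥≤B-identity : ∀ p m → 2ℚ + 16ℚ * p ≡ 2ℚ + 16ℚ * p * (1ℚ - m) + 16ℚ * p * m
∥Q∥≤B-identity = solve-∀ ℚ-ring

μα≤Re[eD̄]-identity : ∀ q d a b u v x y m α κ β B →
  a * (q * u - 0ℚ * v + (d * x - 0ℚ * y)) + b * (q * v + 0ℚ * u + (d * y + 0ℚ * x)) ≡
  m * α + (m * ((+ 1 / 16) * (d * β - q * κ) - (α + κ * (q * κ + d * B)))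
    + (+ 1 / 16) * (16ℚ * a - m) * (q * u + d * x)
    + (+ 1 / 16) * m * ((q * u + d * x) - (d * β - q * κ))
    + (b * (q * v + d * y) - - (m * κ * (q * κ + d * B))))
μα≤Re[eD̄]-identity = solve-∀ ℚ-ring

0≤1-h-identity : ∀ h → 1ℚ - h ≡ 0ℚ + (½ - h + ½)
0≤1-h-identity = solve-∀ ℚ-ring

μ′≤1-identity : ∀ h m → m ≡ (1ℚ - h) * m + h * m
μ′≤1-identity = solve-∀ ℚ-ring

e-close-next-identity2 : ∀ t e m e₀ s → (t *ᵢ e -ᵢ s) -ᵢ (t *ᵢ m) *ᵢ e₀ ≡ t *ᵢ (e -ᵢ m *ᵢ e₀) -ᵢ s
e-close-next-identity2 = solve-∀ ℚ[i]-ring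

e-close-next-identity : ∀ p h m → (+ 384 / 1) * (p * p) * h * ((1ℚ - h) * m * (1ℚ - (1ℚ - h) * m)) ≡
  ((1ℚ - h) * ((+ 384 / 1) * (p * p) * h * (m * (1ℚ - m))) + (+ 192 / 1) * (p * p) * (h * h * (m * m)))
  + (+ 384 / 1) * (p * p) * (h * h * (m * m)) * (½ - h)
e-close-next-identity = solve-∀ ℚ-ring

∥Q∥≤-next-identity2 : ∀ x y → x ≡ (x -ᵢ y) +ᵢ y
∥Q∥≤-next-identity2 = solve-∀ ℚ[i]-ring

∥Q∥≤-next-identity : ∀ p h m → 16ℚ * p * (h * m) + (2ℚ + 16ℚ * p * (1ℚ - m)) ≡ 2ℚ + 16ℚ * p * (1ℚ - (1ℚ - h) * m)
∥Q∥≤-next-identity = solve-∀ ℚ-ring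

∥c-c′∥≤5h-identity2 : ∀ c e s → c -ᵢ ((c +ᵢ e) +ᵢ s) ≡ negᵢ (e +ᵢ s)
∥c-c′∥≤5h-identity2 = solve-∀ ℚ[i]-ring

∥c-c′∥≤5h-identity : ∀ p h m → 5ℚ * h ≡ (h * (4ℚ * m) + (+ 192 / 1) * (p * p) * (h * h * (m * m)))
  + (4ℚ * h * (1ℚ - m) + (+ 192 / 1) * h * ((+ 1 / 36864) - p * p * h)
     + (+ 192 / 1) * (p * p) * (h * h) * ((1ℚ - m) * (1ℚ + m))
     + (1ℚ - (+ 192 / 1) * (+ 1 / 36864)) * h)
∥c-c′∥≤5h-identity = solve-∀ ℚ-ring

β≤ReQ-large-identity : ∀ q u v x y κ B β → x * (2ℚ * (q * q) * u) ≡ β * (2ℚ * (q * q) * u)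
  + (q * q * ((2ℚ * (u * x + v * y) - (u * u + v * v)) + v * v + 2ℚ * ((- v) * y - - (κ * B)))
     + ((q * u - (+ 1 / 512)) * (q * u) + (+ 1 / 1024) * (q * u - (+ 1 / 512))
        + ((+ 1 / 524288) - 2ℚ * κ * B * (q * q))
        + 2ℚ * (q * u) * ((+ 1 / 2048) - q * β)))
β≤ReQ-large-identity = solve-∀ ℚ-ring

Nw₁≥-identity : ∀ r h p s R η α n m → n + 2ℚ * r * (h * s * R) ≡ (1ℚ + r * η)
  + ((n - 1ℚ) + r * (2ℚ * h * s * (R - 1ℚ * α) + 2ℚ * s * (h * α - (+ 36 / 1) * (p * p) * η)
     + η * ((+ 18 / 1) * (p * p) * (m * s) - 1ℚ)
     + (+ 18 / 1) * (p * p) * η * s * (4ℚ - m)))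
Nw₁≥-identity = solve-∀ ℚ-ring

0<1-h-identity : ∀ h → 1ℚ - h ≡ ½ + (½ - h)
0<1-h-identity = solve-∀ ℚ-ring

∥Δw∥≤16rμ-identity : ∀ r m n → 16ℚ * r * m ≡ 16ℚ * r * (m - n) + 16ℚ * r * n
∥Δw∥≤16rμ-identity = solve-∀ ℚ-ring

cauchy-w-identity : ∀ a m → a * m + a * m ≡ 2ℚ * a * m
cauchy-w-identity = solve-∀ ℚ-ring

w≈1-identity : ∀ C r → 16ℚ * r * 1ℚ + C * r ≡ (16ℚ + C) * r
w≈1-identity = solve-∀ ℚ-ring

1+s≤Re-identity : ∀ a b r η C₁ → a * a ≡ (1ℚ + (+ 1 / 8) * (r * η)) * (1ℚ + (+ 1 / 8) * (r * η))
  + ((a * a + b * b) - (1ℚ + r * η) + (C₁ * r - b) * (C₁ * r - - b) + ½ * r * (η - 2ℚ * (C₁ * C₁) * r)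
     + (+ 1 / 64) * (r * η) * (16ℚ - r * η))
1+s≤Re-identity = solve-∀ ℚ-ring

Re-w-identity : ∀ s → 1ℚ + s ≡ (1ℚ + ½ * s) + ½ * s
Re-w-identity = solve-∀ ℚ-ring

-Re-e≤-identity : ∀ a m κ → m * (1ℚ + κ) ≡ - a + ((+ 1 / 16) * ((16ℚ * a - m) + m) + m * (1ℚ + κ))
-Re-e≤-identity = solve-∀ ℚ-ring

real≥-identity : ∀ q d β κ u x → q * u + d * x ≡ (d * β - q * κ) + (q * (u - - κ) + d * (x - β))
real≥-identity = solve-∀ ℚ-ring

0≤real-identity : ∀ x a t → x ≡ 0ℚ + 16ℚ * ((+ 1 / 16) * x - (a + t) + a + t)
0≤real-identity = solve-∀ ℚ-ring

-imag≤-identity : ∀ q d v y → q * (- v) + d * (- y) ≡ - (q * v + d * y)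
-imag≤-identity = solve-∀ ℚ-ring

Im′≤-identity : ∀ v → v ≡ - (- v)
Im′≤-identity = solve-∀ ℚ-ring

∥c∥≤-identity : ∀ u κ → u + 2ℚ * κ ≡ - u + 2ℚ * (u - - κ)
∥c∥≤-identity = solve-∀ ℚ-ring

qu≥-identity : ∀ q u u₀ κ h n → q * u ≡ (+ 1 / 512) + ((q * n - (+ 1 / 256)) + q * ((u₀ + 2ℚ * κ) + κ - n)
  + q * (u + 5ℚ * h - u₀) + ((+ 1 / 512) - q * (3ℚ * κ + 5ℚ * h)))
qu≥-identity = solve-∀ ℚ-ring

0≤a-identity : ∀ a x → a ≡ 0ℚ + (x - - (a - 1ℚ) + (1ℚ - x))
0≤a-identity = solve-∀ ℚ-ring

module NewtonFlow {k : ℕ} (1≤k : 1 ℕ.≤ k) {r : ℚ} (kr≡1 : ι k * r ≡ 1ℚ) (0≤r : 0ℚ ≤ r)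
            (q d : ℕ) (1≤q : 1 ℕ.≤ q) (1≤d : 1 ℕ.≤ d) where

  p B : ℚ
  p = ι q + ι d
  B = 2ℚ + 16ℚ * p

  Q c e : ℚ[i] → ℚ[i]
  Q w = w ^ ((q ℕ.+ d) ℕ.* k)
  c w = w ^ (q ℕ.* k) +ᵢ Q w
  e w = 1ᵢ -ᵢ c w

  -- h is the damping factor; κ bounds how far e strays from the positive real axis; β bounds Re Q from below.
  module Iteration (w₀ : ℚ[i]) {h κ₀ κ β α : ℚ} (0≤h : 0ℚ ≤ h)
           (h-small : h * (p * p * p) ≤ + 1 / 36864)
           (0≤κ₀ : 0ℚ ≤ κ₀) (κ₀+≤κ : κ₀ + (+ 384 / 1) * (p * p) * h ≤ κ)
           (0≤β : 0ℚ ≤ β) (0≤α : 0ℚ ≤ α)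
           (α≤ : α + κ * (ι q * κ + ι d * B) ≤ (+ 1 / 16) * (ι d * β - ι q * κ))
           (κ-small : ι q * (3ℚ * κ + 5ℚ * h) ≤ + 1 / 512)
           (β-small : ι q * β ≤ + 1 / 2048)
           (κB-small : 2ℚ * κ * B * (ι q * ι q) ≤ + 1 / 524288)
           (1≤Nw₀ : 1ℚ ≤ N w₀) (∥Qw₀∥≤2 : ∥ Q w₀ ∥₁ ≤ 2ℚ) (β≤ReQw₀ : β ≤ re (Q w₀))
           (⅛≤Re-e₀ : + 1 / 8 ≤ re (e w₀)) (Re-e₀≤ : re (e w₀) ≤ 1ℚ + κ₀)
           (Im-e₀≤ : im (e w₀) ≤ κ₀) (-Im-e₀≤ : - im (e w₀) ≤ κ₀) where

    e₀ = e w₀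

    1≤ιq : 1ℚ ≤ ι q
    1≤ιq = 1≤ι 1≤q

    0≤q = 0≤ι q
    0≤d = 0≤ι d

    0≤p : 0ℚ ≤ p
    0≤p = 0≤q +₀ 0≤d

    1≤p : 1ℚ ≤ p
    1≤p = ≤-trans 1≤ιq (≤-by 0≤d refl)

    0≤p²h : 0ℚ ≤ (+ 384 / 1) * (p * p) * h
    0≤p²h = nonNegative⁻¹ (+ 384 / 1) *₀ (0≤p *₀ 0≤p) *₀ 0≤h

    κ₀≤κ : κ₀ ≤ κ
    κ₀≤κ = ≤-trans (≤-by 0≤p²h refl) κ₀+≤κ

    0≤κ : 0ℚ ≤ κ
    0≤κ = ≤-trans 0≤κ₀ κ₀≤κ

    p²h≤ : p * p * h ≤ + 1 / 36864
    p²h≤ = ≤-trans (≤-by (0≤p *₀ 0≤p *₀ 0≤h *₀ 0≤- 1≤p) (p²h≤-identity p h)) h-small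

    h≤½ : h ≤ ½
    h≤½ = ≤-trans (≤-by (0≤h *₀ (0≤p *₀ 0≤- 1≤p +₀ 0≤- 1≤p)) (h≤½-identity p h)) (≤-trans p²h≤ (from-yes ((+ 1 / 36864) ≤? ½)))

    κ≤1/1536 : κ ≤ + 1 / 1536
    κ≤1/1536 = ≤-by
      (nonNegative⁻¹ (+ 1 / 3) *₀ 0≤- κ-small +₀ 0≤- 1≤ιq *₀ 0≤κ +₀ nonNegative⁻¹ (+ 5 / 3) *₀ 0≤q *₀ 0≤h)
      (κ≤1/1536-identity (ι q) κ h)

    -- After `i` steps `μ` is `(1 - h)^i`. The bounds are potentials in `μ`: a step lowers `μ` by
    -- `h μ`, which pays for a change of `Q` by at most `16 p h μ`. In `e-close` the factor `μ`
    -- keeps the error small relative to `e` itself, and `1 - μ` makes room at each step for a new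
    -- error of order `h² μ²`.
    record Inv (μ : ℚ) (w : ℚ[i]) : Set where
      field
        0≤μ       : 0ℚ ≤ μ
        μ≤1       : μ ≤ 1ℚ
        1≤Nw      : 1ℚ ≤ N w
        ∥Q∥≤      : ∥ Q w ∥₁ ≤ 2ℚ + 16ℚ * p * (1ℚ - μ)
        e-close   : ∥ e w -ᵢ ⟦ μ ⟧ *ᵢ e₀ ∥₁ ≤ (+ 384 / 1) * (p * p) * h * (μ * (1ℚ - μ))
        β≤ReQ     : β ≤ re (Q w)

    module Bounds {μ} (w : ℚ[i]) (0≤μ : 0ℚ ≤ μ) (μ≤1 : μ ≤ 1ℚ)
                  (e-close : ∥ e w -ᵢ ⟦ μ ⟧ *ᵢ e₀ ∥₁ ≤ (+ 384 / 1) * (p * p) * h * (μ * (1ℚ - μ))) where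
      e-close′ : ∥ e w -ᵢ ⟦ μ ⟧ *ᵢ e₀ ∥₁ ≤ μ * (κ - κ₀)
      e-close′ = ≤-trans e-close (≤-by (0≤μ *₀ 0≤- κ₀+≤κ +₀ 0≤p²h *₀ (0≤μ *₀ 0≤μ)) (e-close′-identity κ₀ κ μ p h))

      re-μe₀ : re (⟦ μ ⟧ *ᵢ e₀) ≡ μ * re e₀
      re-μe₀ = re-μe₀-identity μ (re e₀) (im e₀)

      im-μe₀ : im (⟦ μ ⟧ *ᵢ e₀) ≡ μ * im e₀
      im-μe₀ = im-μe₀-identity μ (re e₀) (im e₀)

      μ≤16Re-e : μ ≤ 16ℚ * re (e w)
      μ≤16Re-e = ≤-by
        (nonNegative⁻¹ 16ℚ *₀ 0≤- (re-close (⟦ μ ⟧ *ᵢ e₀) (e w) (swap-close (e w) (⟦ μ ⟧ *ᵢ e₀) e-close′))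
          +₀ nonNegative⁻¹ 16ℚ *₀ (0≤μ *₀ (0≤- ⅛≤Re-e₀ +₀ 0≤- κ≤1/1536 +₀ 0≤κ₀ +₀ nonNegative⁻¹ (+ 1 / 16 - + 1 / 1536))))
        (trans (μ≤16Re-e-identity (re (e w)) (re e₀) μ κ κ₀) (cong (λ t → μ + (16ℚ * (re (e w) + μ * (κ - κ₀) - t) + 16ℚ * (μ * (re e₀ - (+ 1 / 8) + ((+ 1 / 1536) - κ) + κ₀ + (+ 1 / 16 - + 1 / 1536))))) (sym re-μe₀)))

      Re-e≤ : re (e w) ≤ μ * (1ℚ + κ)
      Re-e≤ = ≤-trans (re-close (e w) (⟦ μ ⟧ *ᵢ e₀) e-close′)
        (subst (λ t → t + μ * (κ - κ₀) ≤ μ * (1ℚ + κ)) (sym re-μe₀)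
          (≤-by (0≤μ *₀ 0≤- Re-e₀≤) (Re-e≤-identity (re e₀) μ κ κ₀)))

      Im-e≤ : im (e w) ≤ μ * κ
      Im-e≤ = ≤-trans (im-close (e w) (⟦ μ ⟧ *ᵢ e₀) e-close′)
        (subst (λ t → t + μ * (κ - κ₀) ≤ μ * κ) (sym im-μe₀)
          (≤-by (0≤μ *₀ 0≤- Im-e₀≤) (Im-e≤-identity (im e₀) μ κ κ₀)))

      -Im-e≤ : - im (e w) ≤ μ * κ
      -Im-e≤ = ≤-by
        (0≤- (im-close (⟦ μ ⟧ *ᵢ e₀) (e w) (swap-close (e w) (⟦ μ ⟧ *ᵢ e₀) e-close′)) +₀ 0≤μ *₀ 0≤- -Im-e₀≤)
        (trans (-Im-e≤-identity (im (e w)) (im e₀) μ κ κ₀) (cong (λ t → - im (e w) + (im (e w) + μ * (κ - κ₀) - t + μ * (κ₀ - - im e₀))) (sym im-μe₀)))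

      ∥e∥≤4μ : ∥ e w ∥₁ ≤ 4ℚ * μ
      ∥e∥≤4μ = ≤-trans (∥∥≤ {e w} Re-e≤ -Re-e≤ Im-e≤ -Im-e≤)
        (≤-by (0≤μ *₀ (nonNegative⁻¹ 2ℚ *₀ 0≤- κ≤1/1536 +₀ nonNegative⁻¹ (+ 3 / 1 - 2ℚ * (+ 1 / 1536)))) (∥e∥≤4μ-identity μ κ))
        where
        -Re-e≤ : - re (e w) ≤ μ * (1ℚ + κ)
        -Re-e≤ = ≤-by (nonNegative⁻¹ (+ 1 / 16) *₀ (0≤- μ≤16Re-e +₀ 0≤μ) +₀ 0≤μ *₀ (0≤1 +₀ 0≤κ)) (-Re-e≤-identity (re (e w)) μ κ)

      μκ≤κ : μ * κ ≤ κ
      μκ≤κ = ≤-by (0≤κ *₀ 0≤- μ≤1) (μκ≤κ-identity μ κ)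

      Im-c≤ : im (c w) ≤ κ
      Im-c≤ = ≤-trans (≤-trans (≤-reflexive (Im-c≤-identity (im (c w)))) -Im-e≤) μκ≤κ

      -Im-c≤ : - im (c w) ≤ κ
      -Im-c≤ = ≤-trans (≤-trans (≤-reflexive (sym (+-identityˡ (- im (c w))))) Im-e≤) μκ≤κ

      -κ≤Re-c : - κ ≤ re (c w)
      -κ≤Re-c = ≤-by (0≤- Re-e≤ +₀ 0≤- μ≤1 *₀ (0≤1 +₀ 0≤κ)) (-κ≤Re-c-identity (re (c w)) μ κ)

    module Next {μ} (w : ℚ[i]) (inv : Inv μ w) where
      open Inv inv public
      open Bounds w 0≤μ μ≤1 e-close public
      open Step 1≤k kr≡1 0≤r q d 1≤q 1≤d {w} 1≤Nw {h} {μ} 0≤h 0≤μ μ≤1 h-small ∥e∥≤4μ public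
        using (w′; Re[eD̄]; remainder; ∥remainder∥≤; e′≡; c′≡; ∥Q′-Q∥≤; ∥w′-w∥≤; Nw′≥; ReQ≤ReQ′)
      open Exponents 1≤k q d 1≤q 1≤d {w} 1≤Nw public using (D; s; 0<s; 1≤18p²NQs)

      ∥Q∥≤B : ∥ Q w ∥₁ ≤ B
      ∥Q∥≤B = ≤-trans ∥Q∥≤ (≤-by (nonNegative⁻¹ 16ℚ *₀ 0≤p *₀ 0≤μ) (∥Q∥≤B-identity p μ))

      0≤B : 0ℚ ≤ B
      0≤B = ≤-trans (0≤∥∥ (Q w)) ∥Q∥≤B

      -- Up to a positive factor this is `Re ζ`, hence the growth of `|w|`. The real parts of `e`
      -- and `D` are at least `μ / 16` and `d β - q κ`; the product of the imaginary parts, at most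
      -- `μ κ (q κ + d B)`, is what `α≤` allows for.
      μα≤Re[eD̄] : μ * α ≤ Re[eD̄]
      μα≤Re[eD̄] = ≤-by
        (0≤μ *₀ 0≤- α≤
          +₀ nonNegative⁻¹ (+ 1 / 16) *₀ 0≤- μ≤16Re-e *₀ 0≤real
          +₀ nonNegative⁻¹ (+ 1 / 16) *₀ 0≤μ *₀ 0≤- real≥
          +₀ 0≤- (-∣ab∣≤ Im-e≤ -Im-e≤ imag≤ -imag≤))
        (μα≤Re[eD̄]-identity (ι q) (ι d) (re (e w)) (im (e w)) (re (c w)) (im (c w)) (re (Q w)) (im (Q w)) μ α κ β B)
        where
        real = ι q * re (c w) + ι d * re (Q w)
        imag = ι q * im (c w) + ι d * im (Q w)
        real≥ : ι d * β - ι q * κ ≤ real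
        real≥ = ≤-by (0≤q *₀ 0≤- -κ≤Re-c +₀ 0≤d *₀ 0≤- β≤ReQ) (real≥-identity (ι q) (ι d) β κ (re (c w)) (re (Q w)))
        0≤real : 0ℚ ≤ real
        0≤real = ≤-trans (≤-by
          (nonNegative⁻¹ 16ℚ *₀ (0≤- α≤ +₀ 0≤α +₀ 0≤κ *₀ (0≤q *₀ 0≤κ +₀ 0≤d *₀ 0≤B)))
          (0≤real-identity (ι d * β - ι q * κ) α (κ * (ι q * κ + ι d * B)))) real≥
        imag≤ : imag ≤ ι q * κ + ι d * B
        imag≤ = +-mono-≤ (*-monoˡ₀ 0≤q Im-c≤)
          (*-monoˡ₀ 0≤d (≤-trans (im≤∥∥ (Q w)) ∥Q∥≤B))
        -imag≤ : - imag ≤ ι q * κ + ι d * B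
        -imag≤ = subst (_≤ ι q * κ + ι d * B) (-imag≤-identity (ι q) (ι d) (im (c w)) (im (Q w)))
          (+-mono-≤ (*-monoˡ₀ 0≤q -Im-c≤)
            (*-monoˡ₀ 0≤d (≤-trans (-im≤∥∥ (Q w)) ∥Q∥≤B)))

      0≤Re[eD̄] : 0ℚ ≤ Re[eD̄]
      0≤Re[eD̄] = ≤-trans (0≤μ *₀ 0≤α) μα≤Re[eD̄]

      Nw≤Nw′ : N w ≤ N w′
      Nw≤Nw′ = ≤-trans (≤-by (nonNegative⁻¹ 2ℚ *₀ 0≤r *₀ (0≤h *₀ <⇒≤ 0<s *₀ 0≤Re[eD̄])) refl) (Nw′≥ 0≤Re[eD̄])

      1≤Nw′ : 1ℚ ≤ N w′
      1≤Nw′ = ≤-trans 1≤Nw Nw≤Nw′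

      μ′ : ℚ
      μ′ = (1ℚ - h) * μ

      0≤1-h : 0ℚ ≤ 1ℚ - h
      0≤1-h = ≤-by (0≤- h≤½ +₀ nonNegative⁻¹ ½) (0≤1-h-identity h)

      0≤μ′ : 0ℚ ≤ μ′
      0≤μ′ = 0≤1-h *₀ 0≤μ

      μ′≤1 : μ′ ≤ 1ℚ
      μ′≤1 = ≤-trans (≤-by (0≤h *₀ 0≤μ) (μ′≤1-identity h μ)) μ≤1

      -- Besides the factor `1 - h`, passing from `μ (1 - μ)` to `μ′ (1 - μ′)` adds `(1 - h) h μ²`.
      -- As `h ≤ ½`, the constant `384` makes this cover the remainder of `192 p² h² μ²`.
      e-close-next : ∥ e w′ -ᵢ ⟦ μ′ ⟧ *ᵢ e₀ ∥₁ ≤ (+ 384 / 1) * (p * p) * h * (μ′ * (1ℚ - μ′))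
      e-close-next = begin
        ∥ e w′ -ᵢ ⟦ μ′ ⟧ *ᵢ e₀ ∥₁
          ≡⟨ cong ∥_∥₁ (trans (cong₂ (λ s t → s -ᵢ t *ᵢ e₀) e′≡ (⟦⟧-* (1ℚ - h) μ)) (e-close-next-identity2 ⟦ 1ℚ - h ⟧ (e w) ⟦ μ ⟧ e₀ remainder)) ⟩
        ∥ ⟦ 1ℚ - h ⟧ *ᵢ (e w -ᵢ ⟦ μ ⟧ *ᵢ e₀) -ᵢ remainder ∥₁
          ≤⟨ ≤-trans (∥∥-- _ remainder) (+-mono-≤ (≤-trans (∥⟦⟧*∥ (e w -ᵢ ⟦ μ ⟧ *ᵢ e₀) 0≤1-h)
               (*-monoˡ₀ 0≤1-h e-close)) ∥remainder∥≤) ⟩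
        (1ℚ - h) * ((+ 384 / 1) * (p * p) * h * (μ * (1ℚ - μ))) + (+ 192 / 1) * (p * p) * (h * h * (μ * μ))
          ≤⟨ ≤-by (nonNegative⁻¹ (+ 384 / 1) *₀ (0≤p *₀ 0≤p) *₀ (0≤h *₀ 0≤h *₀ (0≤μ *₀ 0≤μ)) *₀ 0≤- h≤½) (e-close-next-identity p h μ) ⟩
        (+ 384 / 1) * (p * p) * h * (μ′ * (1ℚ - μ′)) ∎
        where
        open ≤-Reasoning

      module B′ = Bounds w′ 0≤μ′ μ′≤1 e-close-next

      ∥Q∥≤-next : ∥ Q w′ ∥₁ ≤ 2ℚ + 16ℚ * p * (1ℚ - μ′)
      ∥Q∥≤-next = begin
        ∥ Q w′ ∥₁ ≡⟨ cong ∥_∥₁ (∥Q∥≤-next-identity2 (Q w′) (Q w)) ⟩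
        ∥ (Q w′ -ᵢ Q w) +ᵢ Q w ∥₁ ≤⟨ ≤-trans (∥∥-+ (Q w′ -ᵢ Q w) (Q w)) (+-mono-≤ ∥Q′-Q∥≤ ∥Q∥≤) ⟩
        16ℚ * p * (h * μ) + (2ℚ + 16ℚ * p * (1ℚ - μ)) ≡⟨ ∥Q∥≤-next-identity p h μ ⟩
        2ℚ + 16ℚ * p * (1ℚ - μ′) ∎
        where
        open ≤-Reasoning

      ∥Q′∥≤B : ∥ Q w′ ∥₁ ≤ B
      ∥Q′∥≤B = ≤-trans ∥Q∥≤-next (≤-by (nonNegative⁻¹ 16ℚ *₀ 0≤p *₀ 0≤μ′) (∥Q∥≤B-identity p μ′))

      ∥c-c′∥≤5h : ∥ c w -ᵢ c w′ ∥₁ ≤ 5ℚ * h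
      ∥c-c′∥≤5h = begin
        ∥ c w -ᵢ c w′ ∥₁ ≡⟨ cong ∥_∥₁ (trans (cong (c w -ᵢ_) c′≡) (∥c-c′∥≤5h-identity2 (c w) (⟦ h ⟧ *ᵢ e w) remainder)) ⟩
        ∥ negᵢ (⟦ h ⟧ *ᵢ e w +ᵢ remainder) ∥₁ ≡⟨ ∥∥-neg (⟦ h ⟧ *ᵢ e w +ᵢ remainder) ⟩
        ∥ ⟦ h ⟧ *ᵢ e w +ᵢ remainder ∥₁
          ≤⟨ ≤-trans (∥∥-+ (⟦ h ⟧ *ᵢ e w) remainder) (+-mono-≤ (≤-trans (∥⟦⟧*∥ (e w) 0≤h)
               (*-monoˡ₀ 0≤h ∥e∥≤4μ)) ∥remainder∥≤) ⟩
        h * (4ℚ * μ) + (+ 192 / 1) * (p * p) * (h * h * (μ * μ))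
          ≤⟨ ≤-by (nonNegative⁻¹ 4ℚ *₀ 0≤h *₀ 0≤- μ≤1 +₀ nonNegative⁻¹ (+ 192 / 1) *₀ 0≤h *₀ 0≤- p²h≤
                    +₀ nonNegative⁻¹ (+ 192 / 1) *₀ (0≤p *₀ 0≤p) *₀ (0≤h *₀ 0≤h) *₀ (0≤- μ≤1 *₀ (0≤1 +₀ 0≤μ))
                    +₀ nonNegative⁻¹ (1ℚ - (+ 192 / 1) * (+ 1 / 36864)) *₀ 0≤h)
                   (∥c-c′∥≤5h-identity p h μ) ⟩
        5ℚ * h ∎
        where
        open ≤-Reasoning

      -- Once c is not small, |P| ≤ |Q| and P + Q ≈ Re c force Re Q ≥ Re c / 2 up to a small error.
      β≤ReQ-large : + 1 / 256 < ι q * ∥ c w ∥₁ → β ≤ re (Q w′)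
      β≤ReQ-large large = *-cancel₀ {c = 2ℚ * (ι q * ι q) * u} (positive⁻¹ 2ℚ *₊ (0<q *₊ 0<q) *₊ 0<u)
        (≤-by ((0≤q *₀ 0≤q) *₀ (0≤- (Exponents.Nc≤2Re[c̄Q] 1≤k q d 1≤q 1≤d {w′} 1≤Nw′) +₀ 0≤sq v +₀ nonNegative⁻¹ 2ℚ *₀ 0≤- (-∣ab∣≤ -Im′≤ Im′≤ ImQ′≤ -ImQ′≤))
              +₀ (0≤- qu≥ *₀ (0≤q *₀ <⇒≤ 0<u) +₀ nonNegative⁻¹ (+ 1 / 1024) *₀ 0≤- qu≥ +₀ 0≤- κB-small
              +₀ nonNegative⁻¹ 2ℚ *₀ (0≤q *₀ <⇒≤ 0<u) *₀ 0≤- β-small))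
              (β≤ReQ-large-identity (ι q) u v (re (Q w′)) (im (Q w′)) κ B β))
        where
        u = re (c w′)
        v = im (c w′)
        0<q : 0ℚ < ι q
        0<q = 0<ι 1≤q
        ImQ′≤ : im (Q w′) ≤ B
        ImQ′≤ = ≤-trans (im≤∥∥ (Q w′)) ∥Q′∥≤B
        -ImQ′≤ : - im (Q w′) ≤ B
        -ImQ′≤ = ≤-trans (-im≤∥∥ (Q w′)) ∥Q′∥≤B
        -Im′≤ : - v ≤ κ
        -Im′≤ = B′.-Im-c≤
        Im′≤ : - (- v) ≤ κ
        Im′≤ = subst (_≤ κ) (Im′≤-identity v) B′.Im-c≤
        ∥c∥≤ : ∥ c w ∥₁ ≤ (re (c w) + 2ℚ * κ) + κ
        ∥c∥≤ = ∥∥≤ {c w} (≤-by (nonNegative⁻¹ 2ℚ *₀ 0≤κ) refl)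
          (≤-by (nonNegative⁻¹ 2ℚ *₀ 0≤- -κ≤Re-c) (∥c∥≤-identity (re (c w)) κ)) Im-c≤ -Im-c≤
        -- From `1 / 256`, passing from the norm to the real part costs `3 κ` and passing from `w`
        -- to `w′` costs `5 h`. Then `q Re Q` is at least `1 / 1024 - 512 q² κ B`, and `κB-small`
        -- leaves `1 / 2048`, the bound on `q β`.
        qu≥ : + 1 / 512 ≤ ι q * u
        qu≥ = ≤-by (0≤- (<⇒≤ large) +₀ 0≤q *₀ 0≤- ∥c∥≤ +₀ 0≤q *₀ 0≤- (re-close (c w) (c w′) ∥c-c′∥≤5h) +₀ 0≤- κ-small)
          (qu≥-identity (ι q) u (re (c w)) κ h ∥ c w ∥₁)
        0<u : 0ℚ < u
        0<u = *-cancelˡ-<-nonNeg (ι q) {{nonNegative 0≤q}} (subst (_< ι q * u) (sym (*-zeroʳ (ι q))) (<-≤-trans (positive⁻¹ (+ 1 / 512)) qu≥))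

      -- For small `c` the old bound is inherited; otherwise it is derived afresh from `c`, whatever
      -- `Re Q` was before.
      β≤ReQ-next : β ≤ re (Q w′)
      β≤ReQ-next = by-size (ι q * ∥ c w ∥₁ ≤? + 1 / 256)
        where
        by-size : Dec (ι q * ∥ c w ∥₁ ≤ + 1 / 256) → β ≤ re (Q w′)
        by-size (yes small) = ≤-trans β≤ReQ (ReQ≤ReQ′ small μ≤16Re-e)
        by-size (no ¬small) = β≤ReQ-large (≰⇒> ¬small)

      next : Inv μ′ w′
      next = record
        { 0≤μ = 0≤μ′ ; μ≤1 = μ′≤1 ; 1≤Nw = 1≤Nw′ ; ∥Q∥≤ = ∥Q∥≤-next ; e-close = e-close-next ; β≤ReQ = β≤ReQ-next }

    μ : ℕ → ℚ
    μ zero    = 1ℚ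
    μ (suc i) = (1ℚ - h) * μ i

    start : Inv 1ℚ w₀
    start = record
      { 0≤μ = 0≤1 ; μ≤1 = ≤-refl ; 1≤Nw = 1≤Nw₀
      ; ∥Q∥≤ = ≤-trans ∥Qw₀∥≤2 (≤-reflexive (start-identity3 p))
      ; e-close = ≤-reflexive (trans (trans (cong ∥_∥₁ (start-identity2 e₀)) (∥⟦⟧∥ ≤-refl)) (start-identity p h))
      ; β≤ReQ = β≤ReQw₀ }

    opaque
      state : ∀ i → ∃ (Inv (μ i))
      state zero    = w₀ , start
      state (suc i) = Next.w′ _ (proj₂ (state i)) , Next.next _ (proj₂ (state i))

    w : ℕ → ℚ[i]
    w i = proj₁ (state i)

    inv : ∀ i → Inv (μ i) (w i)
    inv i = proj₂ (state i)

    ∥e∥≤ : ∀ i → ∥ e (w i) ∥₁ ≤ 4ℚ * μ i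
    ∥e∥≤ i = Next.∥e∥≤4μ (w i) (inv i)

    opaque
      unfolding state

      w-zero : w 0 ≡ w₀
      w-zero = refl

      ∥w-suc∥≤ : ∀ i → ∥ w (suc i) -ᵢ w i ∥₁ ≤ 16ℚ * (h * μ i) * r
      ∥w-suc∥≤ i = Next.∥w′-w∥≤ (w i) (inv i)

      N-suc : ∀ i → N (w i) ≤ N (w (suc i))
      N-suc i = Next.Nw≤Nw′ (w i) (inv i)

    -- The step sizes telescope because `h μ i = μ i - μ (i + 1)`. This yields both the Cauchy
    -- property and a total displacement of at most `16 r`.
    ∥Δw∥≤ : ∀ i j → ∥ w (j ℕ.+ i) -ᵢ w i ∥₁ ≤ 16ℚ * r * (μ i - μ (j ℕ.+ i))
    ∥Δw∥≤ i zero = ≤-reflexive (trans (trans (cong ∥_∥₁ (∥Δw∥≤-identity3 (w i))) (∥⟦⟧∥ ≤-refl)) (∥Δw∥≤-identity2 r (μ i)))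
    ∥Δw∥≤ i (suc j) = ≤-trans (∥∥-triangle (w (suc (j ℕ.+ i))) (w (j ℕ.+ i)) (w i))
      (≤-trans (+-mono-≤ (∥w-suc∥≤ (j ℕ.+ i)) (∥Δw∥≤ i j))
        (≤-reflexive (∥Δw∥≤-identity r h (μ i) (μ (j ℕ.+ i)))))

    N-mono : ∀ i → N (w 1) ≤ N (w (suc i))
    N-mono zero    = ≤-refl
    N-mono (suc i) = ≤-trans (N-mono i) (N-suc (suc i))

    opaque
      unfolding state

      -- Quantifying the first step suffices, as `N` never decreases afterwards. At the start
      -- `N Q ≤ 4`, so `s ≥ 1 / (72 p²)`, and the gain `2 r h s α` is at least `r h α / (36 p²)`.
      Nw₁≥ : ∀ {η} → 0ℚ ≤ η → (+ 36 / 1) * (p * p) * η ≤ h * α → 1ℚ + r * η ≤ N (w 1)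
      Nw₁≥ {η} 0≤η η≤ = ≤-trans (≤-by
        (0≤- 1≤Nw₀ +₀ 0≤r *₀ (nonNegative⁻¹ 2ℚ *₀ 0≤h *₀ 0≤s *₀ 0≤- S.μα≤Re[eD̄]
          +₀ nonNegative⁻¹ 2ℚ *₀ 0≤s *₀ 0≤- η≤
          +₀ 0≤η *₀ 0≤- 1≤18p²NQs
          +₀ nonNegative⁻¹ (+ 18 / 1) *₀ (0≤p *₀ 0≤p) *₀ 0≤η *₀ 0≤s *₀ 0≤- NQ≤4))
        (Nw₁≥-identity r h p s S.Re[eD̄] η α (N w₀) (N (Q w₀)))) (S.Nw′≥ S.0≤Re[eD̄])
        where
        module S = Next w₀ start
        open S using (s; 1≤18p²NQs)
        0≤s : 0ℚ ≤ s
        0≤s = <⇒≤ S.0<s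
        NQ≤4 : N (Q w₀) ≤ 4ℚ
        NQ≤4 = ≤-trans (N≤∥∥² (Q w₀)) (*-mono₀ {∥ Q w₀ ∥₁} {2ℚ} {∥ Q w₀ ∥₁} {2ℚ} (0≤∥∥ (Q w₀)) (nonNegative⁻¹ 2ℚ) ∥Qw₀∥≤2 ∥Qw₀∥≤2)

    -- Since w₁ gained modulus of order r while w stays within O(r) of 1, for small r it has real part above 1.
    module PositiveRoot {η C : ℚ} (0<h : 0ℚ < h) (0<r : 0ℚ < r)
        (0<η : 0ℚ < η) (η≤ : (+ 36 / 1) * (p * p) * η ≤ h * α)
        (0≤C : 0ℚ ≤ C) (r-small₁ : 2ℚ * ((16ℚ + C) * (16ℚ + C)) * r ≤ η)
        (r-small₂ : (16ℚ + C) * r ≤ 1ℚ) (rη≤16 : r * η ≤ 16ℚ)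
        (w₀≈1 : ∥ w₀ -ᵢ 1ᵢ ∥₁ ≤ C * r) where

      0<1-h : 0ℚ < 1ℚ - h
      0<1-h = <-≤-trans (positive⁻¹ ½) (≤-by (0≤- h≤½) (0<1-h-identity h))

      open GeometricDecay 0<h 0<1-h μ refl (λ i → refl) using (0<μ; vanishes)

      ∥Δw∥≤16rμ : ∀ i j → i ℕ.≤ j → ∥ w j -ᵢ w i ∥₁ ≤ 16ℚ * r * μ i
      ∥Δw∥≤16rμ i j i≤j = ≤-trans (subst (λ t → ∥ w t -ᵢ w i ∥₁ ≤ 16ℚ * r * (μ i - μ t)) (ℕ.m∸n+n≡m i≤j) (∥Δw∥≤ i (j ℕ.∸ i)))
        (≤-by (nonNegative⁻¹ 16ℚ *₀ 0≤r *₀ <⇒≤ (0<μ j)) (∥Δw∥≤16rμ-identity r (μ i) (μ j)))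

      cauchy-w : ∀ ε → 0ℚ < ε → ∃ λ I → ∀ i j → I ℕ.≤ i → I ℕ.≤ j → ∥ w i -ᵢ w j ∥₁ < ε
      cauchy-w ε 0<ε = I , λ i j I≤i I≤j → ≤-<-trans (≤-trans (∥∥-triangle (w i) (w I) (w j))
          (≤-trans (+-mono-≤ (∥Δw∥≤16rμ I i I≤i) (swap-close (w j) (w I) (∥Δw∥≤16rμ I j I≤j))) (≤-reflexive (cauchy-w-identity (16ℚ * r) (μ I)))))
          (proj₂ vanishing I ℕ.≤-refl)
        where
        vanishing = vanishes (2ℚ * (16ℚ * r)) ε (nonNegative⁻¹ 2ℚ *₀ (nonNegative⁻¹ 16ℚ *₀ 0≤r)) 0<ε
        I = proj₁ vanishing

      root-w : ∀ ε → 0ℚ < ε → Eventually λ i → ∥ c (w i) -ᵢ 1ᵢ ∥₁ < ε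
      root-w ε 0<ε = proj₁ vanishing , λ i I≤i → ≤-<-trans (swap-close 1ᵢ (c (w i)) (∥e∥≤ i)) (proj₂ vanishing i I≤i)
        where vanishing = vanishes 4ℚ ε (nonNegative⁻¹ 4ℚ) 0<ε

      C₁ = 16ℚ + C

      w≈1 : ∀ i → ∥ w i -ᵢ 1ᵢ ∥₁ ≤ C₁ * r
      w≈1 i = ≤-trans (∥∥-triangle (w i) (w 0) 1ᵢ) (≤-trans
        (+-mono-≤ (∥Δw∥≤16rμ 0 i ℕ.z≤n) (subst (λ t → ∥ t -ᵢ 1ᵢ ∥₁ ≤ C * r) (sym w-zero) w₀≈1))
        (≤-reflexive (w≈1-identity C r)))

      s : ℚ
      s = (+ 1 / 8) * (r * η)

      0<s : 0ℚ < s
      0<s = positive⁻¹ (+ 1 / 8) *₊ (0<r *₊ 0<η)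

      -- `|w|² ≥ 1 + r η` and `(Im w)² ≤ C₁² r² ≤ r η / 2` leave `(Re w)² ≥ 1 + r η / 2`, which is
      -- at least `(1 + r η / 8)²` because `r η ≤ 16`. The sign of `Re w` is settled by `w` lying
      -- within distance `1` of `1`.
      1+s≤Re : ∀ i → 1ℚ + s ≤ re (w (suc i))
      1+s≤Re i = sq-cancel-≤ 0≤a (≤-by
        (0≤- (≤-trans (Nw₁≥ (<⇒≤ 0<η) η≤) (N-mono i))
          +₀ 0≤- b≤ *₀ (0≤- -b≤) +₀ nonNegative⁻¹ ½ *₀ 0≤r *₀ 0≤- r-small₁
          +₀ (nonNegative⁻¹ (+ 1 / 64) *₀ (0≤r *₀ <⇒≤ 0<η) *₀ 0≤- rη≤16))
        (1+s≤Re-identity a b r η C₁))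
        where
        a = re (w (suc i))
        b = im (w (suc i))
        b≤ : b ≤ C₁ * r
        b≤ = subst (_≤ C₁ * r) (+-identityʳ b) (≤-trans (im≤∥∥ (w (suc i) -ᵢ 1ᵢ)) (w≈1 (suc i)))
        -b≤ : - b ≤ C₁ * r
        -b≤ = subst (_≤ C₁ * r) (cong (-_) (+-identityʳ b)) (≤-trans (-im≤∥∥ (w (suc i) -ᵢ 1ᵢ)) (w≈1 (suc i)))
        0≤a : 0ℚ ≤ a
        0≤a = ≤-by (0≤- (≤-trans (-re≤∥∥ (w (suc i) -ᵢ 1ᵢ)) (w≈1 (suc i))) +₀ 0≤- r-small₂) (0≤a-identity a (C₁ * r))

      Re-w : ∀ i → 1 ℕ.≤ i → 1ℚ + ½ * s < re (w i)
      -- Index `0` is left out: of the start only `1 ≤ N w₀` is known, and the first step brings the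
      -- gain.
      Re-w (suc i) _ = <-≤-trans (<-by (positive⁻¹ ½ *₊ 0<s) (Re-w-identity s)) (1+s≤Re i)

      positive-root : ∃ λ z → IsRoot (K (q ℕ.* k) ((q ℕ.+ d) ℕ.* k)) z × 0ℝ <ℝ Re z
      positive-root = limit-root (q ℕ.* k) ((q ℕ.+ d) ℕ.* k) w cauchy-w root-w (½ * s , positive⁻¹ ½ *₊ 0<s , 1 , Re-w)

-- Approximate roots of unity

N-g^*≤1-identity2 : ∀ t → (1ℚ * 1ℚ + 0ℚ * 0ℚ) * (1ℚ - 0ℚ * t) ≡ 1ℚ
N-g^*≤1-identity2 = solve-∀ ℚ-ring

N-g^*≤1-identity : ∀ n j θ → n * (1ℚ - j * (θ * θ)) ≡ (1ℚ * 1ℚ + θ * θ) * n * (1ℚ - (1ℚ + j) * (θ * θ)) + n * (1ℚ + j) * (θ * θ * (θ * θ))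
N-g^*≤1-identity = solve-∀ ℚ-ring

N-g^≤-identity2 : ∀ j J t ε → 1ℚ - j * t ≡ 1ℚ - ½ * ε + ((J - j) * t + (½ * ε - J * t))
N-g^≤-identity2 = solve-∀ ℚ-ring

N-g^≤-identity : ∀ ε → (1ℚ + ε) * (1ℚ - ½ * ε) ≡ 1ℚ + ½ * ε * (1ℚ - ε)
N-g^≤-identity = solve-∀ ℚ-ring

M≤M²-identity : ∀ ε → (1ℚ + ε) * (1ℚ + ε) ≡ 1ℚ + ε + ε * (1ℚ + ε)
M≤M²-identity = solve-∀ ℚ-ring

Im≤-identity2 : ∀ θ M → 0ℚ ≡ 0ℚ * θ * M
Im≤-identity2 = solve-∀ ℚ-ring

Im≤-identity : ∀ j θ M a b → (1ℚ + j) * θ * M ≡ b + θ * a + ((j * θ * M - b) + θ * (M - a))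
Im≤-identity = solve-∀ ℚ-ring

Re≥-identity2 : ∀ θ M → 1ℚ - ½ * M * (0ℚ * θ * (0ℚ * θ)) ≡ 1ℚ
Re≥-identity2 = solve-∀ ℚ-ring

Re≥-identity : ∀ j θ M a b → a - θ * b ≡ 1ℚ - ½ * M * ((1ℚ + j) * θ * ((1ℚ + j) * θ))
  + ((a - (1ℚ - ½ * M * (j * θ * (j * θ)))) + θ * (j * θ * M - b) + ½ * M * (θ * θ))
Re≥-identity = solve-∀ ℚ-ring

Im≥-identity2 : ∀ θ M → 0ℚ * θ * (1ℚ - ½ * M * (0ℚ * θ * (0ℚ * θ))) ≡ 0ℚ
Im≥-identity2 = solve-∀ ℚ-ring

Im≥-identity : ∀ j θ M a b → b + θ * a ≡ (1ℚ + j) * θ * (1ℚ - ½ * M * ((1ℚ + j) * θ * ((1ℚ + j) * θ)))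
  + ((b - j * θ * (1ℚ - ½ * M * (j * θ * (j * θ)))) + θ * (a - (1ℚ - ½ * M * (j * θ * (j * θ))))
     + ½ * M * ((1ℚ + j) * θ) * (θ * θ * ((j + j) + 1ℚ)))
Im≥-identity = solve-∀ ℚ-ring

∥g^-1∥≤-identity3 : ∀ θ → 0ℚ ≡ 2ℚ * (0ℚ * θ)
∥g^-1∥≤-identity3 = solve-∀ ℚ-ring

∥g^-1∥≤-identity2 : ∀ g x → g *ᵢ x -ᵢ 1ᵢ ≡ (x -ᵢ 1ᵢ) +ᵢ (g -ᵢ 1ᵢ) *ᵢ x
∥g^-1∥≤-identity2 = solve-∀ ℚ[i]-ring

∥g^-1∥≤-identity : ∀ j θ → 2ℚ * (j * θ) + θ * 2ℚ ≡ 2ℚ * ((1ℚ + j) * θ)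
∥g^-1∥≤-identity = solve-∀ ℚ-ring

0<1-ε/2-identity : ∀ ε → 1ℚ - ½ * ε ≡ ½ + ½ * (1ℚ - ε)
0<1-ε/2-identity = solve-∀ ℚ-ring

lemma₁-identity2 : ∀ θ → 0ℚ ≡ θ * 0ℚ - 0ℚ * 1ℚ
lemma₁-identity2 = solve-∀ ℚ-ring

lemma₁-identity : ∀ θ → θ ≡ θ * 1ℚ + 0ℚ * 0ℚ
lemma₁-identity = solve-∀ ℚ-ring

-- Powers of 1 + iθ, as a substitute for the exponential of imaginary numbers;
-- J bounds the exponents for which the drift of the modulus is at most ε.
module Rotation {θ ε : ℚ} (0≤θ : 0ℚ ≤ θ) (0≤ε : 0ℚ ≤ ε) (ε≤1 : ε ≤ 1ℚ) (J : ℕ) (Jθ²≤ε/2 : ι J * (θ * θ) ≤ ½ * ε) where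

  g : ℚ[i]
  g = 1ℚ ⊹ θ

  M : ℚ
  M = 1ℚ + ε

  0≤M : 0ℚ ≤ M
  0≤M = 0≤1 +₀ 0≤ε

  1≤Ng : 1ℚ ≤ N g
  1≤Ng = ≤-by (0≤sq θ) refl

  1≤N-g^ : ∀ j → 1ℚ ≤ N (g ^ j)
  1≤N-g^ j = 1≤N-^ {g} j 1≤Ng

  re-suc : ∀ j → re (g ^ suc j) ≡ re (g ^ j) - θ * im (g ^ j)
  re-suc j = cong (λ t → t - θ * im (g ^ j)) (*-identityˡ (re (g ^ j)))

  im-suc : ∀ j → im (g ^ suc j) ≡ im (g ^ j) + θ * re (g ^ j)
  im-suc j = cong (λ t → t + θ * re (g ^ j)) (*-identityˡ (im (g ^ j)))

  -- The squared modulus of `g ^ j` drifts outwards as `(1 + θ²)^j`; this bounds it by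
  -- `1 / (1 - j θ²)` with the division cleared.
  N-g^*≤1 : ∀ j → N (g ^ j) * (1ℚ - ι j * (θ * θ)) ≤ 1ℚ
  N-g^*≤1 zero    = ≤-reflexive (N-g^*≤1-identity2 (θ * θ))
  N-g^*≤1 (suc j) = ≤-trans (≤-by (0≤N (g ^ j) *₀ 0≤ι (suc j) *₀ 0≤sq (θ * θ))
      (trans (N-g^*≤1-identity (N (g ^ j)) (ι j) θ) (cong (λ t → t * (1ℚ - ι (suc j) * (θ * θ)) + N (g ^ j) * ι (suc j) * (θ * θ * (θ * θ))) (sym (N-* g (g ^ j))))))
    (N-g^*≤1 j)

  N-g^≤ : ∀ {j} → j ℕ.≤ J → N (g ^ j) ≤ M
  N-g^≤ {j} j≤J = *-cancel₀ {c = 1ℚ - ½ * ε} 0<1-ε/2 (≤-trans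
    (*-monoˡ₀ (0≤N (g ^ j))
      (≤-by (0≤- (ι-mono j≤J) *₀ 0≤sq θ +₀ 0≤- Jθ²≤ε/2) (N-g^≤-identity2 (ι j) (ι J) (θ * θ) ε)))
    (≤-trans (N-g^*≤1 j) (≤-by (nonNegative⁻¹ ½ *₀ 0≤ε *₀ 0≤- ε≤1) (N-g^≤-identity ε))))
    where
    0<1-ε/2 : 0ℚ < 1ℚ - ½ * ε
    0<1-ε/2 = <-≤-trans (positive⁻¹ ½) (≤-by (nonNegative⁻¹ ½ *₀ 0≤- ε≤1) (0<1-ε/2-identity ε))

  M≤M² : M ≤ M * M
  M≤M² = ≤-by (0≤ε *₀ 0≤M) (M≤M²-identity ε)

  re≤M : ∀ {z} → N z ≤ M → re z ≤ M
  re≤M {z} Nz≤M = sq-cancel-≤ 0≤M (≤-trans (≤-by (0≤sq (im z)) refl) (≤-trans Nz≤M M≤M²))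

  im≤M : ∀ {z} → N z ≤ M → im z ≤ M
  im≤M {z} Nz≤M = sq-cancel-≤ 0≤M (≤-trans (≤-by (0≤sq (re z)) (+-comm (re z * re z) (im z * im z))) (≤-trans Nz≤M M≤M²))

  Re≤ : ∀ {j} → j ℕ.≤ J → re (g ^ j) ≤ M
  Re≤ {j} j≤J = re≤M {g ^ j} (N-g^≤ j≤J)

  Im≤ : ∀ j → j ℕ.≤ J → im (g ^ j) ≤ ι j * θ * M
  Im≤ zero    _     = ≤-reflexive (Im≤-identity2 θ M)
  Im≤ (suc j) 1+j≤J = subst (_≤ ι (suc j) * θ * M) (sym (im-suc j))
    (≤-by (0≤- (Im≤ j j≤J) +₀ 0≤θ *₀ 0≤- (Re≤ j≤J)) (Im≤-identity (ι j) θ M (re (g ^ j)) (im (g ^ j))))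
    where
    j≤J = ℕ.≤-trans (ℕ.n≤1+n j) 1+j≤J

  -- Together with `Im≥` a discrete form of `cos t ≥ 1 - t² / 2` and `sin t ≥ t (1 - t² / 2)`,
  -- obtained by summing the recursion instead of integrating; `M` accounts for the drift of the
  -- modulus.
  Re≥ : ∀ j → j ℕ.≤ J → 1ℚ - ½ * M * (ι j * θ * (ι j * θ)) ≤ re (g ^ j)
  Re≥ zero    _     = ≤-reflexive (Re≥-identity2 θ M)
  Re≥ (suc j) 1+j≤J = subst (1ℚ - ½ * M * (ι (suc j) * θ * (ι (suc j) * θ)) ≤_) (sym (re-suc j))
    (≤-by (0≤- (Re≥ j j≤J) +₀ 0≤θ *₀ 0≤- (Im≤ j j≤J) +₀ nonNegative⁻¹ ½ *₀ 0≤M *₀ 0≤sq θ)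
      (Re≥-identity (ι j) θ M (re (g ^ j)) (im (g ^ j))))
    where
    j≤J = ℕ.≤-trans (ℕ.n≤1+n j) 1+j≤J

  Im≥ : ∀ j → j ℕ.≤ J → ι j * θ * (1ℚ - ½ * M * (ι j * θ * (ι j * θ))) ≤ im (g ^ j)
  Im≥ zero    _     = ≤-reflexive (Im≥-identity2 θ M)
  Im≥ (suc j) 1+j≤J = subst (ι (suc j) * θ * (1ℚ - ½ * M * (ι (suc j) * θ * (ι (suc j) * θ))) ≤_) (sym (im-suc j))
    (≤-by (0≤- (Im≥ j j≤J) +₀ 0≤θ *₀ 0≤- (Re≥ j j≤J)
        +₀ nonNegative⁻¹ ½ *₀ 0≤M *₀ (0≤ι (suc j) *₀ 0≤θ) *₀ (0≤sq θ *₀ ((0≤ι j +₀ 0≤ι j) +₀ 0≤1)))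
      (Im≥-identity (ι j) θ M (re (g ^ j)) (im (g ^ j))))
    where
    j≤J = ℕ.≤-trans (ℕ.n≤1+n j) 1+j≤J

  ∥g^∥≤2 : ∀ {j} → j ℕ.≤ J → ∥ g ^ j ∥₁ ≤ 2ℚ
  ∥g^∥≤2 {j} j≤J = sq-cancel-≤ (nonNegative⁻¹ 2ℚ) (≤-trans (∥∥²≤2N (g ^ j))
    (*-monoˡ-≤-nonNeg 2ℚ (≤-trans (N-g^≤ j≤J) (+-monoʳ-≤ 1ℚ ε≤1))))

  ∥g^-1∥≤ : ∀ j → j ℕ.≤ J → ∥ g ^ j -ᵢ 1ᵢ ∥₁ ≤ 2ℚ * (ι j * θ)
  ∥g^-1∥≤ zero _ = ≤-reflexive (trans (∥⟦⟧∥ ≤-refl) (∥g^-1∥≤-identity3 θ))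
  ∥g^-1∥≤ (suc j) 1+j≤J = begin
    ∥ g ^ suc j -ᵢ 1ᵢ ∥₁ ≡⟨ cong ∥_∥₁ (∥g^-1∥≤-identity2 g (g ^ j)) ⟩
    ∥ (g ^ j -ᵢ 1ᵢ) +ᵢ (g -ᵢ 1ᵢ) *ᵢ g ^ j ∥₁
      ≤⟨ ≤-trans (∥∥-+ (g ^ j -ᵢ 1ᵢ) _) (+-mono-≤ (∥g^-1∥≤ j j≤J) (≤-trans (∥∥-* (g -ᵢ 1ᵢ) (g ^ j))
           (*-mono₀ (0≤∥∥ (g -ᵢ 1ᵢ)) (nonNegative⁻¹ 2ℚ) ∥g-1∥≤θ (∥g^∥≤2 j≤J)))) ⟩
    2ℚ * (ι j * θ) + θ * 2ℚ ≡⟨ ∥g^-1∥≤-identity (ι j) θ ⟩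
    2ℚ * (ι (suc j) * θ) ∎
    where
    open ≤-Reasoning
    j≤J = ℕ.≤-trans (ℕ.n≤1+n j) 1+j≤J
    ∥g-1∥≤θ : ∥ g -ᵢ 1ᵢ ∥₁ ≤ θ
    ∥g-1∥≤θ = ≤-trans (≤-reflexive (cong ∥_∥₁ (trans (cong₂ _⊹_ refl (+-identityʳ θ)) (lemma₁ θ)))) (≤-trans (∥⟦⟧*∥ 𝑖 0≤θ)
      (≤-reflexive (trans (cong (θ *_) ∥𝑖∥≡1) (*-identityʳ θ))))
      where
      lemma₁ : ∀ θ → (0ℚ ⊹ θ) ≡ ⟦ θ ⟧ *ᵢ 𝑖
      lemma₁ θ = cong₂ _⊹_ (lemma₁-identity2 θ) (lemma₁-identity θ)

-- `γ` stands for `exp(iπ / (2R))` and `y` for its argument. All that is kept of the size of `π / 2`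
-- is `1 ≤ R y ≤ 2`; the bounds on `γ ^ j` are those of cosine and sine at `j y`. That `ω` is within
-- `O(1 / k)` of `1` is passed on to the starting point.
record QuarterTurn (k : ℕ) (r : ℚ) (R : ℕ) (ε : ℚ) : Set where
  field
    ω : ℚ[i]
    y : ℚ
  γ : ℚ[i]
  γ = ω ^ k
  field
    1≤Nω    : 1ℚ ≤ N ω
    ω≈1     : ∥ ω -ᵢ 1ᵢ ∥₁ ≤ 4ℚ * r
    γ^R≈𝑖   : ∥ γ ^ R -ᵢ 𝑖 ∥₁ ≤ ε
    0≤y     : 0ℚ ≤ y
    1≤Ry    : 1ℚ ≤ ι R * y
    Ry≤2    : ι R * y ≤ 2ℚ
    N-γ^≤   : ∀ {j} → j ℕ.≤ R → N (γ ^ j) ≤ 1ℚ + ε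
    Re-γ^≤  : ∀ {j} → j ℕ.≤ R → re (γ ^ j) ≤ 1ℚ + ε
    Im-γ^≤  : ∀ {j} → j ℕ.≤ R → im (γ ^ j) ≤ ι j * y * (1ℚ + ε)
    Re-γ^≥  : ∀ {j} → j ℕ.≤ R → 1ℚ - ½ * (1ℚ + ε) * (ι j * y * (ι j * y)) ≤ re (γ ^ j)
    Im-γ^≥  : ∀ {j} → j ℕ.≤ R → ι j * y * (1ℚ - ½ * (1ℚ + ε) * (ι j * y * (ι j * y))) ≤ im (γ ^ j)

-- A discrete intermediate value theorem. As `G` lies in the first quadrant, the imaginary part
-- stays nonnegative until the imaginary axis is crossed, so the crossing happens on the side of `𝑖`
-- and not of its negative.
exit-right-half-plane : ∀ {G} (z : ℕ → ℚ[i]) → (∀ a → z (suc a) ≡ G *ᵢ z a) → 0ℚ ≤ re G → 0ℚ ≤ im G →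
  ∀ n a → 0ℚ < re (z a) → 0ℚ ≤ im (z a) → re (z (n ℕ.+ a)) ≤ 0ℚ →
  ∃ λ b → b ℕ.< n ℕ.+ a × 0ℚ < re (z b) × 0ℚ ≤ im (z b) × re (z (suc b)) ≤ 0ℚ
exit-right-half-plane z z-suc 0≤ReG 0≤ImG zero a 0<re 0≤im re≤0 = ⊥-elim (<-irrefl refl (<-≤-trans 0<re re≤0))
exit-right-half-plane {G} z z-suc 0≤ReG 0≤ImG (suc n) a 0<re 0≤im re≤0 = by-sign (re (z (suc a)) ≤? 0ℚ)
  where
  by-sign : Dec (re (z (suc a)) ≤ 0ℚ) → _
  by-sign (yes exit) = a , ℕ.s≤s (ℕ.m≤n+m a n) , 0<re , 0≤im , exit
  by-sign (no ¬exit) = subst (λ t → ∃ λ b → b ℕ.< t × 0ℚ < re (z b) × 0ℚ ≤ im (z b) × re (z (suc b)) ≤ 0ℚ) (ℕ.+-suc n a)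
    (exit-right-half-plane z z-suc 0≤ReG 0≤ImG n (suc a) (≰⇒> ¬exit)
      (subst (0ℚ ≤_) (sym (cong im (z-suc a))) (0≤ReG *₀ 0≤im +₀ 0≤ImG *₀ <⇒≤ 0<re))
      (subst (λ t → re (z t) ≤ 0ℚ) (sym (ℕ.+-suc n a)) re≤0))

-- `43 / 100` exceeds `tan(π / 8) = √2 - 1`. So `c + i s` has argument above `π / 8`, its square
-- above `π / 4`, and the fourth power has left the right half-plane.
re-z⁴≤0 : ∀ {c s} → 0ℚ ≤ c → (+ 43 / 100) * c ≤ s → 0ℚ ≤ c * c - s * s →
  (c * c - s * s) * (c * c - s * s) - (c * s + s * c) * (c * s + s * c) ≤ 0ℚ
re-z⁴≤0 {c} {s} 0≤c s≥ 0≤c² = ≤-by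
  ((gap *₀ (0≤c² +₀ (0≤c *₀ 0≤s +₀ 0≤s *₀ 0≤c))))
  (lemma c s)
  where
  0≤s : 0ℚ ≤ s
  0≤s = ≤-trans (nonNegative⁻¹ (+ 43 / 100) *₀ 0≤c) s≥
  gap : 0ℚ ≤ (c * s + s * c) - (c * c - s * s)
  gap = ≤-by (nonNegative⁻¹ (+ 449 / 10000) *₀ 0≤sq c +₀ nonNegative⁻¹ (+ 243 / 100) *₀ 0≤c *₀ 0≤- s≥ +₀ 0≤s *₀ 0≤- s≥) (lemma₁ c s)
    where
    lemma₁ : ∀ c s → (c * s + s * c) - (c * c - s * s) ≡ 0ℚ +
      ((+ 449 / 10000) * (c * c) + (+ 243 / 100) * c * (s - (+ 43 / 100) * c) + s * (s - (+ 43 / 100) * c))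
    lemma₁ = solve-∀ ℚ-ring
  lemma : ∀ c s → 0ℚ ≡ ((c * c - s * s) * (c * c - s * s) - (c * s + s * c) * (c * s + s * c))
    + ((c * s + s * c) - (c * c - s * s)) * ((c * c - s * s) + (c * s + s * c))
  lemma = solve-∀ ℚ-ring

Lλ≡1-identity : ∀ L n θ → L * (n * θ) ≡ n * L * θ
Lλ≡1-identity = solve-∀ ℚ-ring

L′λ≡½-identity : ∀ L λ′ → L * λ′ ≡ ½ * ((L + L) * λ′)
L′λ≡½-identity = solve-∀ ℚ-ring

16λ≤ε-identity2 : ∀ ε → ε ≡ 2ℚ * ε * ½
16λ≤ε-identity2 = solve-∀ ℚ-ring

16λ≤ε-identity : ∀ ε λ′ L → 2ℚ * ε * (L * λ′) ≡ 16ℚ * λ′ + 2ℚ * λ′ * (ε * L - + 8 / 1)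
16λ≤ε-identity = solve-∀ ℚ-ring

Jθ²≤-identity : ∀ ε λ′ θ → ½ * ε ≡ 4ℚ * θ + (½ * (ε - 16ℚ * λ′) + 8ℚ * (λ′ - θ) + 4ℚ * θ)
Jθ²≤-identity = solve-∀ ℚ-ring

λ≤-identity : ∀ λ′ ε → + 1 / 2048 ≡ λ′ + (+ 1 / 16) * ((ε - 16ℚ * λ′) + ((+ 1 / 128) - ε))
λ≤-identity = solve-∀ ℚ-ring

0≤1-½Mx²-identity : ∀ ε x → 1ℚ - ½ * (1ℚ + ε) * (x * x) ≡ 0ℚ + (½ * (1ℚ - ε) + ½ * (1ℚ + ε) * ((1ℚ - x) * (1ℚ + x)))
0≤1-½Mx²-identity = solve-∀ ℚ-ring

-x≤-identity : ∀ α β c s λ′ ε → (+ 1 / 4) * ε ≡ - (α * c - β * s)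
  + (α * c + (λ′ * (1ℚ + ε) * (1ℚ + ε) - β * s) + (+ 1 / 4) * (ε - 16ℚ * λ′) + λ′ * ((1ℚ - ε) * (ε + + 3 / 1)))
-x≤-identity = solve-∀ ℚ-ring

1-ε/4≤v-identity : ∀ x v ε → v * v ≡ (1ℚ - (+ 1 / 4) * ε) * (1ℚ - (+ 1 / 4) * ε)
  + ((x * x + v * v - 1ℚ) + ((+ 1 / 4) * ε * ((+ 1 / 4) * ε) - (- x) * (- x)) + (+ 1 / 8) * ε * ((1ℚ - ε) + + 3 / 1))
1-ε/4≤v-identity = solve-∀ ℚ-ring

zA≈𝑖-identity3 : ∀ v ε → ε ≡ (v - 1ℚ) + (1ℚ + ε - v)
zA≈𝑖-identity3 = solve-∀ ℚ-ring

zA≈𝑖-identity2 : ∀ v ε → ε ≡ - (v - 1ℚ) + (v - (1ℚ - (+ 1 / 4) * ε) + (+ 3 / 4) * ε)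
zA≈𝑖-identity2 = solve-∀ ℚ-ring

zA≈𝑖-identity : ∀ ε → 2ℚ * ε ≡ ((+ 1 / 4) * ε + ε) + (+ 3 / 4) * ε
zA≈𝑖-identity = solve-∀ ℚ-ring

Ry≡Aλ-identity : ∀ R A k θ → R * (A * k * θ) ≡ A * (k * R * θ)
Ry≡Aλ-identity = solve-∀ ℚ-ring

γ-exponent≤J-identity : ∀ k R A → k ℕ.* R ℕ.* A ≡ A ℕ.* k ℕ.* R
γ-exponent≤J-identity = solve-∀ℕ

γ-angle-identity : ∀ a j θ → a * j * θ ≡ j * (a * θ)
γ-angle-identity = solve-∀ ℚ-ring

M≤-identity : ∀ ε → 1ℚ + 2ℚ * ε ≡ 1ℚ + ε + ε
M≤-identity = solve-∀ ℚ-ring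

drop-M-identity : ∀ ε t → 1ℚ - ½ * (1ℚ + ε) * t ≡ (1ℚ - ½ * (1ℚ + 2ℚ * ε) * t) + ½ * ε * t
drop-M-identity = solve-∀ ℚ-ring

quarterTurn-identity2 : ∀ r → 2ℚ * (2ℚ * r) ≡ 4ℚ * r
quarterTurn-identity2 = solve-∀ ℚ-ring

quarterTurn-identity : ∀ k R A → A ℕ.* k ℕ.* R ≡ k ℕ.* R ℕ.* A
quarterTurn-identity = solve-∀ℕ

θ≤λ-identity : ∀ n θ → n * θ ≡ θ + (n - 1ℚ) * θ
θ≤λ-identity = solve-∀ ℚ-ring

J≡-identity : ∀ n θ → ι 4 * n * (θ * θ) ≡ 4ℚ * (n * θ) * θ
J≡-identity = solve-∀ ℚ-ring

jθ≡½-identity : ∀ n L θ → n * L * θ ≡ L * (n * θ)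
jθ≡½-identity = solve-∀ ℚ-ring

s≥-identity : ∀ ε → ½ * (1ℚ - ½ * (1ℚ + ε) * (½ * ½)) ≡ (+ 43 / 100) * (1ℚ + ε)
  + ((+ 197 / 400) * ((+ 1 / 128) - ε) + (+ 3 / 400 - (+ 197 / 400) * (+ 1 / 128)))
s≥-identity = solve-∀ ℚ-ring

0<re-identity : ∀ t ε → 1ℚ - ½ * (1ℚ + ε) * (t * t) ≡ + 1 / 4
  + (½ * ((+ 1 / 128) - ε) + ½ * (1ℚ + ε) * ((1ℚ - t) * (1ℚ + t)) + (+ 1 / 4 - ½ * (+ 1 / 128)))
0<re-identity = solve-∀ ℚ-ring

Aθ≤2r-identity3 : ∀ A θ k → A * θ * k ≡ A * k * θ
Aθ≤2r-identity3 = solve-∀ ℚ-ring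

Aθ≤2r-identity2 : ∀ R y → R * y ≡ y + (R - 1ℚ) * y
Aθ≤2r-identity2 = solve-∀ ℚ-ring

Aθ≤2r-identity : ∀ k r → 2ℚ * (k * r) ≡ 2ℚ * r * k
Aθ≤2r-identity = solve-∀ ℚ-ring

angle-identity : ∀ n a θ → n * a * θ ≡ a * (n * θ)
angle-identity = solve-∀ ℚ-ring

module Construction {k : ℕ} (1≤k : 1 ℕ.≤ k) {r : ℚ} (kr≡1 : ι k * r ≡ 1ℚ) (0≤r : 0ℚ ≤ r)
                    {R : ℕ} (1≤R : 1 ℕ.≤ R) {ε : ℚ} (0<ε : 0ℚ < ε) (ε≤1/128 : ε ≤ + 1 / 128)
                    {L′ : ℕ} (1≤L′ : 1 ℕ.≤ L′) (8≤εL′ : + 8 / 1 ≤ ε * ι L′) where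
  -- With `θ = 1 / N₀`, a block of `n₀ = k R` factors `g` turns by `1 / L`, and the search moves by
  -- blocks up to the angle `2`. For whatever number `A` of blocks it stops at, `(g ^ A) ^ k` is
  -- exactly an `R`-th root of the point reached.
  L n₀ N₀ J : ℕ
  L = L′ ℕ.+ L′
  n₀ = k ℕ.* R
  N₀ = n₀ ℕ.* L
  J = 4 ℕ.* N₀

  0≤ε : 0ℚ ≤ ε
  0≤ε = <⇒≤ 0<ε

  ε≤1 : ε ≤ 1ℚ
  ε≤1 = ≤-trans ε≤1/128 (≤-by (nonNegative⁻¹ (1ℚ - + 1 / 128)) refl)

  1≤n₀ : 1 ℕ.≤ n₀
  1≤n₀ = ℕ.*-mono-≤ 1≤k 1≤R

  1≤L : 1 ℕ.≤ L
  1≤L = ℕ.≤-trans 1≤L′ (ℕ.m≤m+n L′ L′)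

  1≤N₀ : 1 ℕ.≤ N₀
  1≤N₀ = ℕ.*-mono-≤ 1≤n₀ 1≤L

  θ : ℚ
  θ = proj₁ (recip (0<ι 1≤N₀))

  0≤θ : 0ℚ ≤ θ
  0≤θ = <⇒≤ (proj₁ (proj₂ (recip (0<ι 1≤N₀))))

  N₀θ≡1 : ι N₀ * θ ≡ 1ℚ
  N₀θ≡1 = proj₂ (proj₂ (recip (0<ι 1≤N₀)))

  -- λ′ = 1 / L is the angle of one step of the search.
  λ′ : ℚ
  λ′ = ι n₀ * θ

  0≤λ : 0ℚ ≤ λ′
  0≤λ = 0≤ι n₀ *₀ 0≤θ

  Lλ≡1 : ι L * λ′ ≡ 1ℚ
  Lλ≡1 = trans (Lλ≡1-identity (ι L) (ι n₀) θ) (trans (cong (_* θ) (sym (ι-* n₀ L))) N₀θ≡1)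

  L′λ≡½ : ι L′ * λ′ ≡ ½
  L′λ≡½ = trans (L′λ≡½-identity (ι L′) λ′) (trans (cong (λ t → ½ * (t * λ′)) (sym (ι-+ L′ L′))) (cong (½ *_) Lλ≡1))

  16λ≤ε : 16ℚ * λ′ ≤ ε
  16λ≤ε = ≤-by (nonNegative⁻¹ 2ℚ *₀ 0≤λ *₀ 0≤- 8≤εL′)
    (trans (16λ≤ε-identity2 ε) (trans (cong (λ t → 2ℚ * ε * t) (sym L′λ≡½)) (16λ≤ε-identity ε λ′ (ι L′))))

  Jθ²≤ : ι J * (θ * θ) ≤ ½ * ε
  Jθ²≤ = ≤-by (nonNegative⁻¹ (+ 1 / 2) *₀ 0≤- 16λ≤ε +₀ nonNegative⁻¹ 8ℚ *₀ 0≤- θ≤λ +₀ nonNegative⁻¹ 4ℚ *₀ 0≤θ)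
    (trans (Jθ²≤-identity ε λ′ θ) (cong (_+ (½ * (ε - 16ℚ * λ′) + 8ℚ * (λ′ - θ) + 4ℚ * θ)) (sym J≡)))
    where
    θ≤λ : θ ≤ λ′
    θ≤λ = ≤-by (0≤- (1≤ι 1≤n₀) *₀ 0≤θ) (θ≤λ-identity (ι n₀) θ)
    J≡ : ι J * (θ * θ) ≡ 4ℚ * θ
    J≡ = trans (cong (_* (θ * θ)) (ι-* 4 N₀)) (trans (J≡-identity (ι N₀) θ) (trans (cong (λ t → 4ℚ * t * θ) N₀θ≡1) refl))

  open Rotation {θ} {ε} 0≤θ 0≤ε ε≤1 J Jθ²≤

  G : ℚ[i]
  G = g ^ n₀

  z : ℕ → ℚ[i]
  z a = g ^ (n₀ ℕ.* a)

  z-suc : ∀ a → z (suc a) ≡ G *ᵢ z a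
  z-suc a = trans (cong (g ^_) (ℕ.*-suc n₀ a)) (^-homo-* g n₀ (n₀ ℕ.* a))

  exponent≤J : ∀ {a} → a ℕ.≤ L ℕ.+ L → n₀ ℕ.* a ℕ.≤ J
  exponent≤J {a} a≤2L = ℕ.≤-trans (ℕ.*-monoʳ-≤ n₀ a≤2L)
    (ℕ.≤-trans (ℕ.≤-reflexive (ℕ.*-distribˡ-+ n₀ L L)) (ℕ.+-monoʳ-≤ N₀ (ℕ.m≤m+n N₀ (N₀ ℕ.+ (N₀ ℕ.+ 0)))))

  n₀≤J : n₀ ℕ.≤ J
  n₀≤J = subst (ℕ._≤ J) (ℕ.*-identityʳ n₀) (exponent≤J {1} (ℕ.≤-trans 1≤L (ℕ.m≤m+n L L)))

  λ≤ : λ′ ≤ + 1 / 2048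
  λ≤ = ≤-by (nonNegative⁻¹ (+ 1 / 16) *₀ (0≤- 16λ≤ε +₀ 0≤- ε≤1/128)) (λ≤-identity λ′ ε)

  0≤1-½Mx² : ∀ {x} → 0ℚ ≤ x → x ≤ 1ℚ → 0ℚ ≤ 1ℚ - ½ * M * (x * x)
  0≤1-½Mx² {x} 0≤x x≤1 = ≤-by (nonNegative⁻¹ ½ *₀ 0≤- ε≤1 +₀ nonNegative⁻¹ ½ *₀ 0≤M *₀ (0≤- x≤1 *₀ (0≤1 +₀ 0≤x))) (0≤1-½Mx²-identity ε x)

  λ≤1 : λ′ ≤ 1ℚ
  λ≤1 = ≤-trans λ≤ (≤-by (nonNegative⁻¹ (1ℚ - + 1 / 2048)) refl)

  0≤ReG : 0ℚ ≤ re G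
  0≤ReG = ≤-trans (0≤1-½Mx² 0≤λ λ≤1) (Re≥ n₀ n₀≤J)

  0≤ImG : 0ℚ ≤ im G
  0≤ImG = ≤-trans (0≤λ *₀ 0≤1-½Mx² 0≤λ λ≤1) (Im≥ n₀ n₀≤J)

  -- tan ½ > 0.43, and doubling this angle twice passes π/2.
  re-z-4L′≤0 : 0ℚ ≤ re (z (L′ ℕ.+ L′)) → re (z (L ℕ.+ L)) ≤ 0ℚ
  re-z-4L′≤0 0≤re = subst (_≤ 0ℚ) (sym (trans (cong re (trans (z-double L) (cong (λ t → t *ᵢ t) (z-double L′)))) refl))
    (re-z⁴≤0 {c} {s} 0≤c s≥ (subst (0ℚ ≤_) (cong re (z-double L′)) 0≤re))
    where
    z-double : ∀ a → z (a ℕ.+ a) ≡ z a *ᵢ z a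
    z-double a = trans (cong (g ^_) (ℕ.*-distribˡ-+ n₀ a a)) (^-homo-* g (n₀ ℕ.* a) (n₀ ℕ.* a))
    j = n₀ ℕ.* L′
    c = re (z L′)
    s = im (z L′)
    j≤J : j ℕ.≤ J
    j≤J = exponent≤J {L′} (ℕ.≤-trans (ℕ.m≤m+n L′ L′) (ℕ.m≤m+n L L))
    jθ≡½ : ι j * θ ≡ ½
    jθ≡½ = trans (cong (_* θ) (ι-* n₀ L′)) (trans (jθ≡½-identity (ι n₀) (ι L′) θ) L′λ≡½)
    0≤c : 0ℚ ≤ c
    0≤c = ≤-trans (subst (λ t → 0ℚ ≤ 1ℚ - ½ * M * (t * t)) (sym jθ≡½) (0≤1-½Mx² (nonNegative⁻¹ ½) (≤-by (nonNegative⁻¹ ½) refl))) (Re≥ j j≤J)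
    s≥ : (+ 43 / 100) * c ≤ s
    s≥ = ≤-trans (*-monoˡ-≤-nonNeg (+ 43 / 100) (Re≤ j≤J)) (≤-trans
      (≤-by (nonNegative⁻¹ (+ 197 / 400) *₀ 0≤- ε≤1/128 +₀ nonNegative⁻¹ (+ 3 / 400 - (+ 197 / 400) * (+ 1 / 128))) (s≥-identity ε))
      (subst (λ t → t * (1ℚ - ½ * M * (t * t)) ≤ s) jθ≡½ (Im≥ j j≤J)))

  opaque
    exit : ∃ λ b → b ℕ.< L ℕ.+ L × 0ℚ < re (z b) × 0ℚ ≤ im (z b) × re (z (suc b)) ≤ 0ℚ
    exit = by-sign (re (z L) ≤? 0ℚ)
      where
      z-zero : z 0 ≡ 1ᵢ
      z-zero = cong (g ^_) (ℕ.*-zeroʳ n₀)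
      search : ∀ n → re (z n) ≤ 0ℚ → ∃ λ b → b ℕ.< n × 0ℚ < re (z b) × 0ℚ ≤ im (z b) × re (z (suc b)) ≤ 0ℚ
      search n re≤0 = subst (λ t → ∃ λ b → b ℕ.< t × 0ℚ < re (z b) × 0ℚ ≤ im (z b) × re (z (suc b)) ≤ 0ℚ) (ℕ.+-identityʳ n)
        (exit-right-half-plane {G} z z-suc 0≤ReG 0≤ImG n 0 (subst (λ t → 0ℚ < re t) (sym z-zero) 0<1)
          (subst (λ t → 0ℚ ≤ im t) (sym z-zero) ≤-refl) (subst (λ t → re (z t) ≤ 0ℚ) (sym (ℕ.+-identityʳ n)) re≤0))
      widen : (∃ λ b → b ℕ.< L × 0ℚ < re (z b) × 0ℚ ≤ im (z b) × re (z (suc b)) ≤ 0ℚ) →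
        ∃ λ b → b ℕ.< L ℕ.+ L × 0ℚ < re (z b) × 0ℚ ≤ im (z b) × re (z (suc b)) ≤ 0ℚ
      widen (b , b<L , rest) = b , ℕ.≤-trans b<L (ℕ.m≤m+n L L) , rest
      by-sign : Dec (re (z L) ≤ 0ℚ) → ∃ λ b → b ℕ.< L ℕ.+ L × 0ℚ < re (z b) × 0ℚ ≤ im (z b) × re (z (suc b)) ≤ 0ℚ
      by-sign (yes re≤0) = widen (search L re≤0)
      by-sign (no re≰0)  = search (L ℕ.+ L) (re-z-4L′≤0 (<⇒≤ (≰⇒> re≰0)))

  b A : ℕ
  b = proj₁ exit
  A = suc b

  A≤2L : A ℕ.≤ L ℕ.+ L
  A≤2L = proj₁ (proj₂ exit)

  x v : ℚ
  x = re (z A)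
  v = im (z A)

  x≤0 : x ≤ 0ℚ
  x≤0 = proj₂ (proj₂ (proj₂ (proj₂ exit)))

  0<c : 0ℚ < re (z b)
  0<c = proj₁ (proj₂ (proj₂ exit))

  0≤s : 0ℚ ≤ im (z b)
  0≤s = proj₁ (proj₂ (proj₂ (proj₂ exit)))

  0≤v : 0ℚ ≤ v
  0≤v = subst (0ℚ ≤_) (sym (cong im (z-suc b))) (0≤ReG *₀ 0≤s +₀ 0≤ImG *₀ <⇒≤ 0<c)

  -- At `b` the real part was still positive, and one block takes it at most `λ′ M² ≤ 4 λ′ ≤ ε / 4`
  -- below zero.
  -x≤ : - x ≤ (+ 1 / 4) * ε
  -x≤ = subst (λ t → - t ≤ (+ 1 / 4) * ε) (sym (cong re (z-suc b))) (≤-by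
    (0≤ReG *₀ <⇒≤ 0<c
      +₀ 0≤- (*-mono₀ {im G} {λ′ * M} {im (z b)} {M} 0≤ImG 0≤M (Im≤ n₀ n₀≤J) (im≤M {z b} (N-g^≤ (exponent≤J (ℕ.≤-trans (ℕ.n≤1+n b) A≤2L)))))
      +₀ nonNegative⁻¹ (+ 1 / 4) *₀ 0≤- 16λ≤ε +₀ 0≤λ *₀ (0≤- ε≤1 *₀ ((0≤ε +₀ nonNegative⁻¹ 3ℚ))))
    (-x≤-identity (re G) (im G) (re (z b)) (im (z b)) λ′ ε))

  N-zA≤ : N (z A) ≤ M
  N-zA≤ = N-g^≤ (exponent≤J A≤2L)

  1-ε/4≤v : 1ℚ - (+ 1 / 4) * ε ≤ v
  1-ε/4≤v = sq-cancel-≤ 0≤v (≤-by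
    (0≤- (1≤N-g^ (n₀ ℕ.* A)) +₀ 0≤- (x²≤) +₀ nonNegative⁻¹ (+ 1 / 8) *₀ 0≤ε *₀ (0≤- ε≤1 +₀ nonNegative⁻¹ 3ℚ))
    (1-ε/4≤v-identity x v ε))
    where
    x²≤ : (- x) * (- x) ≤ (+ 1 / 4) * ε * ((+ 1 / 4) * ε)
    x²≤ = *-mono₀ 0≤-x (nonNegative⁻¹ (+ 1 / 4) *₀ 0≤ε) -x≤ -x≤
      where
      0≤-x : 0ℚ ≤ - x
      0≤-x = neg-antimono-≤ x≤0

  zA≈𝑖 : ∥ z A -ᵢ 𝑖 ∥₁ ≤ 2ℚ * ε
  zA≈𝑖 = ≤-trans
    (∥∥≤ {z A -ᵢ 𝑖} {(+ 1 / 4) * ε} {ε}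
      (≤-trans (≤-reflexive (+-identityʳ x)) (≤-trans x≤0 (nonNegative⁻¹ (+ 1 / 4) *₀ 0≤ε)))
      (≤-trans (≤-reflexive (cong (-_) (+-identityʳ x))) -x≤)
      (≤-by (0≤- (im≤M {z A} N-zA≤)) (zA≈𝑖-identity3 v ε))
      (≤-by (0≤- 1-ε/4≤v +₀ nonNegative⁻¹ (+ 3 / 4) *₀ 0≤ε) (zA≈𝑖-identity2 v ε)))
    (≤-by (nonNegative⁻¹ (+ 3 / 4) *₀ 0≤ε) (zA≈𝑖-identity ε))

  -- Up to the angle `1` the cosine bound keeps the real part at least `1 / 4`. This yields
  -- `1 ≤ R y`.
  L<A : L ℕ.< A
  L<A = ℕ.≰⇒> λ A≤L → <-irrefl refl (<-≤-trans (0<re A≤L) x≤0)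
    where
    0<re : A ℕ.≤ L → 0ℚ < x
    0<re A≤L = <-≤-trans (<-≤-trans (positive⁻¹ (+ 1 / 4)) (≤-by
        (nonNegative⁻¹ ½ *₀ 0≤- ε≤1/128 +₀ nonNegative⁻¹ ½ *₀ 0≤M *₀ (0≤- Aλ≤1 *₀ (0≤1 +₀ 0≤Aλ)) +₀ nonNegative⁻¹ (+ 1 / 4 - ½ * (+ 1 / 128)))
        (0<re-identity (ι A * λ′) ε)))
      (subst (λ t → 1ℚ - ½ * M * (t * t) ≤ x) (angle A) (Re≥ (n₀ ℕ.* A) (exponent≤J A≤2L)))
      where
      0≤Aλ : 0ℚ ≤ ι A * λ′
      0≤Aλ = 0≤ι A *₀ 0≤λ
      Aλ≤1 : ι A * λ′ ≤ 1ℚ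
      Aλ≤1 = ≤-trans (*-monoʳ₀ 0≤λ (ι-mono A≤L)) (≤-reflexive Lλ≡1)
      angle : ∀ a → ι (n₀ ℕ.* a) * θ ≡ ι a * λ′
      angle a = trans (cong (_* θ) (ι-* n₀ a)) (angle-identity (ι n₀) (ι a) θ)

  y : ℚ
  y = ι (A ℕ.* k) * θ

  Ry≡Aλ : ι R * y ≡ ι A * λ′
  Ry≡Aλ = trans (cong (λ t → ι R * (t * θ)) (ι-* A k)) (trans (Ry≡Aλ-identity (ι R) (ι A) (ι k) θ) (cong (λ t → ι A * (t * θ)) (sym (ι-* k R))))

  Aλ≤2 : ι A * λ′ ≤ 2ℚ
  Aλ≤2 = ≤-trans (*-monoʳ₀ 0≤λ (ι-mono A≤2L))
    (≤-reflexive (trans (cong (_* λ′) (ι-+ L L)) (trans (*-distribʳ-+ λ′ (ι L) (ι L)) (cong₂ _+_ Lλ≡1 Lλ≡1))))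

  γ^-exponent : ∀ j → ((g ^ A) ^ k) ^ j ≡ g ^ (A ℕ.* k ℕ.* j)
  γ^-exponent j = trans (cong (_^ j) (^-assocʳ g A k)) (^-assocʳ g (A ℕ.* k) j)

  γ-exponent≤J : ∀ {j} → j ℕ.≤ R → A ℕ.* k ℕ.* j ℕ.≤ J
  γ-exponent≤J {j} j≤R = ℕ.≤-trans (ℕ.*-monoʳ-≤ (A ℕ.* k) j≤R)
    (subst (ℕ._≤ J) (γ-exponent≤J-identity k R A) (exponent≤J A≤2L))

  γ-angle : ∀ j → ι (A ℕ.* k ℕ.* j) * θ ≡ ι j * y
  γ-angle j = trans (cong (_* θ) (ι-* (A ℕ.* k) j)) (γ-angle-identity (ι (A ℕ.* k)) (ι j) θ)

  0≤y : 0ℚ ≤ y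
  0≤y = 0≤ι (A ℕ.* k) *₀ 0≤θ

  M≤ : M ≤ 1ℚ + 2ℚ * ε
  M≤ = ≤-by 0≤ε (M≤-identity ε)

  drop-M : ∀ {t} → 0ℚ ≤ t → 1ℚ - ½ * (1ℚ + 2ℚ * ε) * t ≤ 1ℚ - ½ * M * t
  drop-M {t} 0≤t = ≤-by (nonNegative⁻¹ ½ *₀ 0≤ε *₀ 0≤t) (drop-M-identity ε t)

  quarterTurn : QuarterTurn k r R (2ℚ * ε)
  quarterTurn = record
    { ω = g ^ A
    ; y = y
    ; 1≤Nω = 1≤N-g^ A
    ; ω≈1 = ≤-trans (∥g^-1∥≤ A (subst (ℕ._≤ J) (ℕ.*-identityʳ A) A*1≤J))
              (≤-trans (*-monoˡ-≤-nonNeg 2ℚ Aθ≤2r) (≤-reflexive (quarterTurn-identity2 r)))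
    ; γ^R≈𝑖 = subst (λ t → ∥ t -ᵢ 𝑖 ∥₁ ≤ 2ℚ * ε) (sym (trans (γ^-exponent R) (cong (g ^_) (quarterTurn-identity k R A)))) zA≈𝑖
    ; 0≤y = 0≤y
    ; 1≤Ry = subst₂ _≤_ Lλ≡1 (sym Ry≡Aλ) (*-monoʳ₀ 0≤λ (ι-mono (ℕ.<⇒≤ L<A)))
    ; Ry≤2 = subst (_≤ 2ℚ) (sym Ry≡Aλ) Aλ≤2
    ; N-γ^≤ = λ {j} j≤R → subst (λ t → N t ≤ 1ℚ + 2ℚ * ε) (sym (γ^-exponent j)) (≤-trans (N-g^≤ (γ-exponent≤J j≤R)) M≤)
    ; Re-γ^≤ = λ {j} j≤R → subst (λ t → re t ≤ 1ℚ + 2ℚ * ε) (sym (γ^-exponent j)) (≤-trans (Re≤ (γ-exponent≤J j≤R)) M≤)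
    ; Im-γ^≤ = λ {j} j≤R → subst₂ (λ s t → im s ≤ t * (1ℚ + 2ℚ * ε)) (sym (γ^-exponent j)) (γ-angle j)
        (≤-trans (Im≤ _ (γ-exponent≤J j≤R)) (*-monoˡ₀ (0≤ι (A ℕ.* k ℕ.* j) *₀ 0≤θ) M≤))
    ; Re-γ^≥ = λ {j} j≤R → subst₂ (λ s t → 1ℚ - ½ * (1ℚ + 2ℚ * ε) * (t * t) ≤ re s) (sym (γ^-exponent j)) (γ-angle j)
        (≤-trans (drop-M (0≤sq (ι (A ℕ.* k ℕ.* j) * θ))) (Re≥ _ (γ-exponent≤J j≤R)))
    ; Im-γ^≥ = λ {j} j≤R → subst₂ (λ s t → t * (1ℚ - ½ * (1ℚ + 2ℚ * ε) * (t * t)) ≤ im s) (sym (γ^-exponent j)) (γ-angle j)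
        (≤-trans (*-monoˡ₀ (0≤ι (A ℕ.* k ℕ.* j) *₀ 0≤θ) (drop-M (0≤sq (ι (A ℕ.* k ℕ.* j) * θ))))
          (Im≥ _ (γ-exponent≤J j≤R)))
    }
    where
    A*1≤J : A ℕ.* 1 ℕ.≤ J
    A*1≤J = ℕ.≤-trans (ℕ.*-monoʳ-≤ A (ℕ.*-mono-≤ 1≤k 1≤R)) (subst (ℕ._≤ J) (ℕ.*-comm n₀ A) (exponent≤J A≤2L))
    Aθ≤2r : ι A * θ ≤ 2ℚ * r
    Aθ≤2r = *-cancel₀ {c = ι k} (0<ι 1≤k) (begin
      ι A * θ * ι k ≡⟨ trans (Aθ≤2r-identity3 (ι A) θ (ι k)) (cong (_* θ) (sym (ι-* A k))) ⟩
      y             ≤⟨ ≤-by (0≤- (1≤ι 1≤R) *₀ 0≤y) (Aθ≤2r-identity2 (ι R) y) ⟩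
      ι R * y       ≤⟨ subst (_≤ 2ℚ) (sym Ry≡Aλ) Aλ≤2 ⟩
      2ℚ            ≡⟨ trans (sym (*-identityʳ 2ℚ)) (trans (cong (2ℚ *_) (sym kr≡1)) (Aθ≤2r-identity (ι k) r)) ⟩
      2ℚ * r * ι k  ∎)
      where
      open ≤-Reasoning

quarter-turn : ∀ {k} → 1 ℕ.≤ k → ∀ {r} → ι k * r ≡ 1ℚ → 0ℚ ≤ r → ∀ {R} → 1 ℕ.≤ R →
  ∀ {ε} → 0ℚ < ε → ε ≤ + 1 / 64 → QuarterTurn k r R ε
quarter-turn 1≤k kr≡1 0≤r 1≤R {ε} 0<ε ε≤1/64 with recip (positive⁻¹ ½ *₊ 0<ε)
... | t , 0<t , ½εt≡1 with archimedean (8ℚ * t)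
... | L′ , 1≤L′ , 8t≤L′ = subst (QuarterTurn _ _ _) (lemma₂ ε)
  (Construction.quarterTurn 1≤k kr≡1 0≤r 1≤R (positive⁻¹ ½ *₊ 0<ε) (*-monoˡ-≤-nonNeg ½ ε≤1/64) 1≤L′
    (≤-by (nonNegative⁻¹ ½ *₀ <⇒≤ 0<ε *₀ 0≤- 8t≤L′)
      (trans (lemma₁ (½ * ε) (ι L′) t) (cong (λ s → 8ℚ * s + ½ * ε * (ι L′ - 8ℚ * t)) ½εt≡1))))
  where
  lemma₁ : ∀ e L t → e * L ≡ 8ℚ * (e * t) + e * (L - 8ℚ * t)
  lemma₁ = solve-∀ ℚ-ring
  lemma₂ : ∀ ε → 2ℚ * (½ * ε) ≡ ε
  lemma₂ = solve-∀ ℚ-ring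

-- Starting points

record Start (k : ℕ) (r : ℚ) (q d : ℕ) (β κ₀ C : ℚ) : Set where
  field
    w₀ : ℚ[i]
  Q : ℚ[i]
  Q = w₀ ^ ((q ℕ.+ d) ℕ.* k)
  c : ℚ[i]
  c = w₀ ^ (q ℕ.* k) +ᵢ Q
  field
    1≤Nw₀   : 1ℚ ≤ N w₀
    w₀≈1    : ∥ w₀ -ᵢ 1ᵢ ∥₁ ≤ C * r
    ∥Q∥≤2   : ∥ Q ∥₁ ≤ 2ℚ
    β≤ReQ   : β ≤ re Q
    Re-c≤⅞  : re c ≤ + 7 / 8
    -κ₀≤Re-c : - re c ≤ κ₀
    Im-c≤κ₀  : im c ≤ κ₀
    -κ₀≤Im-c : - im c ≤ κ₀

𝑖^4h≡1 : ∀ h → 𝑖 ^ (4 ℕ.* h) ≡ 1ᵢ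
𝑖^4h≡1 h = trans (sym (^-assocʳ 𝑖 4 h)) (1^h≡1 h)
  where
  1^h≡1 : ∀ h → 1ᵢ ^ h ≡ 1ᵢ
  1^h≡1 zero    = refl
  1^h≡1 (suc h) = cong (1ᵢ *ᵢ_) (1^h≡1 h)

𝑖^[4h+j] : ∀ h j → 𝑖 ^ (4 ℕ.* h ℕ.+ j) ≡ 𝑖 ^ j
𝑖^[4h+j] h j = trans (^-homo-* 𝑖 (4 ℕ.* h) j) (trans (cong (_*ᵢ 𝑖 ^ j) (𝑖^4h≡1 h)) (lemma (𝑖 ^ j)))
  where
  lemma : ∀ z → 1ᵢ *ᵢ z ≡ z
  lemma = solve-∀ ℚ[i]-ring

∥𝑖^∥≤1 : ∀ j → ∥ 𝑖 ^ j ∥₁ ≤ 1ℚ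
∥𝑖^∥≤1 zero    = ≤-reflexive (∥⟦⟧∥ 0≤1)
∥𝑖^∥≤1 (suc j) = ≤-trans (∥∥-* 𝑖 (𝑖 ^ j))
  (*-mono₀ {∥ 𝑖 ∥₁} {1ℚ} {∥ 𝑖 ^ j ∥₁} {1ℚ} (0≤∥∥ 𝑖) 0≤1 (≤-reflexive ∥𝑖∥≡1) (∥𝑖^∥≤1 j))

-1ᵢ : ℚ[i]
-1ᵢ = negᵢ 1ᵢ

N≤2⇒∥∥≤2 : ∀ z → N z ≤ 2ℚ → ∥ z ∥₁ ≤ 2ℚ
N≤2⇒∥∥≤2 z N≤2 = sq-cancel-≤ (nonNegative⁻¹ 2ℚ) (≤-trans (∥∥²≤2N z) (*-monoˡ-≤-nonNeg 2ℚ N≤2))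

-- Gives an upper bound for a power that is known only after multiplication by a power of `γ` or of
-- `x`.
N-factor≤ : ∀ z u → 1ℚ ≤ N u → N z ≤ N (z *ᵢ u)
N-factor≤ z u 1≤Nu = subst₂ _≤_ (*-identityʳ (N z)) (sym (N-* z u)) (*-monoˡ₀ (0≤N z) 1≤Nu)

re-𝑖conj : ∀ u → re (𝑖 *ᵢ conj u) ≡ im u
re-𝑖conj u = lemma (re u) (im u)
  where
  lemma : ∀ a b → 0ℚ * a - 1ℚ * (- b) ≡ b
  lemma = solve-∀ ℚ-ring

im-𝑖conj : ∀ u → im (𝑖 *ᵢ conj u) ≡ re u
im-𝑖conj u = lemma (re u) (im u)
  where
  lemma : ∀ a b → 0ℚ * (- b) + 1ℚ * a ≡ a
  lemma = solve-∀ ℚ-ring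

-- `conj u` inverts `u` up to the factor `N u`, which is within `ε` of `1`. Negative powers of `γ`
-- are handled in this way.
divide-by-unit : ∀ {ε δ} z u v → 1ℚ ≤ N u → N u ≤ 1ℚ + ε → N u ≤ 2ℚ → ∥ z ∥₁ ≤ 2ℚ →
  ∥ z *ᵢ u -ᵢ v ∥₁ ≤ δ → ∥ z -ᵢ v *ᵢ conj u ∥₁ ≤ 2ℚ * ε + 2ℚ * δ
divide-by-unit {ε} {δ} z u v 1≤Nu Nu≤1+ε Nu≤2 ∥z∥≤2 zu≈v = begin
  ∥ z -ᵢ v *ᵢ conj u ∥₁ ≡⟨ cong ∥_∥₁ split ⟩
  ∥ z *ᵢ negᵢ ⟦ N u - 1ℚ ⟧ +ᵢ (z *ᵢ u -ᵢ v) *ᵢ conj u ∥₁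
    ≤⟨ ≤-trans (∥∥-+ (z *ᵢ negᵢ ⟦ N u - 1ℚ ⟧) ((z *ᵢ u -ᵢ v) *ᵢ conj u))
        (+-mono-≤ (∥∥-* z (negᵢ ⟦ N u - 1ℚ ⟧)) (∥∥-* (z *ᵢ u -ᵢ v) (conj u))) ⟩
  ∥ z ∥₁ * ∥ negᵢ ⟦ N u - 1ℚ ⟧ ∥₁ + ∥ z *ᵢ u -ᵢ v ∥₁ * ∥ conj u ∥₁
    ≤⟨ +-mono-≤ (*-mono₀ {∥ z ∥₁} {2ℚ} {∥ negᵢ ⟦ N u - 1ℚ ⟧ ∥₁} {ε} (0≤∥∥ z) 0≤ε ∥z∥≤2
                  (≤-trans (≤-reflexive (trans (∥∥-neg ⟦ N u - 1ℚ ⟧) (∥⟦⟧∥ (0≤- 1≤Nu)))) Nu-1≤ε))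
                (*-mono₀ {∥ z *ᵢ u -ᵢ v ∥₁} {δ} {∥ conj u ∥₁} {2ℚ} (0≤∥∥ _) (nonNegative⁻¹ 2ℚ) zu≈v
                  (≤-trans (≤-reflexive (∥conj∥ u)) (N≤2⇒∥∥≤2 u Nu≤2))) ⟩
  2ℚ * ε + δ * 2ℚ ≡⟨ cong (λ t → 2ℚ * ε + t) (*-comm δ 2ℚ) ⟩
  2ℚ * ε + 2ℚ * δ ∎
  where
  open ≤-Reasoning
  Nu-1≤ε : N u - 1ℚ ≤ ε
  Nu-1≤ε = ≤-by (0≤- Nu≤1+ε) (lemma (N u) ε)
    where
    lemma : ∀ n ε → ε ≡ (n - 1ℚ) + (1ℚ + ε - n)
    lemma = solve-∀ ℚ-ring
  0≤ε : 0ℚ ≤ ε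
  0≤ε = ≤-trans (0≤- 1≤Nu) Nu-1≤ε
  u*conj : ∀ u → 1ᵢ -ᵢ u *ᵢ conj u ≡ negᵢ ⟦ N u - 1ℚ ⟧
  u*conj u = cong₂ _⊹_ (real (re u) (im u)) (imag (re u) (im u))
    where
    real : ∀ a b → 1ℚ - (a * a - b * (- b)) ≡ - ((a * a + b * b) - 1ℚ)
    real = solve-∀ ℚ-ring
    imag : ∀ a b → 0ℚ - (a * (- b) + b * a) ≡ - 0ℚ
    imag = solve-∀ ℚ-ring
  split : z -ᵢ v *ᵢ conj u ≡ z *ᵢ negᵢ ⟦ N u - 1ℚ ⟧ +ᵢ (z *ᵢ u -ᵢ v) *ᵢ conj u
  split = trans (lemma z u v (conj u)) (cong (λ t → z *ᵢ t +ᵢ (z *ᵢ u -ᵢ v) *ᵢ conj u) (u*conj u))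
    where
    lemma : ∀ z u v w → z -ᵢ v *ᵢ w ≡ z *ᵢ (1ᵢ -ᵢ u *ᵢ w) +ᵢ (z *ᵢ u -ᵢ v) *ᵢ w
    lemma = solve-∀ ℚ[i]-ring

ε≤δ-identity : ∀ t ε → t * ε ≡ ε + (t - 1ℚ) * ε
ε≤δ-identity = solve-∀ ℚ-ring

N-γ^≤2-identity : ∀ ε δ → 2ℚ ≡ 1ℚ + ε + (δ - ε + ((+ 1 / 64) - δ) + (1ℚ - + 1 / 64))
N-γ^≤2-identity = solve-∀ ℚ-ring

[1+δ]²≤-identity : ∀ δ → + 3 / 2 ≡ (1ℚ + δ) * (1ℚ + δ) + (((+ 1 / 64) - δ) * ((2ℚ + + 1 / 64) + δ) + (+ 3 / 2 - (1ℚ + + 1 / 64) * (1ℚ + + 1 / 64)))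
[1+δ]²≤-identity = solve-∀ ℚ-ring

z+zx^j-small-identity : ∀ z y → z +ᵢ z *ᵢ y ≡ z *ᵢ (y -ᵢ negᵢ 1ᵢ)
z+zx^j-small-identity = solve-∀ ℚ[i]-ring

∥x^∥≤-identity : ∀ x y → x ≡ y +ᵢ (x -ᵢ y)
∥x^∥≤-identity = solve-∀ ℚ[i]-ring

w₀^≡γ^-identity : ∀ A n k → A ℕ.* (n ℕ.* k) ≡ k ℕ.* (A ℕ.* n)
w₀^≡γ^-identity = solve-∀ℕ

γ^1≡γ-identity : ∀ z → z *ᵢ 1ᵢ ≡ z
γ^1≡γ-identity = solve-∀ ℚ[i]-ring

-- E bounds the exponents up to which powers of γ^R are compared with powers of 𝑖.
module Approx {k : ℕ} {r : ℚ} {R : ℕ} {ε : ℚ} (1≤k : 1 ℕ.≤ k) (1≤R : 1 ℕ.≤ R) (qt : QuarterTurn k r R ε) (0≤ε : 0ℚ ≤ ε)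
              {E : ℕ} {δ : ℚ} (3^Eε≤δ : ι (3 ℕ.^ E) * ε ≤ δ) (δ≤ : δ ≤ + 1 / 64) where
  open QuarterTurn qt public

  x : ℚ[i]
  x = γ ^ R

  ε≤δ : ε ≤ δ
  ε≤δ = ≤-trans (≤-by (0≤- (1≤ι (ℕ.m^n>0 3 E)) *₀ 0≤ε) (ε≤δ-identity (ι (3 ℕ.^ E)) ε)) 3^Eε≤δ

  0≤δ : 0ℚ ≤ δ
  0≤δ = ≤-trans 0≤ε ε≤δ

  N-γ^≤2 : ∀ {j} → j ℕ.≤ R → N (γ ^ j) ≤ 2ℚ
  N-γ^≤2 {j} j≤R = ≤-trans (N-γ^≤ j≤R) (≤-by (0≤- ε≤δ +₀ 0≤- δ≤ +₀ nonNegative⁻¹ (1ℚ - + 1 / 64)) (N-γ^≤2-identity ε δ))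

  1≤Nγ^ : ∀ j → 1ℚ ≤ N (γ ^ j)
  1≤Nγ^ j = 1≤N-^ {γ} j (1≤N-^ {ω} k 1≤Nω)

  1≤Nx^ : ∀ j → 1ℚ ≤ N (x ^ j)
  1≤Nx^ j = 1≤N-^ {x} j (1≤Nγ^ R)

  ∥x∥≤2 : ∥ x ∥₁ ≤ 2ℚ
  ∥x∥≤2 = N≤2⇒∥∥≤2 x (N-γ^≤2 ℕ.≤-refl)

  x^≈𝑖^ : ∀ {j} → j ℕ.≤ E → ∥ x ^ j -ᵢ 𝑖 ^ j ∥₁ ≤ δ
  x^≈𝑖^ {j} j≤E = ≤-trans (^-close {x} {𝑖} j ∥x∥≤2 (≤-reflexive ∥𝑖∥≡1)) (≤-trans
    (*-mono₀ (0≤ι (3 ℕ.^ j)) 0≤ε (ι-mono (ℕ.^-monoʳ-≤ 3 j≤E)) γ^R≈𝑖) 3^Eε≤δ)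

  N-x^≤ : ∀ {j} → j ℕ.≤ E → N (x ^ j) ≤ (1ℚ + δ) * (1ℚ + δ)
  N-x^≤ {j} j≤E = ≤-trans (N≤∥∥² (x ^ j)) (*-mono₀ (0≤∥∥ (x ^ j)) (0≤1 +₀ 0≤δ) ∥x^∥≤ ∥x^∥≤)
    where
    ∥x^∥≤ : ∥ x ^ j ∥₁ ≤ 1ℚ + δ
    ∥x^∥≤ = ≤-trans (≤-reflexive (cong ∥_∥₁ (∥x^∥≤-identity (x ^ j) (𝑖 ^ j)))) (≤-trans (∥∥-+ (𝑖 ^ j) (x ^ j -ᵢ 𝑖 ^ j))
      (+-mono-≤ (∥𝑖^∥≤1 j) (x^≈𝑖^ j≤E)))

  [1+δ]²≤ : (1ℚ + δ) * (1ℚ + δ) ≤ + 3 / 2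
  [1+δ]²≤ = ≤-by (0≤- δ≤ *₀ (nonNegative⁻¹ (2ℚ + + 1 / 64) +₀ 0≤δ) +₀ nonNegative⁻¹ (+ 3 / 2 - (1ℚ + + 1 / 64) * (1ℚ + + 1 / 64))) ([1+δ]²≤-identity δ)

  N-x^≤2 : ∀ {j} → j ℕ.≤ E → N (x ^ j) ≤ 2ℚ
  N-x^≤2 j≤E = ≤-trans (N-x^≤ j≤E) (≤-trans [1+δ]²≤ (≤-by (nonNegative⁻¹ ½) refl))

  z+zx^j-small : ∀ {j} → j ℕ.≤ E → 𝑖 ^ j ≡ -1ᵢ → ∀ z → ∥ z ∥₁ ≤ 2ℚ → ∥ z +ᵢ z *ᵢ x ^ j ∥₁ ≤ 2ℚ * δ
  z+zx^j-small {j} j≤E 𝑖^j≡-1 z ∥z∥≤2 = ≤-trans (≤-reflexive (cong ∥_∥₁ (z+zx^j-small-identity z (x ^ j)))) (≤-trans (∥∥-* z (x ^ j -ᵢ -1ᵢ))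
    (*-mono₀ {∥ z ∥₁} {2ℚ} {∥ x ^ j -ᵢ -1ᵢ ∥₁} {δ} (0≤∥∥ z) 0≤δ ∥z∥≤2 (subst (λ t → ∥ x ^ j -ᵢ t ∥₁ ≤ δ) 𝑖^j≡-1 (x^≈𝑖^ j≤E))))

  x^≡γ^ : ∀ j → x ^ j ≡ γ ^ (R ℕ.* j)
  x^≡γ^ j = ^-assocʳ γ R j

  module _ (A : ℕ) where
    w₀ : ℚ[i]
    w₀ = ω ^ A

    w₀^≡γ^ : ∀ n → w₀ ^ (n ℕ.* k) ≡ γ ^ (A ℕ.* n)
    w₀^≡γ^ n = trans (^-assocʳ ω A (n ℕ.* k)) (trans (cong (ω ^_) (w₀^≡γ^-identity A n k)) (sym (^-assocʳ ω k (A ℕ.* n))))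

    1≤Nw₀ : 1ℚ ≤ N w₀
    1≤Nw₀ = 1≤N-^ {ω} A 1≤Nω

    w₀≈1 : ∥ w₀ -ᵢ 1ᵢ ∥₁ ≤ ι (3 ℕ.^ A) * 4ℚ * r
    w₀≈1 = subst (λ t → ∥ w₀ -ᵢ t ∥₁ ≤ ι (3 ℕ.^ A) * 4ℚ * r) (1^≡1 A) (≤-trans
      (^-close {ω} {1ᵢ} A (N≤2⇒∥∥≤2 ω (≤-trans (N≤N-^ {ω} 1≤k 1≤Nω) (subst (λ t → N t ≤ 2ℚ) γ^1≡γ (N-γ^≤2 1≤R)))) (≤-reflexive (∥⟦⟧∥ 0≤1)))
      (≤-trans (*-monoˡ₀ (0≤ι (3 ℕ.^ A)) ω≈1) (≤-reflexive (sym (*-assoc (ι (3 ℕ.^ A)) 4ℚ r)))))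
      where
      1^≡1 : ∀ j → 1ᵢ ^ j ≡ 1ᵢ
      1^≡1 zero    = refl
      1^≡1 (suc j) = cong (1ᵢ *ᵢ_) (1^≡1 j)
      γ^1≡γ : γ ^ 1 ≡ γ
      γ^1≡γ = γ^1≡γ-identity γ

    small-c : ∀ {q d β κ₀} → N (w₀ ^ ((q ℕ.+ d) ℕ.* k)) ≤ 2ℚ → β ≤ re (w₀ ^ ((q ℕ.+ d) ℕ.* k)) →
      ∥ w₀ ^ (q ℕ.* k) +ᵢ w₀ ^ ((q ℕ.+ d) ℕ.* k) ∥₁ ≤ κ₀ → κ₀ ≤ + 7 / 8 →
      Start k r q d β κ₀ (ι (3 ℕ.^ A) * 4ℚ)
    small-c {q} {d} NQ≤2 β≤ReQ c≤κ₀ κ₀≤ = record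
      { w₀ = w₀ ; 1≤Nw₀ = 1≤Nw₀ ; w₀≈1 = w₀≈1 ; ∥Q∥≤2 = N≤2⇒∥∥≤2 _ NQ≤2 ; β≤ReQ = β≤ReQ
      ; Re-c≤⅞ = ≤-trans (re≤∥∥ _) (≤-trans c≤κ₀ κ₀≤)
      ; -κ₀≤Re-c = ≤-trans (-re≤∥∥ _) c≤κ₀
      ; Im-c≤κ₀ = ≤-trans (im≤∥∥ _) c≤κ₀
      ; -κ₀≤Im-c = ≤-trans (-im≤∥∥ _) c≤κ₀ }

𝑖^2j≡-1-identity : ∀ n → 2 ℕ.* (1 ℕ.+ 2 ℕ.* n) ≡ 4 ℕ.* n ℕ.+ 2
𝑖^2j≡-1-identity = solve-∀ℕ

start-odd-2-identity5 : ∀ a i s ε δ ϱ → a ≡ (+ 1 / 4) * ϱ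
  + ((a + 4ℚ * δ - i) + (i - s * (1ℚ - ½ * (1ℚ + ε) * (s * s))) + (s - ϱ) * (1ℚ - ½ * (1ℚ + ε) * (s * s))
     + ϱ * ((+ 1 / 16) - ½ * (1ℚ + ε) * (s * s)) + (+ 1 / 4) * (ϱ - 16ℚ * δ) + (+ 7 / 16) * ϱ)
start-odd-2-identity5 = solve-∀ ℚ-ring

start-odd-2-identity4 : ∀ a i j s ε δ ϱ → + 7 / 8 ≡ a + (((i - j) + 12ℚ * δ - a) + (s * (1ℚ + ε) - i) + j + s * (1ℚ - ε)
  + 2ℚ * (2ℚ * ϱ - s) + 4ℚ * ((+ 1 / 8) - ϱ) + 12ℚ * ((+ 1 / 64) - δ) + (+ 7 / 8 - ½ - (+ 12 / 64)))
start-odd-2-identity4 = solve-∀ ℚ-ring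

start-odd-2-identity3 : ∀ a i δ ϱ κ → κ ≡ - a + ((a + 12ℚ * δ - i) + i + (κ - (4ℚ * (ϱ * ϱ) + 16ℚ * δ)) + 4ℚ * (ϱ * ϱ) + 4ℚ * δ)
start-odd-2-identity3 = solve-∀ ℚ-ring

start-odd-2-identity2 : ∀ b i j ε δ ϱ κ T → κ ≡ b + (((i - j) + 12ℚ * δ - b) + (1ℚ + ε - i) + (j - (1ℚ - T)) + (4ℚ * (ϱ * ϱ) - T) + (δ - ε)
  + (κ - (4ℚ * (ϱ * ϱ) + 16ℚ * δ)) + 3ℚ * δ)
start-odd-2-identity2 = solve-∀ ℚ-ring

start-odd-2-identity : ∀ b i j ε δ ϱ κ T → κ ≡ - b + ((b + 12ℚ * δ - (i - j)) + (1ℚ + ε - j) + (i - (1ℚ - T)) + (4ℚ * (ϱ * ϱ) - T) + (δ - ε)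
  + (κ - (4ℚ * (ϱ * ϱ) + 16ℚ * δ)) + 3ℚ * δ)
start-odd-2-identity = solve-∀ ℚ-ring

start-consecutive-identity5 : ∀ a i y ε δ β R → a * (4ℚ * R) ≡ β * (4ℚ * R) + ((1ℚ - 4ℚ * β * R)
  + 4ℚ * R * ((a + 4ℚ * δ - i) + (i - y * (1ℚ - ½ * (1ℚ + ε) * (y * y))) + y * ((+ 4 / 25) - ½ * (1ℚ + ε) * (y * y)))
  + (1ℚ - 16ℚ * δ * R) + 2ℚ * (R * y - 1ℚ) + (4ℚ * (1ℚ - + 4 / 25) - 2ℚ) * (R * y))
start-consecutive-identity5 = solve-∀ ℚ-ring

start-consecutive-identity4 : ∀ a i y ε δ → + 7 / 8 ≡ a + (((i + i) + 8ℚ * δ - a) + 2ℚ * (y * (1ℚ + ε) - i) + 2ℚ * (1ℚ + ε) * ((+ 2 / 5) - y)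
  + (+ 4 / 5) * (δ - ε) + (+ 44 / 5) * ((+ 1 / 256) - δ) + (+ 7 / 8 - + 4 / 5 - (+ 44 / 5) * (+ 1 / 256)))
start-consecutive-identity4 = solve-∀ ℚ-ring

start-consecutive-identity3 : ∀ a i δ κ → κ ≡ - a + ((a + 8ℚ * δ - (i + i)) + i + i + (κ - 8ℚ * δ))
start-consecutive-identity3 = solve-∀ ℚ-ring

start-consecutive-identity2 : ∀ b g δ κ → κ ≡ b + ((g - g) + 8ℚ * δ - b + (κ - 8ℚ * δ))
start-consecutive-identity2 = solve-∀ ℚ-ring

start-consecutive-identity : ∀ b g δ κ → κ ≡ - b + (b + 8ℚ * δ - (g - g) + (κ - 8ℚ * δ))
start-consecutive-identity = solve-∀ ℚ-ring

𝑖^2p≡1-identity : ∀ n → 2 ℕ.* (2 ℕ.* n) ≡ 4 ℕ.* n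
𝑖^2p≡1-identity = solve-∀ℕ

β≤ReQ-identity2 : ∀ a δ → a ≡ + 1 / 16 + (a + δ - 1ℚ + ((+ 1 / 64) - δ) + (1ℚ - + 1 / 64 - + 1 / 16))
β≤ReQ-identity2 = solve-∀ ℚ-ring

∥c∥≤-identity3 : ∀ P Q → P +ᵢ Q ≡ (P -ᵢ negᵢ 1ᵢ) +ᵢ (Q -ᵢ 1ᵢ)
∥c∥≤-identity3 = solve-∀ ℚ[i]-ring

∥c∥≤-identity2 : ∀ δ → δ + δ ≡ 2ℚ * δ
∥c∥≤-identity2 = solve-∀ ℚ-ring

Q≡-identity2 : ∀ j p → 2 ℕ.* j ℕ.* p ≡ 2 ℕ.* (p ℕ.* j)
Q≡-identity2 = solve-∀ℕ

Q≡-identity : ∀ d h → 2 ℕ.* (1 ℕ.+ 2 ℕ.* d ℕ.* h) ≡ 2 ℕ.+ d ℕ.* (4 ℕ.* h)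
Q≡-identity = solve-∀ℕ

Px≡Q-identity : ∀ A q d → A ℕ.* q ℕ.+ d ℕ.* A ≡ A ℕ.* (q ℕ.+ d)
Px≡Q-identity = solve-∀ℕ

NQ≤2-identity : ∀ ε δ → 2ℚ ≡ (1ℚ + ε) * (+ 3 / 2) + ((+ 3 / 2) * ((δ - ε) + ((+ 1 / 64) - δ)) + (2ℚ - (1ℚ + + 1 / 64) * (+ 3 / 2)))
NQ≤2-identity = solve-∀ ℚ-ring

Q≈γ²-identity : ∀ a b → a *ᵢ b -ᵢ a ≡ a *ᵢ (b -ᵢ 1ᵢ)
Q≈γ²-identity = solve-∀ ℚ[i]-ring

β≤ReQ-identity : ∀ a g ε δ y → a ≡ + 1 / 16 + ((a + 2ℚ * δ - g) + (g - (1ℚ - ½ * (1ℚ + ε) * (ι 2 * y * (ι 2 * y))))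
  + (+ 2 / 9) * (1ℚ + ε) * ((2ℚ - 3ℚ * y) * (2ℚ + 3ℚ * y))
  + (+ 8 / 9) * (δ - ε) + (+ 26 / 9) * ((+ 1 / 64) - δ) + (+ 1 / 9 - (+ 26 / 9) * (+ 1 / 64) - + 1 / 16))
β≤ReQ-identity = solve-∀ ℚ-ring

X≡-identity : ∀ R p j → R ℕ.* (p ℕ.* j) ≡ R ℕ.* j ℕ.* p
X≡-identity = solve-∀ℕ

Pvx≡X-identity : ∀ R j q → R ℕ.* j ℕ.* q ℕ.+ R ℕ.* (2 ℕ.* j) ≡ R ℕ.* j ℕ.* (q ℕ.+ 2)
Pvx≡X-identity = solve-∀ℕ

Pv≈-𝑖-identity2 : ∀ a X i → a -ᵢ negᵢ i ≡ (a +ᵢ X) -ᵢ (X -ᵢ i)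
Pv≈-𝑖-identity2 = solve-∀ ℚ[i]-ring

Pv≈-𝑖-identity : ∀ δ → 2ℚ * δ + δ ≡ 3ℚ * δ
Pv≈-𝑖-identity = solve-∀ ℚ-ring

Q≈-identity2 : ∀ ε δ → 4ℚ * δ ≡ 2ℚ * ε + 2ℚ * δ + 2ℚ * (δ - ε)
Q≈-identity2 = solve-∀ ℚ-ring

P≈-identity3 : ∀ ε δ → 8ℚ * δ ≡ 2ℚ * ε + 2ℚ * (3ℚ * δ) + 2ℚ * (δ - ε)
P≈-identity3 = solve-∀ ℚ-ring

c≈-identity4 : ∀ P Q i u v → (P +ᵢ Q) -ᵢ (i *ᵢ u -ᵢ i *ᵢ v) ≡ (P -ᵢ negᵢ i *ᵢ v) +ᵢ (Q -ᵢ i *ᵢ u)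
c≈-identity4 = solve-∀ ℚ[i]-ring

c≈-identity3 : ∀ δ → 8ℚ * δ + 4ℚ * δ ≡ 12ℚ * δ
c≈-identity3 = solve-∀ ℚ-ring

s²≤-identity : ∀ ϱ → 2ℚ * ϱ * (2ℚ * ϱ) ≡ 4ℚ * (ϱ * ϱ)
s²≤-identity = solve-∀ ℚ-ring

s²-bound-identity : ∀ ε x → x ≡ ½ * (1ℚ + ε) * x + ½ * (1ℚ - ε) * x
s²-bound-identity = solve-∀ ℚ-ring

0≤Im-u-Im-v-identity : ∀ a b y q ε → a - b ≡ 0ℚ + (a - (q + ι 2) * y * (1ℚ - ½ * (1ℚ + ε) * ((q + ι 2) * y * ((q + ι 2) * y))) + (q * y * (1ℚ + ε) - b)
  + y * (1ℚ - (q + ι 2) * (½ * (1ℚ + ε) * ((q + ι 2) * y * ((q + ι 2) * y))) + (½ - q * ε) + ½))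
0≤Im-u-Im-v-identity = solve-∀ ℚ-ring

X≈𝑖-identity : ∀ n → 2 ℕ.* (2 ℕ.* n) ℕ.+ 1 ≡ 1 ℕ.+ 4 ℕ.* n
X≈𝑖-identity = solve-∀ℕ

Qγ≡X-identity : ∀ q → 4 ℕ.* q ℕ.* (q ℕ.+ 1) ℕ.+ 1 ≡ (2 ℕ.* q ℕ.+ 1) ℕ.* (2 ℕ.* q ℕ.+ 1)
Qγ≡X-identity = solve-∀ℕ

Px²≡Xγ-identity : ∀ q → 4 ℕ.* q ℕ.* q ℕ.+ (2 ℕ.* q ℕ.+ 1) ℕ.* 2 ≡ (2 ℕ.* q ℕ.+ 1) ℕ.* (2 ℕ.* q ℕ.+ 1) ℕ.+ 1
Px²≡Xγ-identity = solve-∀ℕ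

NXγ≤2-identity : ∀ ε δ → 2ℚ ≡ (+ 3 / 2) * (1ℚ + ε) + ((+ 3 / 2) * ((δ - ε) + ((+ 1 / 64) - δ)) + (2ℚ - (1ℚ + + 1 / 64) * (+ 3 / 2)))
NXγ≤2-identity = solve-∀ ℚ-ring

P≈-identity2 : ∀ P X i g → P +ᵢ i *ᵢ g ≡ (P +ᵢ X *ᵢ g) -ᵢ (X -ᵢ i) *ᵢ g
P≈-identity2 = solve-∀ ℚ[i]-ring

P≈-identity : ∀ δ → 2ℚ * δ + δ * 2ℚ ≡ 4ℚ * δ
P≈-identity = solve-∀ ℚ-ring

c≈-identity2 : ∀ P Q u v → (P +ᵢ Q) -ᵢ (u -ᵢ v) ≡ (P +ᵢ v) +ᵢ (Q -ᵢ u)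
c≈-identity2 = solve-∀ ℚ[i]-ring

c≈-identity : ∀ δ → 4ℚ * δ + 4ℚ * δ ≡ 8ℚ * δ
c≈-identity = solve-∀ ℚ-ring

1·y-identity : ∀ y → (1ℚ + 0ℚ) * y ≡ y
1·y-identity = solve-∀ ℚ-ring

y≤⅖-identity : ∀ y → + 2 / 5 ≡ y + (+ 1 / 5) * (2ℚ - 5ℚ * y)
y≤⅖-identity = solve-∀ ℚ-ring

ps²≤1-identity : ∀ p x → p * (4ℚ * x) ≡ 4ℚ * p * x
ps²≤1-identity = solve-∀ ℚ-ring

V≡-identity2 : ∀ a b → b + b ≡ (0ℚ * a - 1ℚ * (- b)) - (0ℚ * a - 1ℚ * b)
V≡-identity2 = solve-∀ ℚ-ring

V≡-identity : ∀ a b → a - a ≡ (0ℚ * (- b) + 1ℚ * a) - (0ℚ * b + 1ℚ * a)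
V≡-identity = solve-∀ ℚ-ring

module _ {k : ℕ} {r ε : ℚ} (1≤k : 1 ℕ.≤ k) (0≤ε : 0ℚ ≤ ε) {E : ℕ} {δ : ℚ} (3^Eε≤δ : ι (3 ℕ.^ E) * ε ≤ δ) (δ≤ : δ ≤ + 1 / 64) where

  -- p = q + d even: w₀ᵏ ≈ -1.
  start-even : ∀ {q d q′ p′ β κ₀} → QuarterTurn k r 1 ε →
    q ≡ 1 ℕ.+ 2 ℕ.* q′ → q ℕ.+ d ≡ 2 ℕ.* p′ → 2 ℕ.* (q ℕ.+ d) ℕ.≤ E →
    β ≤ + 1 / 16 → 2ℚ * δ ≤ κ₀ → κ₀ ≤ + 7 / 8 → Start k r q d β κ₀ (ι (3 ℕ.^ 2) * 4ℚ)
  start-even {q} {d} {q′} {p′} {β} {κ₀} qt q≡ p≡ 2p≤E β≤ 2δ≤κ₀ κ₀≤ = small-c 2 {q} {d}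
    (subst (λ t → N t ≤ 2ℚ) (sym Q≡) (N-x^≤2 2p≤E))
    β≤ReQ (≤-trans ∥c∥≤ 2δ≤κ₀) κ₀≤
    where
    open Approx {k} {r} {1} {ε} 1≤k (ℕ.s≤s ℕ.z≤n) qt 0≤ε {E} {δ} 3^Eε≤δ δ≤
    p = q ℕ.+ d
    P = w₀ 2 ^ (q ℕ.* k)
    Q = w₀ 2 ^ (p ℕ.* k)
    to-x : ∀ n → w₀ 2 ^ (n ℕ.* k) ≡ x ^ (2 ℕ.* n)
    to-x n = trans (w₀^≡γ^ 2 n) (sym (trans (x^≡γ^ (2 ℕ.* n)) (cong (γ ^_) (ℕ.*-identityˡ (2 ℕ.* n)))))
    Q≡ : Q ≡ x ^ (2 ℕ.* p)
    Q≡ = to-x p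
    𝑖^2p≡1 : 𝑖 ^ (2 ℕ.* p) ≡ 1ᵢ
    𝑖^2p≡1 = trans (cong (𝑖 ^_) (trans (cong (2 ℕ.*_) p≡) (𝑖^2p≡1-identity p′))) (𝑖^4h≡1 p′)
    𝑖^2q≡-1 : 𝑖 ^ (2 ℕ.* q) ≡ -1ᵢ
    𝑖^2q≡-1 = trans (cong (𝑖 ^_) (trans (cong (2 ℕ.*_) q≡) (𝑖^2j≡-1-identity q′))) (𝑖^[4h+j] q′ 2)
    Q≈1 : ∥ Q -ᵢ 1ᵢ ∥₁ ≤ δ
    Q≈1 = subst₂ (λ s t → ∥ s -ᵢ t ∥₁ ≤ δ) (sym Q≡) 𝑖^2p≡1 (x^≈𝑖^ 2p≤E)
    P≈-1 : ∥ P -ᵢ -1ᵢ ∥₁ ≤ δ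
    P≈-1 = subst₂ (λ s t → ∥ s -ᵢ t ∥₁ ≤ δ) (sym (to-x q)) 𝑖^2q≡-1
      (x^≈𝑖^ (ℕ.≤-trans (ℕ.*-monoʳ-≤ 2 (ℕ.m≤m+n q d)) 2p≤E))
    β≤ReQ : β ≤ re Q
    β≤ReQ = ≤-trans β≤ (≤-by (0≤- (re-close 1ᵢ Q (swap-close Q 1ᵢ Q≈1)) +₀ 0≤- δ≤ +₀ nonNegative⁻¹ (1ℚ - + 1 / 64 - + 1 / 16)) (β≤ReQ-identity2 (re Q) δ))
    ∥c∥≤ : ∥ P +ᵢ Q ∥₁ ≤ 2ℚ * δ
    ∥c∥≤ = ≤-trans (≤-reflexive (cong ∥_∥₁ (∥c∥≤-identity3 P Q))) (≤-trans (∥∥-+ (P -ᵢ -1ᵢ) (Q -ᵢ 1ᵢ))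
      (≤-trans (+-mono-≤ P≈-1 Q≈1) (≤-reflexive (∥c∥≤-identity2 δ))))

  𝑖^2j≡-1 : ∀ {j j′} → j ≡ 1 ℕ.+ 2 ℕ.* j′ → 𝑖 ^ (2 ℕ.* j) ≡ -1ᵢ
  𝑖^2j≡-1 {j′ = j′} j≡ = trans (cong (𝑖 ^_) (trans (cong (2 ℕ.*_) j≡) (𝑖^2j≡-1-identity j′))) (𝑖^[4h+j] j′ 2)

  -- w₀ᵈᵏ ≈ -1 with w₀^(pk) ≈ exp(iπ/d), of positive real part since d ≥ 3.
  start-odd : ∀ {q d j j′ h β κ₀} → QuarterTurn k r d ε → 3 ℕ.≤ d →
    (q ℕ.+ d) ℕ.* j ≡ 1 ℕ.+ 2 ℕ.* d ℕ.* h → j ≡ 1 ℕ.+ 2 ℕ.* j′ → 4 ℕ.* h ℕ.≤ E → 2 ℕ.* j ℕ.≤ E →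
    β ≤ + 1 / 16 → 2ℚ * δ ≤ κ₀ → κ₀ ≤ + 7 / 8 → Start k r q d β κ₀ (ι (3 ℕ.^ (2 ℕ.* j)) * 4ℚ)
  start-odd {q} {d} {j} {j′} {h} {β} {κ₀} qt 3≤d pj≡ j≡ 4h≤E 2j≤E β≤ 2δ≤κ₀ κ₀≤ = small-c A {q} {d}
    NQ≤2 β≤ReQ (≤-trans (subst (λ t → ∥ P +ᵢ t ∥₁ ≤ 2ℚ * δ) Px≡Q (z+zx^j-small 2j≤E (𝑖^2j≡-1 {j} {j′} j≡) P ∥P∥≤2)) 2δ≤κ₀) κ₀≤
    where
    1≤d = ℕ.≤-trans (ℕ.s≤s (ℕ.z≤n {2})) 3≤d
    2≤d = ℕ.≤-trans (ℕ.s≤s (ℕ.s≤s (ℕ.z≤n {1}))) 3≤d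
    open Approx {k} {r} {d} {ε} 1≤k 1≤d qt 0≤ε {E} {δ} 3^Eε≤δ δ≤
    p = q ℕ.+ d
    A = 2 ℕ.* j
    P = w₀ A ^ (q ℕ.* k)
    Q = w₀ A ^ (p ℕ.* k)
    -- By `p j = 1 + 2 d h`, apart from the full turns `x ^ (4 h)` only the angle `π / d` of `γ²` is
    -- left.
    Q≡ : Q ≡ γ ^ 2 *ᵢ x ^ (4 ℕ.* h)
    Q≡ = trans (w₀^≡γ^ A p) (trans (cong (γ ^_) (trans (Q≡-identity2 j p) (trans (cong (2 ℕ.*_) pj≡) (Q≡-identity d h))))
      (trans (^-homo-* γ 2 (d ℕ.* (4 ℕ.* h))) (cong (γ ^ 2 *ᵢ_) (sym (x^≡γ^ (4 ℕ.* h))))))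
    Px≡Q : P *ᵢ x ^ A ≡ Q
    Px≡Q = trans (cong₂ _*ᵢ_ (w₀^≡γ^ A q) (x^≡γ^ A)) (trans (sym (^-homo-* γ (A ℕ.* q) (d ℕ.* A)))
      (trans (cong (γ ^_) (Px≡Q-identity A q d)) (sym (w₀^≡γ^ A p))))
    NQ≤2 : N Q ≤ 2ℚ
    NQ≤2 = ≤-trans (≤-reflexive (trans (cong N Q≡) (N-* (γ ^ 2) (x ^ (4 ℕ.* h))))) (≤-trans
      (*-mono₀ (0≤N (γ ^ 2)) (nonNegative⁻¹ (+ 3 / 2)) (N-γ^≤ 2≤d) (≤-trans (N-x^≤ 4h≤E) [1+δ]²≤))
      (≤-by (nonNegative⁻¹ (+ 3 / 2) *₀ (0≤- ε≤δ +₀ 0≤- δ≤) +₀ nonNegative⁻¹ (2ℚ - (1ℚ + + 1 / 64) * (+ 3 / 2))) (NQ≤2-identity ε δ)))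
    ∥P∥≤2 : ∥ P ∥₁ ≤ 2ℚ
    ∥P∥≤2 = N≤2⇒∥∥≤2 P (≤-trans (N-factor≤ P (x ^ A) (1≤Nx^ A)) (≤-trans (≤-reflexive (cong N Px≡Q)) NQ≤2))
    Q≈γ² : ∥ γ ^ 2 -ᵢ Q ∥₁ ≤ 2ℚ * δ
    Q≈γ² = swap-close Q (γ ^ 2) (≤-trans (≤-reflexive (cong ∥_∥₁ (trans (cong (_-ᵢ γ ^ 2) Q≡) (Q≈γ²-identity (γ ^ 2) (x ^ (4 ℕ.* h))))))
      (≤-trans (∥∥-* (γ ^ 2) (x ^ (4 ℕ.* h) -ᵢ 1ᵢ)) (*-mono₀ {∥ γ ^ 2 ∥₁} {2ℚ} {∥ x ^ (4 ℕ.* h) -ᵢ 1ᵢ ∥₁} {δ} (0≤∥∥ (γ ^ 2)) 0≤δ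
        (N≤2⇒∥∥≤2 (γ ^ 2) (N-γ^≤2 2≤d)) (subst (λ t → ∥ x ^ (4 ℕ.* h) -ᵢ t ∥₁ ≤ δ) (𝑖^4h≡1 h) (x^≈𝑖^ 4h≤E)))))
    -- `d ≥ 3` and `d y ≤ 2` keep the angle `2 y` below `4 / 3`, where `1 - t² / 2` is still
    -- `1 / 9`.
    3y≤2 : 3ℚ * y ≤ 2ℚ
    3y≤2 = ≤-trans (*-monoʳ₀ 0≤y (ι-mono 3≤d)) Ry≤2
    β≤ReQ : β ≤ re Q
    β≤ReQ = ≤-trans β≤ (≤-by
      (0≤- (re-close (γ ^ 2) Q Q≈γ²) +₀ 0≤- (Re-γ^≥ 2≤d)
        +₀ nonNegative⁻¹ (+ 2 / 9) *₀ (0≤1 +₀ 0≤ε) *₀ (0≤- 3y≤2 *₀ (nonNegative⁻¹ 2ℚ +₀ nonNegative⁻¹ 3ℚ *₀ 0≤y))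
        +₀ nonNegative⁻¹ (+ 8 / 9) *₀ 0≤- ε≤δ +₀ nonNegative⁻¹ (+ 26 / 9) *₀ 0≤- δ≤
        +₀ nonNegative⁻¹ (+ 1 / 9 - (+ 26 / 9) * (+ 1 / 64) - + 1 / 16))
      (β≤ReQ-identity (re Q) (re (γ ^ 2)) ε δ y))

  𝑖^[1+4h]≡𝑖 : ∀ h → 𝑖 ^ (1 ℕ.+ 4 ℕ.* h) ≡ 𝑖
  𝑖^[1+4h]≡𝑖 h = trans (cong (𝑖 ^_) (ℕ.+-comm 1 (4 ℕ.* h))) (𝑖^[4h+j] h 1)

  -- For d = 2 the previous choice would give Re w₀^(pk) ≈ 0; rotating w₀ᵏ back by the small angle y cures this.
  start-odd-2 : ∀ {q R A j j′ h β κ₀ ϱ} → QuarterTurn k r R ε → 1 ℕ.≤ R → q ℕ.+ 2 ℕ.≤ R →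
    suc A ≡ R ℕ.* j → (q ℕ.+ 2) ℕ.* j ≡ 1 ℕ.+ 4 ℕ.* h → j ≡ 1 ℕ.+ 2 ℕ.* j′ → 1 ℕ.+ 4 ℕ.* h ℕ.≤ E → 2 ℕ.* j ℕ.≤ E →
    0ℚ ≤ ϱ → ϱ * ι R ≡ ι (q ℕ.+ 2) → ϱ ≤ + 1 / 8 → 4ℚ * ι (q ℕ.+ 2) * (ϱ * ϱ) ≤ 1ℚ → ι q * δ ≤ ½ → 16ℚ * δ ≤ ϱ →
    β ≤ (+ 1 / 4) * ϱ → 4ℚ * (ϱ * ϱ) + 16ℚ * δ ≤ κ₀ → Start k r q 2 β κ₀ (ι (3 ℕ.^ A) * 4ℚ)
  start-odd-2 {q} {R} {A} {j} {j′} {h} {β} {κ₀} {ϱ} qt 1≤R p≤R A≡ pj≡ j≡ h≤E 2j≤E 0≤ϱ ϱR≡p ϱ≤ pϱ²≤ qδ≤½ 16δ≤ϱ β≤ κ₀≥ = record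
    { w₀ = w₀ A ; 1≤Nw₀ = 1≤Nw₀ A ; w₀≈1 = w₀≈1 A ; ∥Q∥≤2 = ∥Q∥≤2
    ; β≤ReQ = ≤-trans β≤ (≤-by
        (0≤- ReQ≥ +₀ 0≤- Im-u≥ +₀ 0≤- py≥ *₀ 0≤1-½[1+ε]s² +₀ 0≤ϱ *₀ 0≤- [1+ε]s²≤ +₀ nonNegative⁻¹ (+ 1 / 4) *₀ 0≤- 16δ≤ϱ +₀ nonNegative⁻¹ (+ 7 / 16) *₀ 0≤ϱ)
        (start-odd-2-identity5 (re Q) (im u) s ε δ ϱ))
    ; Re-c≤⅞ = ≤-by
        (0≤- Re-c≤ +₀ 0≤- Im-u≤ +₀ 0≤Im-v +₀ 0≤s *₀ 0≤- ε≤1 +₀ nonNegative⁻¹ 2ℚ *₀ 0≤- py≤ +₀ nonNegative⁻¹ 4ℚ *₀ 0≤- ϱ≤ +₀ nonNegative⁻¹ 12ℚ *₀ 0≤- δ≤ +₀ nonNegative⁻¹ (+ 7 / 8 - ½ - (+ 12 / 64)))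
        (start-odd-2-identity4 (re c) (im u) (im v) s ε δ ϱ)
    ; -κ₀≤Re-c = ≤-by
        (0≤- Re-c≥ +₀ 0≤Im-u-Im-v +₀ 0≤- κ₀≥ +₀ nonNegative⁻¹ 4ℚ *₀ 0≤sq ϱ +₀ nonNegative⁻¹ 4ℚ *₀ 0≤δ)
        (start-odd-2-identity3 (re c) (im u - im v) δ ϱ κ₀)
    ; Im-c≤κ₀ = ≤-by
        (0≤- Im-c≤ +₀ 0≤- (Re-γ^≤ p≤R) +₀ 0≤- (Re-γ^≥ q≤R) +₀ 0≤- t²-bound +₀ 0≤- ε≤δ +₀ 0≤- κ₀≥ +₀ nonNegative⁻¹ 3ℚ *₀ 0≤δ)
        (start-odd-2-identity2 (im c) (re u) (re v) ε δ ϱ κ₀ (½ * (1ℚ + ε) * (t * t)))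
    ; -κ₀≤Im-c = ≤-by
        (0≤- Im-c≥ +₀ 0≤- (Re-γ^≤ q≤R) +₀ 0≤- (Re-γ^≥ p≤R) +₀ 0≤- s²-bound +₀ 0≤- ε≤δ +₀ 0≤- κ₀≥ +₀ nonNegative⁻¹ 3ℚ *₀ 0≤δ)
        (start-odd-2-identity (im c) (re u) (re v) ε δ ϱ κ₀ (½ * (1ℚ + ε) * (s * s))) }
    where
    open Approx {k} {r} {R} {ε} 1≤k 1≤R qt 0≤ε {E} {δ} 3^Eε≤δ δ≤
    p = q ℕ.+ 2
    q≤R : q ℕ.≤ R
    q≤R = ℕ.≤-trans (ℕ.m≤m+n q 2) p≤R
    P = w₀ A ^ (q ℕ.* k)
    Q = w₀ A ^ (p ℕ.* k)
    c = P +ᵢ Q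
    u v : ℚ[i]
    u = γ ^ p
    v = γ ^ q
    s t : ℚ
    s = ι p * y
    t = ι q * y
    X = x ^ (1 ℕ.+ 4 ℕ.* h)
    X≡ : X ≡ γ ^ (R ℕ.* j ℕ.* p)
    X≡ = trans (x^≡γ^ (1 ℕ.+ 4 ℕ.* h)) (cong (γ ^_) (trans (cong (R ℕ.*_) (sym pj≡)) (X≡-identity R p j)))
    -- `A + 1 = R j` says that `w₀ᵏ` is about `𝑖 ^ j`, turned back by one `γ`. Multiplying `Q` by
    -- `γ ^ p` and `P` by `γ ^ q` undoes the turn without negative exponents.
    Qu≡X : Q *ᵢ u ≡ X
    Qu≡X = trans (cong (_*ᵢ u) (w₀^≡γ^ A p)) (trans (sym (^-homo-* γ (A ℕ.* p) p))
      (trans (cong (γ ^_) (trans (ℕ.+-comm (A ℕ.* p) p) (cong (ℕ._* p) A≡))) (sym X≡)))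
    Pvx≡X : P *ᵢ v *ᵢ x ^ (2 ℕ.* j) ≡ X
    Pvx≡X = trans (cong₂ _*ᵢ_ (trans (cong (_*ᵢ v) (w₀^≡γ^ A q)) (trans (sym (^-homo-* γ (A ℕ.* q) q))
        (cong (γ ^_) (trans (ℕ.+-comm (A ℕ.* q) q) (cong (ℕ._* q) A≡))))) (x^≡γ^ (2 ℕ.* j)))
      (trans (sym (^-homo-* γ (R ℕ.* j ℕ.* q) (R ℕ.* (2 ℕ.* j)))) (trans (cong (γ ^_) (Pvx≡X-identity R j q)) (sym X≡)))
    X≈𝑖 : ∥ X -ᵢ 𝑖 ∥₁ ≤ δ
    X≈𝑖 = subst (λ t → ∥ X -ᵢ t ∥₁ ≤ δ) (𝑖^[1+4h]≡𝑖 h) (x^≈𝑖^ h≤E)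
    NX≤2 : N X ≤ 2ℚ
    NX≤2 = N-x^≤2 h≤E
    ∥Q∥≤2 : ∥ Q ∥₁ ≤ 2ℚ
    ∥Q∥≤2 = N≤2⇒∥∥≤2 Q (≤-trans (N-factor≤ Q u (1≤Nγ^ p)) (≤-trans (≤-reflexive (cong N Qu≡X)) NX≤2))
    NPv≤2 : N (P *ᵢ v) ≤ 2ℚ
    NPv≤2 = ≤-trans (N-factor≤ (P *ᵢ v) (x ^ (2 ℕ.* j)) (1≤Nx^ (2 ℕ.* j))) (≤-trans (≤-reflexive (cong N Pvx≡X)) NX≤2)
    ∥P∥≤2 : ∥ P ∥₁ ≤ 2ℚ
    ∥P∥≤2 = N≤2⇒∥∥≤2 P (≤-trans (N-factor≤ P v (1≤Nγ^ q)) NPv≤2)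
    Pv≈-𝑖 : ∥ P *ᵢ v -ᵢ negᵢ 𝑖 ∥₁ ≤ 3ℚ * δ
    Pv≈-𝑖 = ≤-trans (≤-reflexive (cong ∥_∥₁ (Pv≈-𝑖-identity2 (P *ᵢ v) X 𝑖))) (≤-trans (∥∥-- (P *ᵢ v +ᵢ X) (X -ᵢ 𝑖))
      (≤-trans (+-mono-≤ (subst (λ t → ∥ P *ᵢ v +ᵢ t ∥₁ ≤ 2ℚ * δ) Pvx≡X (z+zx^j-small 2j≤E (𝑖^2j≡-1 {j} {j′} j≡) (P *ᵢ v) (N≤2⇒∥∥≤2 (P *ᵢ v) NPv≤2))) X≈𝑖)
        (≤-reflexive (Pv≈-𝑖-identity δ))))
    Q≈ : ∥ Q -ᵢ 𝑖 *ᵢ conj u ∥₁ ≤ 4ℚ * δ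
    Q≈ = ≤-trans (divide-by-unit {ε} Q u 𝑖 (1≤Nγ^ p) (N-γ^≤ p≤R) (N-γ^≤2 p≤R) ∥Q∥≤2 (subst (λ t → ∥ t -ᵢ 𝑖 ∥₁ ≤ δ) (sym Qu≡X) X≈𝑖))
      (≤-by (nonNegative⁻¹ 2ℚ *₀ 0≤- ε≤δ) (Q≈-identity2 ε δ))
    P≈ : ∥ P -ᵢ negᵢ 𝑖 *ᵢ conj v ∥₁ ≤ 8ℚ * δ
    P≈ = ≤-trans (divide-by-unit {ε} P v (negᵢ 𝑖) (1≤Nγ^ q) (N-γ^≤ q≤R) (N-γ^≤2 q≤R) ∥P∥≤2 Pv≈-𝑖)
      (≤-by (nonNegative⁻¹ 2ℚ *₀ 0≤- ε≤δ) (P≈-identity3 ε δ))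
    -- What `c` would be with exact rotations: its real part `sin(p y) - sin(q y)` is nonnegative,
    -- its imaginary part is of second order in `y`, while `Re Q ≈ sin(p y)` is of first order. This
    -- makes the defect small relative to `β`.
    V = 𝑖 *ᵢ conj u -ᵢ 𝑖 *ᵢ conj v
    c≈ : ∥ c -ᵢ V ∥₁ ≤ 12ℚ * δ
    c≈ = ≤-trans (≤-reflexive (cong ∥_∥₁ (c≈-identity4 P Q 𝑖 (conj u) (conj v)))) (≤-trans (∥∥-+ (P -ᵢ negᵢ 𝑖 *ᵢ conj v) (Q -ᵢ 𝑖 *ᵢ conj u))
      (≤-trans (+-mono-≤ P≈ Q≈) (≤-reflexive (c≈-identity3 δ))))
    re-V : re V ≡ im u - im v
    re-V = cong₂ _-_ (re-𝑖conj u) (re-𝑖conj v)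
    im-V : im V ≡ re u - re v
    im-V = cong₂ _-_ (im-𝑖conj u) (im-𝑖conj v)
    Re-c≤ : re c ≤ (im u - im v) + 12ℚ * δ
    Re-c≤ = subst (λ t → re c ≤ t + 12ℚ * δ) re-V (re-close c V c≈)
    Re-c≥ : im u - im v ≤ re c + 12ℚ * δ
    Re-c≥ = subst (_≤ re c + 12ℚ * δ) re-V (re-close V c (swap-close c V c≈))
    Im-c≤ : im c ≤ (re u - re v) + 12ℚ * δ
    Im-c≤ = subst (λ t → im c ≤ t + 12ℚ * δ) im-V (im-close c V c≈)
    Im-c≥ : re u - re v ≤ im c + 12ℚ * δ
    Im-c≥ = subst (_≤ im c + 12ℚ * δ) im-V (im-close V c (swap-close c V c≈))
    ReQ≥ : im u ≤ re Q + 4ℚ * δ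
    ReQ≥ = subst (_≤ re Q + 4ℚ * δ) (re-𝑖conj u) (re-close (𝑖 *ᵢ conj u) Q (swap-close Q (𝑖 *ᵢ conj u) Q≈))
    0≤s : 0ℚ ≤ s
    0≤s = 0≤ι p *₀ 0≤y
    0≤t : 0ℚ ≤ t
    0≤t = 0≤ι q *₀ 0≤y
    t≤s : t ≤ s
    t≤s = *-monoʳ₀ 0≤y (ι-mono (ℕ.m≤m+n q 2))
    s≡ : s ≡ ϱ * (ι R * y)
    s≡ = trans (cong (_* y) (sym ϱR≡p)) (*-assoc ϱ (ι R) y)
    py≤ : s ≤ 2ℚ * ϱ
    py≤ = subst₂ _≤_ (sym s≡) (*-comm ϱ 2ℚ) (*-monoˡ₀ 0≤ϱ Ry≤2)
    py≥ : ϱ ≤ s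
    py≥ = subst₂ _≤_ (*-identityʳ ϱ) (sym s≡) (*-monoˡ₀ 0≤ϱ 1≤Ry)
    ε≤1 : ε ≤ 1ℚ
    ε≤1 = ≤-trans ε≤δ (≤-trans δ≤ (≤-by (nonNegative⁻¹ (1ℚ - + 1 / 64)) refl))
    s²≤ : s * s ≤ 4ℚ * (ϱ * ϱ)
    s²≤ = ≤-trans (*-mono₀ 0≤s (nonNegative⁻¹ 2ℚ *₀ 0≤ϱ) py≤ py≤) (≤-reflexive (s²≤-identity ϱ))
    s²-bound : ½ * (1ℚ + ε) * (s * s) ≤ 4ℚ * (ϱ * ϱ)
    s²-bound = ≤-trans (≤-by (nonNegative⁻¹ ½ *₀ 0≤- ε≤1 *₀ 0≤sq s) (s²-bound-identity ε (s * s))) s²≤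
    t²-bound : ½ * (1ℚ + ε) * (t * t) ≤ 4ℚ * (ϱ * ϱ)
    t²-bound = ≤-trans (*-monoˡ₀ (nonNegative⁻¹ ½ *₀ (0≤1 +₀ 0≤ε)) (*-mono₀ 0≤t 0≤s t≤s t≤s)) s²-bound
    ϱ²≤ : ϱ * ϱ ≤ + 1 / 64
    ϱ²≤ = *-mono₀ {ϱ} {+ 1 / 8} {ϱ} {+ 1 / 8} 0≤ϱ (nonNegative⁻¹ (+ 1 / 8)) ϱ≤ ϱ≤
    [1+ε]s²≤ : ½ * (1ℚ + ε) * (s * s) ≤ + 1 / 16
    [1+ε]s²≤ = ≤-trans s²-bound (*-monoˡ-≤-nonNeg 4ℚ ϱ²≤)
    [1+ε]t²≤ : ½ * (1ℚ + ε) * (t * t) ≤ + 1 / 16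
    [1+ε]t²≤ = ≤-trans t²-bound (*-monoˡ-≤-nonNeg 4ℚ ϱ²≤)
    0≤1-½[1+ε]s² : 0ℚ ≤ 1ℚ - ½ * (1ℚ + ε) * (s * s)
    0≤1-½[1+ε]s² = 0≤- (≤-trans [1+ε]s²≤ (≤-by (nonNegative⁻¹ (1ℚ - + 1 / 16)) refl))
    Im-u≥ : s * (1ℚ - ½ * (1ℚ + ε) * (s * s)) ≤ im u
    Im-u≥ = Im-γ^≥ p≤R
    Im-u≤ : im u ≤ s * (1ℚ + ε)
    Im-u≤ = Im-γ^≤ p≤R
    0≤Im-v : 0ℚ ≤ im v
    0≤Im-v = ≤-trans (0≤t *₀ 0≤- (≤-trans [1+ε]t²≤ (≤-by (nonNegative⁻¹ (1ℚ - + 1 / 16)) refl))) (Im-γ^≥ q≤R)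
    0≤Im-u-Im-v : 0ℚ ≤ im u - im v
    0≤Im-u-Im-v = ≤-by
      (0≤- Im-u≥ +₀ 0≤- (Im-γ^≤ q≤R) +₀ 0≤y *₀ (0≤- ps²≤1 +₀ 0≤- qε≤½ +₀ nonNegative⁻¹ ½))
      (trans (0≤Im-u-Im-v-identity (im u) (im v) y (ι q) ε) (cong (λ p → 0ℚ + (im u - p * y * (1ℚ - ½ * (1ℚ + ε) * (p * y * (p * y))) + (ι q * y * (1ℚ + ε) - im v)
        + y * (1ℚ - p * (½ * (1ℚ + ε) * (p * y * (p * y))) + (½ - ι q * ε) + ½))) (sym (ι-+ q 2))))
      where
      ps²≤1 : ι p * (½ * (1ℚ + ε) * (s * s)) ≤ 1ℚ
      ps²≤1 = ≤-trans (*-monoˡ₀ (0≤ι p) s²-bound) (≤-trans (≤-reflexive (ps²≤1-identity (ι p) (ϱ * ϱ))) pϱ²≤)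
      qε≤½ : ι q * ε ≤ ½
      qε≤½ = ≤-trans (*-monoˡ₀ (0≤ι q) ε≤δ) qδ≤½

  -- For d = 1 and q even: w₀ᵏ ≈ exp(2πiq/(2q+1)), where w₀^(qk) and w₀^(pk) are nearly conjugate.
  start-consecutive : ∀ {q q′ β κ₀} → QuarterTurn k r (2 ℕ.* q ℕ.+ 1) ε → q ≡ 2 ℕ.* q′ → 2 ℕ.≤ q → 2 ℕ.* q ℕ.+ 1 ℕ.≤ E →
    4ℚ * β * ι (2 ℕ.* q ℕ.+ 1) ≤ 1ℚ → 16ℚ * δ * ι (2 ℕ.* q ℕ.+ 1) ≤ 1ℚ → δ ≤ + 1 / 256 → 8ℚ * δ ≤ κ₀ →
    Start k r q 1 β κ₀ (ι (3 ℕ.^ (4 ℕ.* q)) * 4ℚ)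
  start-consecutive {q} {q′} {β} {κ₀} qt q≡ 2≤q R≤E β≤ 16δ≤ δ≤1/256 8δ≤κ₀ = record
    { w₀ = w₀ A ; 1≤Nw₀ = 1≤Nw₀ A ; w₀≈1 = w₀≈1 A ; ∥Q∥≤2 = ∥Q∥≤2
    ; β≤ReQ = *-cancel₀ {c = 4ℚ * ι R} (positive⁻¹ 4ℚ *₊ 0<ι 1≤R) (≤-by
        (0≤- β≤ +₀ nonNegative⁻¹ 4ℚ *₀ 0≤ι R *₀ (0≤- ReQ≥ +₀ 0≤- Im-γ≥ +₀ 0≤y *₀ 0≤- [1+ε]y²≤) +₀ 0≤- 16δ≤ +₀ nonNegative⁻¹ 2ℚ *₀ 0≤- 1≤Ry +₀ nonNegative⁻¹ (4ℚ * (1ℚ - + 4 / 25) - 2ℚ) *₀ (0≤ι R *₀ 0≤y))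
        (start-consecutive-identity5 (re Q) (im γ) y ε δ β (ι R)))
    ; Re-c≤⅞ = ≤-by
        (0≤- (re-close c V c≈) +₀ nonNegative⁻¹ 2ℚ *₀ 0≤- Im-γ≤ +₀ nonNegative⁻¹ 2ℚ *₀ (0≤1 +₀ 0≤ε) *₀ 0≤- y≤⅖
          +₀ nonNegative⁻¹ (+ 4 / 5) *₀ 0≤- ε≤δ +₀ nonNegative⁻¹ (+ 44 / 5) *₀ 0≤- δ≤1/256 +₀ nonNegative⁻¹ (+ 7 / 8 - + 4 / 5 - (+ 44 / 5) * (+ 1 / 256)))
        (start-consecutive-identity4 (re c) (im γ) y ε δ)
    ; -κ₀≤Re-c = ≤-by (0≤- (re-close V c (swap-close c V c≈)) +₀ 0≤Im-γ +₀ 0≤Im-γ +₀ 0≤- 8δ≤κ₀) (start-consecutive-identity3 (re c) (im γ) δ κ₀)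
    ; Im-c≤κ₀ = ≤-by (0≤- (im-close c V c≈) +₀ 0≤- 8δ≤κ₀) (start-consecutive-identity2 (im c) (re γ) δ κ₀)
    ; -κ₀≤Im-c = ≤-by (0≤- (im-close V c (swap-close c V c≈)) +₀ 0≤- 8δ≤κ₀) (start-consecutive-identity (im c) (re γ) δ κ₀) }
    where
    R = 2 ℕ.* q ℕ.+ 1
    1≤R : 1 ℕ.≤ R
    1≤R = ℕ.m≤n+m 1 (2 ℕ.* q)
    open Approx {k} {r} {R} {ε} 1≤k 1≤R qt 0≤ε {E} {δ} 3^Eε≤δ δ≤
    p = q ℕ.+ 1
    A = 4 ℕ.* q
    P = w₀ A ^ (q ℕ.* k)
    Q = w₀ A ^ (p ℕ.* k)
    c = P +ᵢ Q
    γ^1≡γ : γ ^ 1 ≡ γ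
    γ^1≡γ = γ^1≡γ-identity γ
    X = x ^ R
    X≈𝑖 : ∥ X -ᵢ 𝑖 ∥₁ ≤ δ
    X≈𝑖 = subst (λ t → ∥ X -ᵢ t ∥₁ ≤ δ) (trans (cong (λ t → 𝑖 ^ (2 ℕ.* t ℕ.+ 1)) q≡) (trans (cong (𝑖 ^_) (X≈𝑖-identity q′)) (𝑖^[1+4h]≡𝑖 q′))) (x^≈𝑖^ R≤E)
    -- `4 q (q + 1) + 1 = R²`, and `R` is `1` modulo `4` as `q` is even, so `Q ≈ 𝑖 / γ`. Likewise
    -- `4 q² + 2 R = R² + 1` gives `P ≈ -𝑖 γ`, and the imaginary parts cancel.
    Qγ≡X : Q *ᵢ γ ≡ X
    Qγ≡X = trans (cong₂ _*ᵢ_ (w₀^≡γ^ A p) (sym γ^1≡γ)) (trans (sym (^-homo-* γ (A ℕ.* p) 1))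
      (trans (cong (γ ^_) (Qγ≡X-identity q)) (sym (x^≡γ^ R))))
    Px²≡Xγ : P *ᵢ x ^ 2 ≡ X *ᵢ γ
    Px²≡Xγ = trans (cong₂ _*ᵢ_ (w₀^≡γ^ A q) (x^≡γ^ 2)) (trans (sym (^-homo-* γ (A ℕ.* q) (R ℕ.* 2)))
      (trans (cong (γ ^_) (Px²≡Xγ-identity q)) (trans (^-homo-* γ (R ℕ.* R) 1) (cong₂ _*ᵢ_ (sym (x^≡γ^ R)) γ^1≡γ))))
    1≤Nγ : 1ℚ ≤ N γ
    1≤Nγ = subst (λ t → 1ℚ ≤ N t) γ^1≡γ (1≤Nγ^ 1)
    Nγ≤1+ε : N γ ≤ 1ℚ + ε
    Nγ≤1+ε = subst (λ t → N t ≤ 1ℚ + ε) γ^1≡γ (N-γ^≤ 1≤R)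
    Nγ≤2 : N γ ≤ 2ℚ
    Nγ≤2 = subst (λ t → N t ≤ 2ℚ) γ^1≡γ (N-γ^≤2 1≤R)
    2≤E : 2 ℕ.≤ E
    2≤E = ℕ.≤-trans 2≤q (ℕ.≤-trans (ℕ.m≤n*m q 2) (ℕ.≤-trans (ℕ.m≤m+n (2 ℕ.* q) 1) R≤E))
    NXγ≤2 : N (X *ᵢ γ) ≤ 2ℚ
    NXγ≤2 = ≤-trans (≤-reflexive (N-* X γ)) (≤-trans
      (*-mono₀ (0≤N X) (0≤1 +₀ 0≤ε) (≤-trans (N-x^≤ R≤E) [1+δ]²≤) Nγ≤1+ε)
      (≤-by (nonNegative⁻¹ (+ 3 / 2) *₀ (0≤- ε≤δ +₀ 0≤- δ≤) +₀ nonNegative⁻¹ (2ℚ - (1ℚ + + 1 / 64) * (+ 3 / 2))) (NXγ≤2-identity ε δ)))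
    ∥P∥≤2 : ∥ P ∥₁ ≤ 2ℚ
    ∥P∥≤2 = N≤2⇒∥∥≤2 P (≤-trans (N-factor≤ P (x ^ 2) (1≤Nx^ 2)) (≤-trans (≤-reflexive (cong N Px²≡Xγ)) NXγ≤2))
    ∥Q∥≤2 : ∥ Q ∥₁ ≤ 2ℚ
    ∥Q∥≤2 = N≤2⇒∥∥≤2 Q (≤-trans (N-factor≤ Q γ 1≤Nγ) (≤-trans (≤-reflexive (cong N Qγ≡X)) (N-x^≤2 R≤E)))
    Q≈ : ∥ Q -ᵢ 𝑖 *ᵢ conj γ ∥₁ ≤ 4ℚ * δ
    Q≈ = ≤-trans (divide-by-unit {ε} Q γ 𝑖 1≤Nγ Nγ≤1+ε Nγ≤2 ∥Q∥≤2 (subst (λ t → ∥ t -ᵢ 𝑖 ∥₁ ≤ δ) (sym Qγ≡X) X≈𝑖))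
      (≤-by (nonNegative⁻¹ 2ℚ *₀ 0≤- ε≤δ) (Q≈-identity2 ε δ))
    P≈ : ∥ P +ᵢ 𝑖 *ᵢ γ ∥₁ ≤ 4ℚ * δ
    P≈ = ≤-trans (≤-reflexive (cong ∥_∥₁ (P≈-identity2 P X 𝑖 γ))) (≤-trans (∥∥-- (P +ᵢ X *ᵢ γ) ((X -ᵢ 𝑖) *ᵢ γ))
      (≤-trans (+-mono-≤ (subst (λ t → ∥ P +ᵢ t ∥₁ ≤ 2ℚ * δ) Px²≡Xγ (z+zx^j-small 2≤E refl P ∥P∥≤2))
        (≤-trans (∥∥-* (X -ᵢ 𝑖) γ) (*-mono₀ {∥ X -ᵢ 𝑖 ∥₁} {δ} {∥ γ ∥₁} {2ℚ} (0≤∥∥ (X -ᵢ 𝑖)) (nonNegative⁻¹ 2ℚ) X≈𝑖 (N≤2⇒∥∥≤2 γ Nγ≤2))))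
        (≤-reflexive (P≈-identity δ))))
    V : ℚ[i]
    V = (im γ + im γ) ⊹ (re γ - re γ)
    c≈ : ∥ c -ᵢ V ∥₁ ≤ 8ℚ * δ
    c≈ = ≤-trans (≤-reflexive (cong ∥_∥₁ (trans (cong (c -ᵢ_) V≡) (c≈-identity2 P Q (𝑖 *ᵢ conj γ) (𝑖 *ᵢ γ))))) (≤-trans (∥∥-+ (P +ᵢ 𝑖 *ᵢ γ) (Q -ᵢ 𝑖 *ᵢ conj γ))
      (≤-trans (+-mono-≤ P≈ Q≈) (≤-reflexive (c≈-identity δ))))
      where
      V≡ : V ≡ 𝑖 *ᵢ conj γ -ᵢ 𝑖 *ᵢ γ
      V≡ = cong₂ _⊹_ (V≡-identity2 (re γ) (im γ)) (V≡-identity (re γ) (im γ))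
    ReQ≥ : im γ ≤ re Q + 4ℚ * δ
    ReQ≥ = subst (_≤ re Q + 4ℚ * δ) (re-𝑖conj γ) (re-close (𝑖 *ᵢ conj γ) Q (swap-close Q (𝑖 *ᵢ conj γ) Q≈))
    1·y : ι 1 * y ≡ y
    1·y = 1·y-identity y
    Im-γ≤ : im γ ≤ y * (1ℚ + ε)
    Im-γ≤ = subst₂ (λ s t → im s ≤ t * (1ℚ + ε)) γ^1≡γ 1·y (Im-γ^≤ 1≤R)
    Im-γ≥ : y * (1ℚ - ½ * (1ℚ + ε) * (y * y)) ≤ im γ
    Im-γ≥ = subst₂ (λ s t → t * (1ℚ - ½ * (1ℚ + ε) * (t * t)) ≤ im s) γ^1≡γ 1·y (Im-γ^≥ 1≤R)
    -- This keeps `c ≈ 2 sin y` at most about `4 / 5`, so that the residual `1 - c` is not small at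
    -- the start.
    5≤R : 5 ℕ.≤ R
    5≤R = ℕ.+-monoˡ-≤ 1 (ℕ.*-monoʳ-≤ 2 2≤q)
    5y≤2 : 5ℚ * y ≤ 2ℚ
    5y≤2 = ≤-trans (*-monoʳ₀ 0≤y (ι-mono 5≤R)) Ry≤2
    y≤⅖ : y ≤ + 2 / 5
    y≤⅖ = ≤-by (nonNegative⁻¹ (+ 1 / 5) *₀ 0≤- 5y≤2) (y≤⅖-identity y)
    ε≤1 : ε ≤ 1ℚ
    ε≤1 = ≤-trans ε≤δ (≤-trans δ≤ (≤-by (nonNegative⁻¹ (1ℚ - + 1 / 64)) refl))
    [1+ε]y²≤ : ½ * (1ℚ + ε) * (y * y) ≤ + 4 / 25
    [1+ε]y²≤ = ≤-trans (≤-by (nonNegative⁻¹ ½ *₀ 0≤- ε≤1 *₀ 0≤sq y) (s²-bound-identity ε (y * y)))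
      (*-mono₀ {y} {+ 2 / 5} {y} {+ 2 / 5} 0≤y (nonNegative⁻¹ (+ 2 / 5)) y≤⅖ y≤⅖)
    0≤Im-γ : 0ℚ ≤ im γ
    0≤Im-γ = ≤-trans (0≤y *₀ 0≤- (≤-trans [1+ε]y²≤ (≤-by (nonNegative⁻¹ (1ℚ - + 4 / 25)) refl))) Im-γ≥

-- Starting points, uniform in k, whose defect is small relative to Re w₀^(pk).
Starts : ℕ → ℕ → Set
Starts q d = ∀ t → 0ℚ < t → t ≤ 1ℚ → ∃ λ β → 0ℚ < β × ι q * β ≤ + 1 / 2048 × ∃ λ C → 0ℚ ≤ C ×
  (∀ k r → 1 ℕ.≤ k → ι k * r ≡ 1ℚ → 0ℚ ≤ r → Start k r q d β (t * β) C)

-- The choice of the constants and of the threshold for `k`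

1≤B-identity : ∀ p → 2ℚ + 16ℚ * p ≡ 1ℚ + (1ℚ + 16ℚ * p)
1≤B-identity = solve-∀ ℚ-ring

pBt≡-identity : ∀ p B t → p * B * t ≡ (+ 1 / 1024) * ((+ 1024 / 1) * (p * B) * t)
pBt≡-identity = solve-∀ ℚ-ring

t≤1-identity : ∀ t → t ≡ 1ℚ * 1ℚ * t
t≤1-identity = solve-∀ ℚ-ring

h-small-identity : ∀ h p u → (+ 1 / 36864) * (((+ 36864 / 1) * (p * p * p) + (+ 384 / 1) * (p * p) * u) * h) ≡
  h * (p * p * p) + (+ 1 / 36864) * ((+ 384 / 1) * (p * p) * u * h)
h-small-identity = solve-∀ ℚ-ring

384p²h≤tβ-identity : ∀ h p u s → s * (((+ 36864 / 1) * (p * p * p) + (+ 384 / 1) * (p * p) * u) * h) ≡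
  (+ 384 / 1) * (p * p) * h * (s * u) + s * ((+ 36864 / 1) * (p * p * p) * h)
384p²h≤tβ-identity = solve-∀ ℚ-ring

κ≥-identity : ∀ s x → 2ℚ * s ≡ s + x + (s - x)
κ≥-identity = solve-∀ ℚ-ring

β≤1-identity : ∀ q β → q * β ≡ β + (q - 1ℚ) * β
β≤1-identity = solve-∀ ℚ-ring

α≤-identity : ∀ q d t β B → (+ 1 / 16) * (d * β - q * (2ℚ * (t * β))) ≡
  ((+ 1 / 64) * β + 2ℚ * (t * β) * (q * (2ℚ * (t * β)) + d * B))
  + β * ((+ 1 / 16) * (d - 1ℚ) + (+ 1 / 8) * ((+ 1 / 1024) - q * 1ℚ * t) + 2ℚ * ((+ 1 / 1024) - d * B * t)
    + 4ℚ * (t * β) * ((+ 1 / 1024) - q * 1ℚ * t) + (+ 4 / 1024) * (t * (1ℚ - β) + (1ℚ - t))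
    + (+ 1 / 16 - + 1 / 64 - + 1 / 8192 - + 2 / 1024 - + 4 / 1024))
α≤-identity = solve-∀ ℚ-ring

qh≤-identity : ∀ h q d → h * ((q + d) * (q + d) * (q + d)) ≡ q * h + h * (d + (q + d) * (((q + d) - 1ℚ) * ((q + d) + 1ℚ)))
qh≤-identity = solve-∀ ℚ-ring

κ-small-identity : ∀ q t β h → + 1 / 512 ≡ q * (3ℚ * (2ℚ * (t * β)) + 5ℚ * h)
  + ((+ 6 / 1) * (t * ((+ 1 / 2048) - q * β) + (+ 1 / 2048) * ((+ 1 / 1024) - 1ℚ * 1ℚ * t)) + 5ℚ * ((+ 1 / 36864) - q * h)
     + (+ 1 / 512 - + 6 / 2097152 - + 5 / 36864))
κ-small-identity = solve-∀ ℚ-ring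

κB-small-identity : ∀ q t β B → + 1 / 524288 ≡ 2ℚ * (2ℚ * (t * β)) * B * (q * q)
  + 4ℚ * (q * β * ((+ 1 / 1024) - q * B * t) + (+ 1 / 1024) * ((+ 1 / 2048) - q * β))
κB-small-identity = solve-∀ ℚ-ring

root-identity3 : ∀ a → 1ℚ - a ≡ + 1 / 8 + ((+ 7 / 8) - a)
root-identity3 = solve-∀ ℚ-ring

root-identity2 : ∀ a κ → 1ℚ + κ ≡ (1ℚ - a) + (κ - - a)
root-identity2 = solve-∀ ℚ-ring

root-identity : ∀ b → - (0ℚ - b) ≡ b
root-identity = solve-∀ ℚ-ring

r-small₂-identity : ∀ a b c r → (a + b + c) * r ≡ b * r + (a + c) * r
r-small₂-identity = solve-∀ ℚ-ring

rη≤16-identity : ∀ a b c r → (a + b + c) * r ≡ r * c + (a + b) * r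
rη≤16-identity = solve-∀ ℚ-ring

r-small₁-identity : ∀ i C η r → η ≡ 2ℚ * (C * C) * r * (η * i) + ((1ℚ - (2ℚ * (C * C) * i + C + η) * r) * η + (C + η) * r * η)
r-small₁-identity = solve-∀ ℚ-ring

module FromStarts {q d : ℕ} (1≤q : 1 ℕ.≤ q) (1≤d : 1 ℕ.≤ d) (starts : Starts q d) where
  p B : ℚ
  p = ι q + ι d
  B = 2ℚ + 16ℚ * p

  1≤ιq : 1ℚ ≤ ι q
  1≤ιq = 1≤ι 1≤q

  1≤ιd : 1ℚ ≤ ι d
  1≤ιd = 1≤ι 1≤d

  0≤q : 0ℚ ≤ ι q
  0≤q = 0≤ι q

  0≤d : 0ℚ ≤ ι d
  0≤d = 0≤ι d

  1≤p : 1ℚ ≤ p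
  1≤p = ≤-trans 1≤ιq (≤-by 0≤d refl)

  0≤p : 0ℚ ≤ p
  0≤p = ≤-trans 0≤1 1≤p

  0<p : 0ℚ < p
  0<p = <-≤-trans 0<1 1≤p

  1≤B : 1ℚ ≤ B
  1≤B = ≤-by (0≤1 +₀ nonNegative⁻¹ 16ℚ *₀ 0≤p) (1≤B-identity p)

  0≤B : 0ℚ ≤ B
  0≤B = ≤-trans 0≤1 1≤B

  0<1024pB : 0ℚ < (+ 1024 / 1) * (p * B)
  0<1024pB = positive⁻¹ (+ 1024 / 1) *₊ (0<p *₊ <-≤-trans 0<1 1≤B)

  -- The defect bound `κ = 2 t β` enters the conditions multiplied by quantities like `d B` and is
  -- compared with `β`. As `B` bounds `Q` along the whole iteration independently of `β`, one `t`
  -- settles these comparisons before `β` is known.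
  t : ℚ
  t = proj₁ (recip 0<1024pB)

  0<t : 0ℚ < t
  0<t = proj₁ (proj₂ (recip 0<1024pB))

  0≤t : 0ℚ ≤ t
  0≤t = <⇒≤ 0<t

  pBt≡ : p * B * t ≡ + 1 / 1024
  pBt≡ = trans (pBt≡-identity p B t) (cong ((+ 1 / 1024) *_) (proj₂ (proj₂ (recip 0<1024pB))))

  xyt≤ : ∀ {x y} → 0ℚ ≤ x → x ≤ p → y ≤ B → x * y * t ≤ + 1 / 1024
  xyt≤ 0≤x x≤p y≤B = ≤-trans (*-monoʳ₀ 0≤t (*-mono₀ 0≤x 0≤B x≤p y≤B)) (≤-reflexive pBt≡)

  q≤p : ι q ≤ p
  q≤p = ≤-by 0≤d refl

  d≤p : ι d ≤ p
  d≤p = ≤-by 0≤q (+-comm (ι q) (ι d))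

  qBt≤ : ι q * B * t ≤ + 1 / 1024
  qBt≤ = xyt≤ 0≤q q≤p ≤-refl

  dBt≤ : ι d * B * t ≤ + 1 / 1024
  dBt≤ = xyt≤ 0≤d d≤p ≤-refl

  qt≤ : ι q * 1ℚ * t ≤ + 1 / 1024
  qt≤ = xyt≤ 0≤q q≤p 1≤B

  t≤ : 1ℚ * 1ℚ * t ≤ + 1 / 1024
  t≤ = xyt≤ {1ℚ} {1ℚ} 0≤1 1≤p 1≤B

  t≤1 : t ≤ 1ℚ
  t≤1 = ≤-trans (≤-reflexive (t≤1-identity t)) (≤-trans t≤ (≤-by (nonNegative⁻¹ (1ℚ - + 1 / 1024)) refl))

  β C : ℚ
  β = proj₁ (starts t 0<t t≤1)
  C = proj₁ (proj₂ (proj₂ (proj₂ (starts t 0<t t≤1))))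

  0<β : 0ℚ < β
  0<β = proj₁ (proj₂ (starts t 0<t t≤1))

  0≤β : 0ℚ ≤ β
  0≤β = <⇒≤ 0<β

  qβ≤ : ι q * β ≤ + 1 / 2048
  qβ≤ = proj₁ (proj₂ (proj₂ (starts t 0<t t≤1)))

  0≤C : 0ℚ ≤ C
  0≤C = proj₁ (proj₂ (proj₂ (proj₂ (proj₂ (starts t 0<t t≤1)))))

  startAt : ∀ k r → 1 ℕ.≤ k → ι k * r ≡ 1ℚ → 0ℚ ≤ r → Start k r q d β (t * β) C
  startAt = proj₂ (proj₂ (proj₂ (proj₂ (proj₂ (starts t 0<t t≤1)))))

  0<tβ : 0ℚ < t * β
  0<tβ = 0<t *₊ 0<β

  0≤tβ : 0ℚ ≤ t * β
  0≤tβ = <⇒≤ 0<tβ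

  u : ℚ
  u = proj₁ (recip 0<tβ)

  0≤u : 0ℚ ≤ u
  0≤u = <⇒≤ (proj₁ (proj₂ (recip 0<tβ)))

  tβu≡1 : t * β * u ≡ 1ℚ
  tβu≡1 = proj₂ (proj₂ (recip 0<tβ))

  -- The sum of two demands on `1 / h`: `36864 p³` from a single step, and `384 p² / (t β)` so that
  -- the error accumulated in `e` does not exceed the starting defect.
  X : ℚ
  X = (+ 36864 / 1) * (p * p * p) + (+ 384 / 1) * (p * p) * u

  0<X : 0ℚ < X
  0<X = +-mono-<-≤ (positive⁻¹ (+ 36864 / 1) *₊ (0<p *₊ 0<p *₊ 0<p)) (nonNegative⁻¹ (+ 384 / 1) *₀ (0≤p *₀ 0≤p) *₀ 0≤u)

  h : ℚ
  h = proj₁ (recip 0<X)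

  0<h : 0ℚ < h
  0<h = proj₁ (proj₂ (recip 0<X))

  0≤h : 0ℚ ≤ h
  0≤h = <⇒≤ 0<h

  Xh≡1 : X * h ≡ 1ℚ
  Xh≡1 = proj₂ (proj₂ (recip 0<X))

  h-small : h * (p * p * p) ≤ + 1 / 36864
  h-small = ≤-by (nonNegative⁻¹ (+ 1 / 36864) *₀ (nonNegative⁻¹ (+ 384 / 1) *₀ (0≤p *₀ 0≤p) *₀ 0≤u *₀ 0≤h))
    (trans (cong ((+ 1 / 36864) *_) (sym Xh≡1)) (h-small-identity h p u))

  384p²h≤tβ : (+ 384 / 1) * (p * p) * h ≤ t * β
  384p²h≤tβ = ≤-by (0≤tβ *₀ (nonNegative⁻¹ (+ 36864 / 1) *₀ (0≤p *₀ 0≤p *₀ 0≤p) *₀ 0≤h))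
    (trans (sym (*-identityʳ (t * β))) (trans (cong (t * β *_) (sym Xh≡1)) (trans (384p²h≤tβ-identity h p u (t * β))
      (trans (cong (λ s → (+ 384 / 1) * (p * p) * h * s + t * β * ((+ 36864 / 1) * (p * p * p) * h)) tβu≡1) (cong (_+ t * β * ((+ 36864 / 1) * (p * p * p) * h)) (*-identityʳ ((+ 384 / 1) * (p * p) * h)))))))

  -- Half of `κ` is the starting defect, the other half is reserved for the error of the iteration.
  κ α : ℚ
  κ = 2ℚ * (t * β)
  α = (+ 1 / 64) * β

  0<α : 0ℚ < α
  0<α = positive⁻¹ (+ 1 / 64) *₊ 0<β

  κ≥ : t * β + (+ 384 / 1) * (p * p) * h ≤ κ
  κ≥ = ≤-by (0≤- 384p²h≤tβ) (κ≥-identity (t * β) ((+ 384 / 1) * (p * p) * h))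

  β≤1 : β ≤ 1ℚ
  β≤1 = ≤-trans (≤-by (0≤- 1≤ιq *₀ 0≤β) (β≤1-identity (ι q) β)) (≤-trans qβ≤ (≤-by (nonNegative⁻¹ (1ℚ - + 1 / 2048)) refl))

  α≤ : α + κ * (ι q * κ + ι d * B) ≤ (+ 1 / 16) * (ι d * β - ι q * κ)
  α≤ = ≤-by
    (0≤β *₀ (nonNegative⁻¹ (+ 1 / 16) *₀ 0≤- 1≤ιd
      +₀ nonNegative⁻¹ (+ 1 / 8) *₀ 0≤- qt≤
      +₀ nonNegative⁻¹ 2ℚ *₀ 0≤- dBt≤
      +₀ nonNegative⁻¹ 4ℚ *₀ (0≤t *₀ 0≤β) *₀ 0≤- qt≤
      +₀ nonNegative⁻¹ (+ 4 / 1024) *₀ (0≤t *₀ 0≤- β≤1 +₀ 0≤- t≤1)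
      +₀ nonNegative⁻¹ (+ 1 / 16 - + 1 / 64 - + 1 / 8192 - + 2 / 1024 - + 4 / 1024)))
    (α≤-identity (ι q) (ι d) t β B)

  qh≤ : ι q * h ≤ + 1 / 36864
  qh≤ = ≤-trans (≤-by (0≤h *₀ (0≤d +₀ 0≤p *₀ (0≤- 1≤p *₀ (0≤p +₀ 0≤1)))) (qh≤-identity h (ι q) (ι d))) h-small

  κ-small : ι q * (3ℚ * κ + 5ℚ * h) ≤ + 1 / 512
  κ-small = ≤-by
    (nonNegative⁻¹ (+ 6 / 1) *₀ (0≤t *₀ 0≤- qβ≤ +₀ nonNegative⁻¹ (+ 1 / 2048) *₀ 0≤- t≤) +₀ nonNegative⁻¹ 5ℚ *₀ 0≤- qh≤
      +₀ nonNegative⁻¹ (+ 1 / 512 - + 6 / 2097152 - + 5 / 36864))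
    (κ-small-identity (ι q) t β h)

  κB-small : 2ℚ * κ * B * (ι q * ι q) ≤ + 1 / 524288
  κB-small = ≤-by
    (nonNegative⁻¹ 4ℚ *₀ (0≤q *₀ 0≤β *₀ 0≤- qBt≤ +₀ nonNegative⁻¹ (+ 1 / 1024) *₀ 0≤- qβ≤))
    (κB-small-identity (ι q) t β B)

  0<36p² : 0ℚ < (+ 36 / 1) * (p * p)
  0<36p² = positive⁻¹ (+ 36 / 1) *₊ (0<p *₊ 0<p)

  η : ℚ
  η = proj₁ (recip 0<36p²) * (h * α)

  0<η : 0ℚ < η
  0<η = proj₁ (proj₂ (recip 0<36p²)) *₊ (0<h *₊ 0<α)

  η≤ : (+ 36 / 1) * (p * p) * η ≤ h * α
  η≤ = ≤-reflexive (trans (sym (*-assoc ((+ 36 / 1) * (p * p)) (proj₁ (recip 0<36p²)) (h * α)))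
    (trans (cong (_* (h * α)) (proj₂ (proj₂ (recip 0<36p²)))) (*-identityˡ (h * α))))

  -- Again a sum of demands: `W r ≤ 1` implies all three smallness conditions on `r`.
  C₁ η⁻¹ W : ℚ
  C₁ = 16ℚ + C
  η⁻¹ = proj₁ (recip 0<η)
  W = 2ℚ * (C₁ * C₁) * η⁻¹ + C₁ + η

  0≤C₁ : 0ℚ ≤ C₁
  0≤C₁ = nonNegative⁻¹ 16ℚ +₀ 0≤C

  0≤η : 0ℚ ≤ η
  0≤η = <⇒≤ 0<η

  0≤2C₁²η⁻¹ : 0ℚ ≤ 2ℚ * (C₁ * C₁) * η⁻¹
  0≤2C₁²η⁻¹ = nonNegative⁻¹ 2ℚ *₀ (0≤C₁ *₀ 0≤C₁) *₀ <⇒≤ (proj₁ (proj₂ (recip 0<η)))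

  k₀ : ℕ
  k₀ = proj₁ (archimedean W)

  root : ∀ k → k₀ ℕ.≤ k → 1 ℕ.≤ k → ∃ λ z → IsRoot (K (q ℕ.* k) ((q ℕ.+ d) ℕ.* k)) z × 0ℝ <ℝ Re z
  root k k₀≤k 1≤k = NewtonFlow.Iteration.PositiveRoot.positive-root 1≤k kr≡1 0≤r q d 1≤q 1≤d w₀
    0≤h h-small 0≤tβ κ≥ 0≤β (<⇒≤ 0<α) α≤ κ-small qβ≤ κB-small 1≤Nw₀ ∥Q∥≤2 β≤ReQ
    (≤-by (0≤- Re-c≤⅞) (root-identity3 (re c))) (≤-by (0≤- -κ₀≤Re-c) (root-identity2 (re c) (t * β)))
    (≤-trans (≤-reflexive (+-identityˡ (- im c))) -κ₀≤Im-c) (≤-trans (≤-reflexive (root-identity (im c))) Im-c≤κ₀)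
    0<h 0<r 0<η η≤ 0≤C r-small₁ r-small₂ rη≤16 w₀≈1
    where
    r : ℚ
    r = proj₁ (recip (0<ι 1≤k))
    0<r : 0ℚ < r
    0<r = proj₁ (proj₂ (recip (0<ι 1≤k)))
    0≤r : 0ℚ ≤ r
    0≤r = <⇒≤ 0<r
    kr≡1 : ι k * r ≡ 1ℚ
    kr≡1 = proj₂ (proj₂ (recip (0<ι 1≤k)))
    open Start (startAt k r 1≤k kr≡1 0≤r)
    W≤k : W ≤ ι k
    W≤k = ≤-trans (proj₂ (proj₂ (archimedean W))) (ι-mono k₀≤k)
    Wr≤1 : W * r ≤ 1ℚ
    Wr≤1 = subst (W * r ≤_) kr≡1 (*-monoʳ₀ 0≤r W≤k)
    r-small₂ : C₁ * r ≤ 1ℚ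
    r-small₂ = ≤-trans (≤-by ((0≤2C₁²η⁻¹ +₀ 0≤η) *₀ 0≤r) (r-small₂-identity (2ℚ * (C₁ * C₁) * η⁻¹) C₁ η r)) Wr≤1
    rη≤16 : r * η ≤ 16ℚ
    rη≤16 = ≤-trans (≤-by ((0≤2C₁²η⁻¹ +₀ 0≤C₁) *₀ 0≤r) (rη≤16-identity (2ℚ * (C₁ * C₁) * η⁻¹) C₁ η r))
      (≤-trans Wr≤1 (≤-by (nonNegative⁻¹ (+ 15 / 1)) refl))
    r-small₁ : 2ℚ * (C₁ * C₁) * r ≤ η
    r-small₁ = ≤-by (0≤- Wr≤1 *₀ 0≤η +₀ (0≤C₁ +₀ 0≤η) *₀ 0≤r *₀ 0≤η)
      (trans (r-small₁-identity η⁻¹ C₁ η r) (trans (cong (λ s → 2ℚ * (C₁ * C₁) * r * s + ((1ℚ - W * r) * η + (C₁ + η) * r * η)) (proj₂ (proj₂ (recip 0<η))))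
        (cong (_+ ((1ℚ - W * r) * η + (C₁ + η) * r * η)) (*-identityʳ (2ℚ * (C₁ * C₁) * r)))))

-- Parity and inverses modulo `d` and `2 d`

parity : ∀ n → (∃ λ m → n ≡ 2 ℕ.* m) ⊎ (∃ λ m → n ≡ 1 ℕ.+ 2 ℕ.* m)
parity zero = inj₁ (0 , refl)
parity (suc n) with parity n
... | inj₁ (m , eq) = inj₂ (m , cong suc eq)
... | inj₂ (m , eq) = inj₁ (suc m , trans (cong suc eq) (sym (ℕ.*-suc 2 m)))

-- If the identity comes as `1 + x p = y d`, then `x p` is `-1` modulo `d`, and its square, again a
-- multiple of `p`, is `1`.
bézout : ∀ {p d p′} → Coprime p d → p ≡ 1 ℕ.+ p′ → ∃₂ λ j h → p ℕ.* j ≡ 1 ℕ.+ d ℕ.* h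
bézout {p} {d} {p′} coprime p≡ = from-identity (coprime-Bézout coprime)
  where
  from-negative : ∀ x y s → x ℕ.* p ≡ s → 1 ℕ.+ s ≡ y ℕ.* d → ∃₂ λ j h → p ℕ.* j ≡ 1 ℕ.+ d ℕ.* h
  -- Here `y d = 1`, so `d = 1` and every number is an inverse.
  from-negative x y zero    xp≡ eq = 1 , p′ , trans (ℕ.*-identityʳ p) (trans p≡
    (cong suc (sym (trans (cong (ℕ._* p′) (ℕ.m*n≡1⇒n≡1 y d (sym eq))) (ℕ.*-identityˡ p′)))))
  from-negative x y (suc s) xp≡ eq = x ℕ.* suc s , s ℕ.* y , trans (lemma₁ p x (suc s)) (trans (cong (ℕ._* suc s) xp≡)
    (trans (lemma₂ s) (trans (cong (λ t → 1 ℕ.+ s ℕ.* t) eq) (lemma₃ s y d))))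
    where
    lemma₁ : ∀ p x s → p ℕ.* (x ℕ.* s) ≡ x ℕ.* p ℕ.* s
    lemma₁ = solve-∀ℕ
    lemma₂ : ∀ s → (1 ℕ.+ s) ℕ.* (1 ℕ.+ s) ≡ 1 ℕ.+ s ℕ.* (1 ℕ.+ (1 ℕ.+ s))
    lemma₂ = solve-∀ℕ
    lemma₃ : ∀ s y d → 1 ℕ.+ s ℕ.* (y ℕ.* d) ≡ 1 ℕ.+ d ℕ.* (s ℕ.* y)
    lemma₃ = solve-∀ℕ
  from-identity : Bézout.Identity 1 p d → ∃₂ λ j h → p ℕ.* j ≡ 1 ℕ.+ d ℕ.* h
  from-identity (Bézout.+- x y eq) = x , y , trans (ℕ.*-comm p x) (trans (sym eq) (cong suc (ℕ.*-comm y d)))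
  from-identity (Bézout.-+ x y eq) = from-negative x y (x ℕ.* p) refl eq

-- An inverse modulo `d` becomes one modulo `2 d` after adding `d` if necessary: as `p` is odd, this
-- changes the parity of `h`. Then `p j` is odd, and so is `j`.
odd-inverse : ∀ {p d p′} → Coprime p d → p ≡ 1 ℕ.+ 2 ℕ.* p′ →
  ∃₂ λ j h → p ℕ.* j ≡ 1 ℕ.+ 2 ℕ.* d ℕ.* h × ∃ λ j′ → j ≡ 1 ℕ.+ 2 ℕ.* j′
odd-inverse {p} {d} {p′} coprime p≡ = from-bézout (bézout {p′ = 2 ℕ.* p′} coprime p≡)
  where
  odd-factor : ∀ j h → p ℕ.* j ≡ 1 ℕ.+ 2 ℕ.* d ℕ.* h → ∃ λ j′ → j ≡ 1 ℕ.+ 2 ℕ.* j′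
  odd-factor j h eq with parity j
  ... | inj₂ odd       = odd
  ... | inj₁ (i , j≡) = ⊥-elim (ℕ.even≢odd (p ℕ.* i) (d ℕ.* h)
    (trans (lemma₁ p i) (trans (cong (p ℕ.*_) (sym j≡)) (trans eq (cong suc (ℕ.*-assoc 2 d h))))))
    where
    lemma₁ : ∀ p i → 2 ℕ.* (p ℕ.* i) ≡ p ℕ.* (2 ℕ.* i)
    lemma₁ = solve-∀ℕ
  from-bézout : (∃₂ λ j h → p ℕ.* j ≡ 1 ℕ.+ d ℕ.* h) →
    ∃₂ λ j h → p ℕ.* j ≡ 1 ℕ.+ 2 ℕ.* d ℕ.* h × ∃ λ j′ → j ≡ 1 ℕ.+ 2 ℕ.* j′
  from-bézout (j , h , eq) with parity h
  ... | inj₁ (i , h≡) = j , i , eq′ , odd-factor j i eq′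
    where
    lemma : ∀ d i → 1 ℕ.+ d ℕ.* (2 ℕ.* i) ≡ 1 ℕ.+ 2 ℕ.* d ℕ.* i
    lemma = solve-∀ℕ
    eq′ : p ℕ.* j ≡ 1 ℕ.+ 2 ℕ.* d ℕ.* i
    eq′ = trans eq (trans (cong (λ t → 1 ℕ.+ d ℕ.* t) h≡) (lemma d i))
  ... | inj₂ (i , h≡) = j ℕ.+ d , i ℕ.+ p′ ℕ.+ 1 , eq′ , odd-factor (j ℕ.+ d) (i ℕ.+ p′ ℕ.+ 1) eq′
    where
    lemma : ∀ d i p′ → 1 ℕ.+ d ℕ.* (1 ℕ.+ 2 ℕ.* i) ℕ.+ (1 ℕ.+ 2 ℕ.* p′) ℕ.* d ≡ 1 ℕ.+ 2 ℕ.* d ℕ.* (i ℕ.+ p′ ℕ.+ 1)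
    lemma = solve-∀ℕ
    eq′ : p ℕ.* (j ℕ.+ d) ≡ 1 ℕ.+ 2 ℕ.* d ℕ.* (i ℕ.+ p′ ℕ.+ 1)
    eq′ = trans (ℕ.*-distribˡ-+ p j d) (trans (cong₂ (λ s t → s ℕ.+ t ℕ.* d) (trans eq (cong (λ t → 1 ℕ.+ d ℕ.* t) h≡)) p≡) (lemma d i p′))

-- Tolerances for the four kinds of starting points

precision : ∀ E {δ} → 0ℚ < δ → δ ≤ + 1 / 64 → ∃ λ ε → 0ℚ < ε × ε ≤ + 1 / 64 × ι (3 ℕ.^ E) * ε ≤ δ
precision E {δ} 0<δ δ≤ with recip (0<ι (ℕ.m^n>0 3 E))
... | i , 0<i , 3^Ei≡1 = i * δ , 0<i *₊ 0<δ , ≤-trans iδ≤δ δ≤ ,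
  ≤-reflexive (trans (sym (*-assoc (ι (3 ℕ.^ E)) i δ)) (trans (cong (_* δ) 3^Ei≡1) (*-identityˡ δ)))
  where
  iδ≤δ : i * δ ≤ δ
  iδ≤δ = ≤-by (0≤- (1≤ι (ℕ.m^n>0 3 E)) *₀ (<⇒≤ 0<i *₀ <⇒≤ 0<δ))
    (trans (sym (*-identityˡ δ)) (trans (cong (_* δ) (sym 3^Ei≡1)) (lemma (ι (3 ℕ.^ E)) i δ)))
    where
    lemma : ∀ t i δ → t * i * δ ≡ i * δ + (t - 1ℚ) * (i * δ)
    lemma = solve-∀ ℚ-ring

module Precision (E : ℕ) {δ : ℚ} (0<δ : 0ℚ < δ) (δ≤ : δ ≤ + 1 / 64) where
  -- Makes up in advance for the factor `3 ^ E` that `^-close` may lose on powers up to `E`.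
  ε : ℚ
  ε = proj₁ (precision E 0<δ δ≤)

  0<ε : 0ℚ < ε
  0<ε = proj₁ (proj₂ (precision E 0<δ δ≤))

  ε≤ : ε ≤ + 1 / 64
  ε≤ = proj₁ (proj₂ (proj₂ (precision E 0<δ δ≤)))

  3^Eε≤δ : ι (3 ℕ.^ E) * ε ≤ δ
  3^Eε≤δ = proj₂ (proj₂ (proj₂ (precision E 0<δ δ≤)))

small-multiple : ∀ n → 1 ℕ.≤ n → ∃ λ β → 0ℚ < β × ι n * β ≡ + 1 / 2048
small-multiple n 1≤n = scale (recip (0<ι 1≤n))
  where
  scale : (∃ λ i → 0ℚ < i × ι n * i ≡ 1ℚ) → ∃ λ β → 0ℚ < β × ι n * β ≡ + 1 / 2048
  scale (i , 0<i , ni≡1) = (+ 1 / 2048) * i , positive⁻¹ (+ 1 / 2048) *₊ 0<i ,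
    trans (lemma (ι n) i) (cong ((+ 1 / 2048) *_) ni≡1)
    where
    lemma : ∀ n i → n * ((+ 1 / 2048) * i) ≡ (+ 1 / 2048) * (n * i)
    lemma = solve-∀ ℚ-ring

β≤1/2048-identity : ∀ n b → n * b ≡ b + (n - 1ℚ) * b
β≤1/2048-identity = solve-∀ ℚ-ring

tβ≤β-identity : ∀ t b → b ≡ t * b + (1ℚ - t) * b
tβ≤β-identity = solve-∀ ℚ-ring

8δ≡tβ-identity : ∀ s → 8ℚ * ((+ 1 / 8) * s) ≡ s
8δ≡tβ-identity = solve-∀ ℚ-ring

2δ≤tβ-identity : ∀ δ → 8ℚ * δ ≡ 2ℚ * δ + (+ 6 / 1) * δ
2δ≤tβ-identity = solve-∀ ℚ-ring

module Tolerance {n : ℕ} (1≤n : 1 ℕ.≤ n) {t : ℚ} (0<t : 0ℚ < t) (t≤1 : t ≤ 1ℚ) where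
  β : ℚ
  β = proj₁ (small-multiple n 1≤n)

  0<β : 0ℚ < β
  0<β = proj₁ (proj₂ (small-multiple n 1≤n))

  nβ≡ : ι n * β ≡ + 1 / 2048
  nβ≡ = proj₂ (proj₂ (small-multiple n 1≤n))

  β≤1/2048 : β ≤ + 1 / 2048
  β≤1/2048 = subst (β ≤_) nβ≡ (≤-by (0≤- (1≤ι 1≤n) *₀ <⇒≤ 0<β) (β≤1/2048-identity (ι n) β))

  tβ≤β : t * β ≤ β
  tβ≤β = ≤-by (0≤- t≤1 *₀ <⇒≤ 0<β) (tβ≤β-identity t β)

  tβ≤1/2048 : t * β ≤ + 1 / 2048
  tβ≤1/2048 = ≤-trans tβ≤β β≤1/2048

  -- The factor `1 / 8` answers the defect `8 δ` of `start-consecutive`; the cases with `c ≈ 0` need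
  -- only `2 δ`.
  δ : ℚ
  δ = (+ 1 / 8) * (t * β)

  0<δ : 0ℚ < δ
  0<δ = positive⁻¹ (+ 1 / 8) *₊ (0<t *₊ 0<β)

  δ≤1/256 : δ ≤ + 1 / 256
  δ≤1/256 = ≤-trans (*-monoˡ-≤-nonNeg (+ 1 / 8) tβ≤1/2048) (≤-by (nonNegative⁻¹ (+ 1 / 256 - (+ 1 / 8) * (+ 1 / 2048))) refl)

  δ≤1/64 : δ ≤ + 1 / 64
  δ≤1/64 = ≤-trans δ≤1/256 (≤-by (nonNegative⁻¹ (+ 1 / 64 - + 1 / 256)) refl)

  8δ≡tβ : 8ℚ * δ ≡ t * β
  8δ≡tβ = 8δ≡tβ-identity (t * β)

  2δ≤tβ : 2ℚ * δ ≤ t * β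
  2δ≤tβ = ≤-trans (≤-by (nonNegative⁻¹ (+ 6 / 1) *₀ <⇒≤ 0<δ) (2δ≤tβ-identity δ)) (≤-reflexive 8δ≡tβ)

  β≤1/16 : β ≤ + 1 / 16
  β≤1/16 = ≤-trans β≤1/2048 (≤-by (nonNegative⁻¹ (+ 1 / 16 - + 1 / 2048)) refl)

  tβ≤7/8 : t * β ≤ + 7 / 8
  tβ≤7/8 = ≤-trans tβ≤1/2048 (≤-by (nonNegative⁻¹ (+ 7 / 8 - + 1 / 2048)) refl)

0≤3^4 : ∀ A → 0ℚ ≤ ι (3 ℕ.^ A) * 4ℚ
0≤3^4 A = 0≤ι (3 ℕ.^ A) *₀ nonNegative⁻¹ 4ℚ

starts-even : ∀ {q d q′ p′} → 1 ℕ.≤ q → q ≡ 1 ℕ.+ 2 ℕ.* q′ → q ℕ.+ d ≡ 2 ℕ.* p′ → Starts q d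
starts-even {q} {d} {q′} {p′} 1≤q q≡ p≡ t 0<t t≤1 =
  β , 0<β , ≤-reflexive nβ≡ , ι (3 ℕ.^ 2) * 4ℚ , 0≤3^4 2 , λ k r 1≤k kr≡1 0≤r →
  start-even {k} {r} {ε} 1≤k (<⇒≤ 0<ε) {E} {δ} 3^Eε≤δ δ≤1/64 {q} {d} {q′} {p′}
    (quarter-turn 1≤k kr≡1 0≤r (ℕ.s≤s ℕ.z≤n) 0<ε ε≤) q≡ p≡ ℕ.≤-refl β≤1/16 2δ≤tβ tβ≤7/8
  where
  open Tolerance 1≤q 0<t t≤1
  E = 2 ℕ.* (q ℕ.+ d)
  open Precision E 0<δ δ≤1/64

starts-odd : ∀ {q d j j′ h} → 1 ℕ.≤ q → 3 ℕ.≤ d → (q ℕ.+ d) ℕ.* j ≡ 1 ℕ.+ 2 ℕ.* d ℕ.* h → j ≡ 1 ℕ.+ 2 ℕ.* j′ → Starts q d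
starts-odd {q} {d} {j} {j′} {h} 1≤q 3≤d pj≡ j≡ t 0<t t≤1 =
  β , 0<β , ≤-reflexive nβ≡ , ι (3 ℕ.^ (2 ℕ.* j)) * 4ℚ , 0≤3^4 (2 ℕ.* j) , λ k r 1≤k kr≡1 0≤r →
  start-odd {k} {r} {ε} 1≤k (<⇒≤ 0<ε) {E} {δ} 3^Eε≤δ δ≤1/64 {q} {d} {j} {j′} {h}
    (quarter-turn 1≤k kr≡1 0≤r (ℕ.≤-trans (ℕ.s≤s ℕ.z≤n) 3≤d) 0<ε ε≤) 3≤d pj≡ j≡
    (ℕ.m≤m+n (4 ℕ.* h) (2 ℕ.* j)) (ℕ.m≤n+m (2 ℕ.* j) (4 ℕ.* h)) β≤1/16 2δ≤tβ tβ≤7/8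
  where
  open Tolerance 1≤q 0<t t≤1
  E = 4 ℕ.* h ℕ.+ 2 ℕ.* j
  open Precision E 0<δ δ≤1/64

starts-consecutive : ∀ {q q′} → q ≡ 2 ℕ.* q′ → 2 ℕ.≤ q → Starts q 1
starts-consecutive {q} {q′} q≡ 2≤q t 0<t t≤1 =
  β , 0<β , qβ≤ , ι (3 ℕ.^ (4 ℕ.* q)) * 4ℚ , 0≤3^4 (4 ℕ.* q) , λ k r 1≤k kr≡1 0≤r →
  start-consecutive {k} {r} {ε} 1≤k (<⇒≤ 0<ε) {R} {δ} 3^Eε≤δ δ≤1/64 {q} {q′}
    (quarter-turn 1≤k kr≡1 0≤r 1≤R 0<ε ε≤) q≡ 2≤q ℕ.≤-refl 4βR≤1 16δR≤1 δ≤1/256 (≤-reflexive 8δ≡tβ)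
  where
  R = 2 ℕ.* q ℕ.+ 1
  1≤R : 1 ℕ.≤ R
  1≤R = ℕ.m≤n+m 1 (2 ℕ.* q)
  -- Here `Re Q` is only about `sin y` with `R y ≥ 1`, so `β` is scaled by `R` rather than by `q`.
  open Tolerance 1≤R 0<t t≤1
  open Precision R 0<δ δ≤1/64
  qβ≤ : ι q * β ≤ + 1 / 2048
  qβ≤ = subst (ι q * β ≤_) nβ≡ (*-monoʳ₀ (<⇒≤ 0<β) (ι-mono (ℕ.≤-trans (ℕ.m≤n*m q 2) (ℕ.m≤m+n (2 ℕ.* q) 1))))
  4βR≤1 : 4ℚ * β * ι R ≤ 1ℚ
  4βR≤1 = ≤-trans (≤-reflexive (trans (lemma β (ι R)) (cong (4ℚ *_) nβ≡))) (≤-by (nonNegative⁻¹ (1ℚ - + 4 / 2048)) refl)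
    where
    lemma : ∀ b R → 4ℚ * b * R ≡ 4ℚ * (R * b)
    lemma = solve-∀ ℚ-ring
  16δR≤1 : 16ℚ * δ * ι R ≤ 1ℚ
  16δR≤1 = ≤-trans (≤-reflexive (trans (lemma t β (ι R)) (cong (λ s → 2ℚ * t * s) nβ≡)))
    (≤-by (nonNegative⁻¹ (+ 1 / 1024) *₀ 0≤- t≤1 +₀ nonNegative⁻¹ (1ℚ - + 1 / 1024)) (lemma₁ t))
    where
    lemma : ∀ t b R → 16ℚ * ((+ 1 / 8) * (t * b)) * R ≡ 2ℚ * t * (R * b)
    lemma = solve-∀ ℚ-ring
    lemma₁ : ∀ t → 1ℚ ≡ 2ℚ * t * (+ 1 / 2048) + ((+ 1 / 1024) * (1ℚ - t) + (1ℚ - + 1 / 1024))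
    lemma₁ = solve-∀ ℚ-ring

starts-odd-2 : ∀ {q j j′ h} → 1 ℕ.≤ q → (q ℕ.+ 2) ℕ.* j ≡ 1 ℕ.+ 4 ℕ.* h → j ≡ 1 ℕ.+ 2 ℕ.* j′ → Starts q 2
starts-odd-2 {q} {j} {j′} {h} 1≤q pj≡ j≡ t 0<t t≤1 =
  β , 0<β , qβ≤ , ι (3 ℕ.^ A) * 4ℚ , 0≤3^4 A , λ k r 1≤k kr≡1 0≤r →
  start-odd-2 {k} {r} {ε} 1≤k (<⇒≤ 0<ε) {E} {δ} 3^Eε≤δ δ≤1/64 {q} {R} {A} {j} {j′} {h}
    (quarter-turn 1≤k kr≡1 0≤r 1≤R 0<ε ε≤) 1≤R (ℕ.m≤n*m p K′ {{ℕ.>-nonZero 1≤K}}) A≡ pj≡ j≡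
    (ℕ.m≤m+n (1 ℕ.+ 4 ℕ.* h) (2 ℕ.* j)) (ℕ.m≤n+m (2 ℕ.* j) (1 ℕ.+ 4 ℕ.* h))
    0≤ϱ ϱR≡p ϱ≤⅛ 4pϱ²≤1 qδ≤½ 16δ≤ϱ ≤-refl tβ≥
  where
  p = q ℕ.+ 2
  t⁻¹ : ℚ
  t⁻¹ = proj₁ (recip 0<t)
  0≤t⁻¹ : 0ℚ ≤ t⁻¹
  0≤t⁻¹ = <⇒≤ (proj₁ (proj₂ (recip 0<t)))
  tt⁻¹≡1 : t * t⁻¹ ≡ 1ℚ
  tt⁻¹≡1 = proj₂ (proj₂ (recip 0<t))
  -- Makes `ϱ = 1 / K′` so small that `p ϱ ≤ 1 / 512` and `32 ϱ ≤ t`. The latter keeps the quadratic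
  -- defect `4 ϱ²` within half of `t β = t ϱ / 4`; the other half is `16 δ`.
  bound : ∃ λ n → 1 ℕ.≤ n × (+ 512 / 1) * ι p + 32ℚ * t⁻¹ ≤ ι n
  bound = archimedean ((+ 512 / 1) * ι p + 32ℚ * t⁻¹)
  K′ : ℕ
  K′ = proj₁ bound
  1≤K : 1 ℕ.≤ K′
  1≤K = proj₁ (proj₂ bound)
  1≤p : 1 ℕ.≤ p
  1≤p = ℕ.≤-trans 1≤q (ℕ.m≤m+n q 2)
  R = K′ ℕ.* p
  1≤R : 1 ℕ.≤ R
  1≤R = ℕ.*-mono-≤ 1≤K 1≤p
  -- The predecessor is the small rotation back by the angle `y`.
  A = ℕ.pred (R ℕ.* j)
  A≡ : suc A ≡ R ℕ.* j
  A≡ = ℕ.suc-pred (R ℕ.* j) {{ℕ.>-nonZero (ℕ.*-mono-≤ 1≤R (subst (1 ℕ.≤_) (sym j≡) (ℕ.s≤s ℕ.z≤n)))}}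
  ϱ : ℚ
  ϱ = proj₁ (recip (0<ι 1≤K))
  0<ϱ : 0ℚ < ϱ
  0<ϱ = proj₁ (proj₂ (recip (0<ι 1≤K)))
  0≤ϱ : 0ℚ ≤ ϱ
  0≤ϱ = <⇒≤ 0<ϱ
  Kϱ≡1 : ι K′ * ϱ ≡ 1ℚ
  Kϱ≡1 = proj₂ (proj₂ (recip (0<ι 1≤K)))
  ϱR≡p : ϱ * ι R ≡ ι p
  ϱR≡p = trans (cong (ϱ *_) (ι-* K′ p)) (trans (lemma ϱ (ι K′) (ι p)) (trans (cong (_* ι p) Kϱ≡1) (*-identityˡ (ι p))))
    where
    lemma : ∀ a b c → a * (b * c) ≡ b * a * c
    lemma = solve-∀ ℚ-ring
  sum≤1 : ((+ 512 / 1) * ι p + 32ℚ * t⁻¹) * ϱ ≤ 1ℚ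
  sum≤1 = subst (((+ 512 / 1) * ι p + 32ℚ * t⁻¹) * ϱ ≤_) Kϱ≡1 (*-monoʳ₀ 0≤ϱ (proj₂ (proj₂ bound)))
  pϱ≤ : ι p * ϱ ≤ + 1 / 512
  pϱ≤ = ≤-by (nonNegative⁻¹ (+ 1 / 512) *₀ (0≤- sum≤1 +₀ nonNegative⁻¹ 32ℚ *₀ 0≤t⁻¹ *₀ 0≤ϱ)) (lemma (ι p) t⁻¹ ϱ)
    where
    lemma : ∀ p s ϱ → + 1 / 512 ≡ p * ϱ + (+ 1 / 512) * ((1ℚ - ((+ 512 / 1) * p + 32ℚ * s) * ϱ) + 32ℚ * s * ϱ)
    lemma = solve-∀ ℚ-ring
  qϱ≤ : ι q * ϱ ≤ + 1 / 512
  qϱ≤ = ≤-trans (*-monoʳ₀ 0≤ϱ (ι-mono (ℕ.m≤m+n q 2))) pϱ≤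
  ϱ≤ : ϱ ≤ + 1 / 512
  ϱ≤ = ≤-trans (≤-by (0≤- (1≤ι 1≤p) *₀ 0≤ϱ) (lemma (ι p) ϱ)) pϱ≤
    where
    lemma : ∀ n b → n * b ≡ b + (n - 1ℚ) * b
    lemma = solve-∀ ℚ-ring
  ϱ≤⅛ : ϱ ≤ + 1 / 8
  ϱ≤⅛ = ≤-trans ϱ≤ (≤-by (nonNegative⁻¹ (+ 1 / 8 - + 1 / 512)) refl)
  32ϱ≤t : 32ℚ * ϱ ≤ t
  32ϱ≤t = ≤-by (<⇒≤ 0<t *₀ (0≤- sum≤1 +₀ nonNegative⁻¹ (+ 512 / 1) *₀ 0≤ι p *₀ 0≤ϱ))
    (trans (lemma t (ι p) t⁻¹ ϱ) (cong (_+ t * ((1ℚ - ((+ 512 / 1) * ι p + 32ℚ * t⁻¹) * ϱ) + (+ 512 / 1) * ι p * ϱ))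
      (trans (cong (λ s → 32ℚ * ϱ * s) tt⁻¹≡1) (*-identityʳ (32ℚ * ϱ)))))
    where
    lemma : ∀ t p s ϱ → t ≡ 32ℚ * ϱ * (t * s) + t * ((1ℚ - ((+ 512 / 1) * p + 32ℚ * s) * ϱ) + (+ 512 / 1) * p * ϱ)
    lemma = solve-∀ ℚ-ring
  4pϱ²≤1 : 4ℚ * ι p * (ϱ * ϱ) ≤ 1ℚ
  4pϱ²≤1 = ≤-by (nonNegative⁻¹ 4ℚ *₀ (0≤- pϱ≤ *₀ 0≤ϱ) +₀ nonNegative⁻¹ (+ 4 / 512) *₀ 0≤- ϱ≤ +₀ nonNegative⁻¹ (1ℚ - (+ 4 / 512) * (+ 1 / 512)))
    (lemma (ι p) ϱ)
    where
    lemma : ∀ p ϱ → 1ℚ ≡ 4ℚ * p * (ϱ * ϱ) + (4ℚ * (((+ 1 / 512) - p * ϱ) * ϱ) + (+ 4 / 512) * ((+ 1 / 512) - ϱ) + (1ℚ - (+ 4 / 512) * (+ 1 / 512)))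
    lemma = solve-∀ ℚ-ring
  β δ : ℚ
  β = (+ 1 / 4) * ϱ
  δ = (+ 1 / 128) * (t * ϱ)
  0<β : 0ℚ < β
  0<β = positive⁻¹ (+ 1 / 4) *₊ 0<ϱ
  0<δ : 0ℚ < δ
  0<δ = positive⁻¹ (+ 1 / 128) *₊ (0<t *₊ 0<ϱ)
  tϱ≤ϱ : t * ϱ ≤ ϱ
  tϱ≤ϱ = ≤-by (0≤- t≤1 *₀ 0≤ϱ) (lemma t ϱ)
    where
    lemma : ∀ t b → b ≡ t * b + (1ℚ - t) * b
    lemma = solve-∀ ℚ-ring
  δ≤1/64 : δ ≤ + 1 / 64
  δ≤1/64 = ≤-trans (*-monoˡ-≤-nonNeg (+ 1 / 128) (≤-trans tϱ≤ϱ ϱ≤)) (≤-by (nonNegative⁻¹ (+ 1 / 64 - (+ 1 / 128) * (+ 1 / 512))) refl)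
  qβ≤ : ι q * β ≤ + 1 / 2048
  qβ≤ = ≤-trans (≤-reflexive (lemma (ι q) ϱ)) (*-monoˡ-≤-nonNeg (+ 1 / 4) qϱ≤)
    where
    lemma : ∀ q ϱ → q * ((+ 1 / 4) * ϱ) ≡ (+ 1 / 4) * (q * ϱ)
    lemma = solve-∀ ℚ-ring
  qδ≤½ : ι q * δ ≤ ½
  qδ≤½ = ≤-by (nonNegative⁻¹ (+ 1 / 128) *₀ (0≤ι q *₀ 0≤- tϱ≤ϱ +₀ 0≤- qϱ≤) +₀ nonNegative⁻¹ (½ - (+ 1 / 128) * (+ 1 / 512))) (lemma (ι q) t ϱ)
    where
    lemma : ∀ q t ϱ → ½ ≡ q * ((+ 1 / 128) * (t * ϱ)) + ((+ 1 / 128) * (q * (ϱ - t * ϱ) + ((+ 1 / 512) - q * ϱ)) + (½ - (+ 1 / 128) * (+ 1 / 512)))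
    lemma = solve-∀ ℚ-ring
  16δ≤ϱ : 16ℚ * δ ≤ ϱ
  16δ≤ϱ = ≤-by (nonNegative⁻¹ (+ 1 / 8) *₀ 0≤- tϱ≤ϱ +₀ nonNegative⁻¹ (+ 7 / 8) *₀ 0≤ϱ) (lemma t ϱ)
    where
    lemma : ∀ t ϱ → ϱ ≡ 16ℚ * ((+ 1 / 128) * (t * ϱ)) + ((+ 1 / 8) * (ϱ - t * ϱ) + (+ 7 / 8) * ϱ)
    lemma = solve-∀ ℚ-ring
  tβ≥ : 4ℚ * (ϱ * ϱ) + 16ℚ * δ ≤ t * β
  tβ≥ = ≤-by (nonNegative⁻¹ (+ 1 / 8) *₀ 0≤- 32ϱ≤t *₀ 0≤ϱ) (lemma t ϱ)
    where
    lemma : ∀ t ϱ → t * ((+ 1 / 4) * ϱ) ≡ (4ℚ * (ϱ * ϱ) + 16ℚ * ((+ 1 / 128) * (t * ϱ))) + (+ 1 / 8) * (t - 32ℚ * ϱ) * ϱ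
    lemma = solve-∀ ℚ-ring
  E = 1 ℕ.+ 4 ℕ.* h ℕ.+ 2 ℕ.* j
  open Precision E 0<δ δ≤1/64

-- The parities leave no gap: if `p` is even then `q` is odd by coprimality, and if `p` is odd and
-- `d = 1` then `q` is even, hence at least `2`.
starts : ∀ q d → 1 ℕ.≤ q → 1 ℕ.≤ d → Coprime (q ℕ.+ d) q → Starts q d
starts q d 1≤q 1≤d coprime = by-parity (parity (q ℕ.+ d)) (parity q)
  where
  coprime-d : Coprime (q ℕ.+ d) d
  coprime-d {i} (i∣p , i∣d) = coprime (i∣p , ∣m+n∣m⇒∣n (subst (i ∣_) (ℕ.+-comm q d) i∣p) i∣d)
  by-difference : ∀ {p′} d → 1 ℕ.≤ d → Coprime (q ℕ.+ d) d → q ℕ.+ d ≡ 1 ℕ.+ 2 ℕ.* p′ →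
    (∃ λ m → q ≡ 2 ℕ.* m) ⊎ (∃ λ m → q ≡ 1 ℕ.+ 2 ℕ.* m) → Starts q d
  by-difference 1 _ _ p≡ (inj₁ (q′ , q≡)) = starts-consecutive {q} {q′} q≡ (2≤q q′ q≡)
    where
    2≤q : ∀ q′ → q ≡ 2 ℕ.* q′ → 2 ℕ.≤ q
    2≤q zero     q≡0 = ⊥-elim (ℕ.n≮0 (subst (1 ℕ.≤_) q≡0 1≤q))
    2≤q (suc q′) q≡  = subst (2 ℕ.≤_) (sym q≡) (ℕ.*-monoʳ-≤ 2 (ℕ.s≤s (ℕ.z≤n {q′})))
  by-difference {p′} 1 _ _ p≡ (inj₂ (q′ , q≡)) = ⊥-elim (ℕ.even≢odd (suc q′) p′ (trans (lemma q′) (trans (cong (ℕ._+ 1) (sym q≡)) p≡)))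
    where
    lemma : ∀ n → 2 ℕ.* (1 ℕ.+ n) ≡ 1 ℕ.+ 2 ℕ.* n ℕ.+ 1
    lemma = solve-∀ℕ
  by-difference {p′} 2 _ coprime-d p≡ _ = from-inverse (odd-inverse {p′ = p′} coprime-d p≡)
    where
    from-inverse : _ → Starts q 2
    from-inverse (j , h , pj≡ , j′ , j≡) = starts-odd-2 {q} {j} {j′} {h} 1≤q pj≡ j≡
  by-difference {p′} d@(suc (suc (suc _))) _ coprime-d p≡ _ = from-inverse (odd-inverse {p′ = p′} coprime-d p≡)
    where
    from-inverse : _ → Starts q d
    from-inverse (j , h , pj≡ , j′ , j≡) = starts-odd {q} {d} {j} {j′} {h} 1≤q (ℕ.s≤s (ℕ.s≤s (ℕ.s≤s ℕ.z≤n))) pj≡ j≡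
  by-parity : (∃ λ m → q ℕ.+ d ≡ 2 ℕ.* m) ⊎ (∃ λ m → q ℕ.+ d ≡ 1 ℕ.+ 2 ℕ.* m) →
    (∃ λ m → q ≡ 2 ℕ.* m) ⊎ (∃ λ m → q ≡ 1 ℕ.+ 2 ℕ.* m) → Starts q d
  by-parity (inj₁ (p′ , p≡)) (inj₂ (q′ , q≡)) = starts-even {q} {d} {q′} {p′} 1≤q q≡ p≡
  by-parity (inj₁ (p′ , p≡)) (inj₁ (q′ , q≡)) = ⊥-elim (2≢1 (coprime (divides p′ (trans p≡ (ℕ.*-comm 2 p′)) , divides q′ (trans q≡ (ℕ.*-comm 2 q′)))))
    where
    2≢1 : 2 ≢ 1
    2≢1 ()
  by-parity (inj₂ (p′ , p≡)) parity-q = by-difference {p′} d 1≤d coprime-d p≡ parity-q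

-- From `ℓ` to the exponents

/1-*-cong : ∀ {a b m n} .(c : Coprime a (suc b)) → mkℚ (+ a) b c * (+ m / 1) ≡ + n / 1 → a ℕ.* m ≡ n ℕ.* suc b
/1-*-cong {a} {b} {m} {n} c eq = ℤ.+-injective (begin
  + (a ℕ.* m)                           ≡⟨ ℤ.pos-* a m ⟩
  + a ℤ.* + m                           ≡⟨ ℤ.*-identityʳ (+ a ℤ.* + m) ⟨
  + a ℤ.* + m ℤ.* + 1                   ≡⟨ ℚᵘ.drop-*≡* ≃ᵘ ⟩
  + n ℤ.* + (suc b ℕ.* 1)               ≡⟨ cong (λ t → + n ℤ.* + t) (ℕ.*-identityʳ (suc b)) ⟩
  + n ℤ.* + suc b                       ≡⟨ ℤ.pos-* n (suc b) ⟨
  + (n ℕ.* suc b)                       ∎)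
  where
  open ≡-Reasoning
  ≃ᵘ : ℚᵘ.mkℚᵘ (+ a) b ℚᵘ.* ℚᵘ.mkℚᵘ (+ m) 0 ℚᵘ.≃ ℚᵘ.mkℚᵘ (+ n) 0
  ≃ᵘ = ℚᵘ.≃-trans (ℚᵘ.*-congˡ {ℚᵘ.mkℚᵘ (+ a) b} (ℚᵘ.≃-sym (toℚᵘ-fromℚᵘ (ℚᵘ.mkℚᵘ (+ m) 0))))
    (ℚᵘ.≃-trans (ℚᵘ.≃-sym (toℚᵘ-homo-* (mkℚ (+ a) b c) (+ m / 1)))
      (ℚᵘ.≃-trans (toℚᵘ-cong eq) (toℚᵘ-fromℚᵘ (ℚᵘ.mkℚᵘ (+ n) 0))))

theorem4 : (ℓ : ℚ) → 1ℚ < ℓ → ∃ λ (N : ℕ) →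
    (m n : ℕ) → m > N → ℓ * (+ m / 1) ≡ + n / 1 →
    ¬ Stable (K m n) × (∃ λ z → IsRoot (K m n) z × 0ℝ <ℝ Re z)
theorem4 (mkℚ (ℤ.-[1+ _ ]) b c) 1<ℓ = ⊥-elim (1≮negative 1<ℓ)
  where
  1≮negative : ∀ {a b} .{c : Coprime (suc a) (suc b)} → ¬ 1ℚ < mkℚ (ℤ.-[1+ a ]) b c
  1≮negative (*<* ())
-- Coprimality of `a` and `q` turns `a m = n q` into `m = q k`, and for such `m` exceeding `q k₀`
-- means `k > k₀`; in particular `k` is positive.
theorem4 (mkℚ (+ a) b c) 1<ℓ = q ℕ.* k₀ , λ m n m>N ℓm≡n → conclude m n m>N (/1-*-cong {a} {b} {m} {n} c ℓm≡n)
  where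
  q = suc b
  q<a : q ℕ.< a
  q<a = ℤ.drop‿+<+ (subst₂ ℤ._<_ (ℤ.*-identityˡ (+ q)) (ℤ.*-identityʳ (+ a)) (drop-*<* 1<ℓ))
  d = a ℕ.∸ q
  q+d≡a : q ℕ.+ d ≡ a
  q+d≡a = ℕ.m+[n∸m]≡n (ℕ.<⇒≤ q<a)
  1≤d : 1 ℕ.≤ d
  1≤d = ℕ.m<n⇒0<n∸m q<a
  coprime : Coprime a q
  coprime = Coprime.recompute c
  open FromStarts {q} {d} (ℕ.s≤s ℕ.z≤n) 1≤d
    (starts q d (ℕ.s≤s ℕ.z≤n) 1≤d (subst (λ t → Coprime t q) (sym q+d≡a) coprime))
  conclude : ∀ m n → m > q ℕ.* k₀ → a ℕ.* m ≡ n ℕ.* q →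
    ¬ Stable (K m n) × (∃ λ z → IsRoot (K m n) z × 0ℝ <ℝ Re z)
  conclude m n m>N am≡nq = unstable {G = K m n} positive-root , positive-root
    where
    q∣m : q ∣ m
    q∣m = coprime-divisor (Coprime.sym coprime) (divides n am≡nq)
    k : ℕ
    k = ℕ.quotient q∣m
    m≡qk : m ≡ q ℕ.* k
    m≡qk = trans (_∣_.equality q∣m) (ℕ.*-comm k q)
    n≡pk : n ≡ (q ℕ.+ d) ℕ.* k
    n≡pk = ℕ.*-cancelʳ-≡ n ((q ℕ.+ d) ℕ.* k) q (trans (sym am≡nq) (trans (cong (a ℕ.*_) m≡qk)
      (trans (lemma a q k) (cong (λ t → t ℕ.* k ℕ.* q) (sym q+d≡a)))))
      where
      lemma : ∀ a q k → a ℕ.* (q ℕ.* k) ≡ a ℕ.* k ℕ.* q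
      lemma = solve-∀ℕ
    k₀<k : k₀ ℕ.< k
    k₀<k = ℕ.*-cancelˡ-< q k₀ k (subst (q ℕ.* k₀ ℕ.<_) m≡qk m>N)
    positive-root : ∃ λ z → IsRoot (K m n) z × 0ℝ <ℝ Re z
    positive-root = subst₂ (λ m n → ∃ λ z → IsRoot (K m n) z × 0ℝ <ℝ Re z) (sym m≡qk) (sym n≡pk)
      (root k (ℕ.<⇒≤ k₀<k) (ℕ.≤-trans (ℕ.s≤s ℕ.z≤n) k₀<k))
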